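{- Fix positive integers $d$ and $w$. For every $\epsilon>0$ there is an $N$ such that every finite convex subset $P$ of $\mathbb{N}^d$ (with the induced order) with $w(P)\in\{2,\dots,w\}$ and $|P|>N$ satisfies $\delta(P)>1/2-\epsilon$.
   Context: $\mathbb{N}$ is the set of positive integers and $\mathbb{N}^d$ carries the product (coordinatewise) order. $Q\subseteq\mathbb{N}^d$ is convex if $x,z\in Q$ and $x<y<z$ imply $y\in Q$. $w(P)$ is the width (maximum antichain size). For a uniformly random linear extension $\prec$ of $P$ and distinct $x,y\in P$, $\delta_{xy}=\min\{\mathbb{P}(x\prec y),\mathbb{P}(y\prec x)\}$, and $\delta(P)=\max\delta_{xy}$ over distinct $x,y\in P$. -}

module Defs where

open import Data.Bool using (Bool; true; false; _∧_; not; if_then_else_)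
open import Data.Nat as ℕ using (ℕ; zero; suc; _≤_)
import Data.Nat.Properties as ℕP
open import Data.Integer using (+_)
open import Data.Rational using (ℚ; 0ℚ; _/_; _⊔_)
open import Data.List using (List; []; _∷_; _++_; length; map; concatMap; filterᵇ; foldr)
open import Data.List.Membership.Propositional using (_∈_)
open import Data.List.Relation.Unary.AllPairs using (AllPairs)
open import Data.Vec using (Vec)
import Data.Vec.Properties as VecP
open import Data.Vec.Relation.Binary.Pointwise.Inductive using (Pointwise; decidable)
open import Data.Product using (Σ; _×_; ∃-syntax)
open import Relation.Nullary using (¬_; Dec; yes; no; does)
open import Relation.Binary.PropositionalEquality using (_≡_; _≢_)

-- Points of ℕ^d (coordinates are naturals; positivity is imposed separately).
Pt : ℕ → Set
Pt d = Vec ℕ d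

_≤ᵖ_ : ∀ {d} → Pt d → Pt d → Set
x ≤ᵖ y = Pointwise _≤_ x y

_<ᵖ_ : ∀ {d} → Pt d → Pt d → Set
x <ᵖ y = x ≤ᵖ y × x ≢ y

_≤ᵖ?_ : ∀ {d} (x y : Pt d) → Dec (x ≤ᵖ y)
x ≤ᵖ? y = decidable ℕ._≤?_ x y

_≟ᵖ_ : ∀ {d} (x y : Pt d) → Dec (x ≡ y)
x ≟ᵖ y = VecP.≡-dec ℕ._≟_ x y

ltᵇ : ∀ {d} → Pt d → Pt d → Bool
ltᵇ x y = does (x ≤ᵖ? y) ∧ not (does (x ≟ᵖ y))

eqᵇ : ∀ {d} → Pt d → Pt d → Bool
eqᵇ x y = does (x ≟ᵖ y)

memᵇ : ∀ {d} → Pt d → List (Pt d) → Bool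
memᵇ x [] = false
memᵇ x (y ∷ ys) = if eqᵇ x y then true else memᵇ x ys

-- A finite subset P of ℕ^d is given as a duplicate-free list of points.
-- Convexity: x, z ∈ P and x < y < z imply y ∈ P.
Convex : ∀ {d} → List (Pt d) → Set
Convex {d} P = ∀ (x y z : Pt d) → x ∈ P → z ∈ P → x <ᵖ y → y <ᵖ z → y ∈ P

IsAntichain : ∀ {d} → List (Pt d) → List (Pt d) → Set
IsAntichain P A =
  (∀ {a} → a ∈ A → a ∈ P) × AllPairs (λ a b → ¬ (a ≤ᵖ b) × ¬ (b ≤ᵖ a)) A

IsWidth : ∀ {d} → List (Pt d) → ℕ → Set
IsWidth {d} P k =
  (Σ (List (Pt d)) λ A → IsAntichain P A × length A ≡ k)
  × (∀ A → IsAntichain P A → length A ≤ k)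

-- All permutations of a list (for a duplicate-free list, these are distinct).
insertions : ∀ {A : Set} → A → List A → List (List A)
insertions x [] = (x ∷ []) ∷ []
insertions x (y ∷ ys) = (x ∷ y ∷ ys) ∷ map (y ∷_) (insertions x ys)

perms : ∀ {A : Set} → List A → List (List A)
perms [] = [] ∷ []
perms (x ∷ xs) = concatMap (insertions x) (perms xs)

allᵇ : ∀ {A : Set} → (A → Bool) → List A → Bool
allᵇ p [] = true
allᵇ p (x ∷ xs) = p x ∧ allᵇ p xs

respectsᵇ : ∀ {d} → List (Pt d) → Bool
respectsᵇ [] = true
respectsᵇ (z ∷ L) = allᵇ (λ u → not (ltᵇ u z)) L ∧ respectsᵇ L

linExts : ∀ {d} → List (Pt d) → List (List (Pt d))
linExts P = filterᵇ respectsᵇ (perms P)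

beforeᵇ : ∀ {d} → Pt d → Pt d → List (Pt d) → Bool
beforeᵇ x y [] = false
beforeᵇ x y (z ∷ L) =
  if eqᵇ z x then memᵇ y L else (if eqᵇ z y then false else beforeᵇ x y L)

-- a / n as a rational (n = 0 never occurs for a nonempty poset; set to 0).
frac : ℕ → ℕ → ℚ
frac a zero = 0ℚ
frac a (suc n) = + a / suc n

prob : ∀ {d} → List (Pt d) → Pt d → Pt d → ℚ
prob P x y = frac (length (filterᵇ (beforeᵇ x y) (linExts P))) (length (linExts P))

δxy : ∀ {d} → List (Pt d) → Pt d → Pt d → ℚ
δxy P x y = Data.Rational._⊓_ (prob P x y) (prob P y x)
  where import Data.Rational

-- δ(P) = max of δ_xy over ordered pairs of distinct elements of P
-- (all δ_xy ≥ 0, so folding from 0 gives the maximum when |P| ≥ 2).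
δ : ∀ {d} → List (Pt d) → ℚ
δ P = foldr _⊔_ 0ℚ
  (concatMap (λ x → map (δxy P x) (filterᵇ (λ y → not (eqᵇ x y)) P)) P)

{-# OPTIONS --safe #-}
-- A convex P of bounded width contains a long chain, hence a long segment of a coordinate line; descending from
-- it as far as possible yields an initial segment of P which is a chain (as) of length proportional to |P|, and
-- the same inside P ∖ as yields a second chain (bs).
-- A linear extension amounts to an arrangement of P ∖ as together with the numbers of letters (elements of as)
-- inserted just before each of its elements. Moving letters forward never violates an order relation, so
-- probabilities are compared by injections that move letters.
-- Let X be the number of letters preceding some b ∈ bs. If every value of X has probability below 1/K, then the
-- first element of as that precedes b with probability below ½ does so with probability above ½ − 1/K.
-- If P ∖ as is much smaller than as, moving one letter shows that consecutive values of X are nearly equally likely.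
-- Otherwise let i < j: given everything else, the number of letters just before bᵢ is uniform on an interval
-- {l, …, s}, where s also counts the letters just before bⱼ, and the mean of l is the difference of the mean numbers
-- of letters before bᵢ and bⱼ. These means decrease along bs, so they are nearly constant on some long window,
-- and there some pair around the centre b very likely has l = 0 and s large, which spreads X.
module Submission where

open import Defs
open import Data.Nat using (ℕ; _≤_; _<_)
open import Data.Rational using (ℚ; 0ℚ; ½; _-_) renaming (_<_ to _<ℚ_)
open import Data.List using (List; length)
open import Data.List.Relation.Unary.All using (All)
open import Data.List.Relation.Unary.Unique.Propositional using (Unique)
open import Data.Vec.Relation.Unary.All using () renaming (All to AllV)
open import Data.Product using (Σ; _×_; ∃-syntax)

import Data.Nat.Properties as ℕP
open import Algebra.Properties.CommutativeSemigroup ℕP.+-commutativeSemigroup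
  using () renaming (interchange to +-interchange; x∙yz≈y∙xz to +-x∙yz≈y∙xz; xy∙z≈zy∙x to +-xy∙z≈zy∙x; xy∙z≈xz∙y to +-xy∙z≈xz∙y)
open import Algebra.Properties.CommutativeSemigroup ℕP.*-commutativeSemigroup
  using () renaming (x∙yz≈y∙xz to *-x∙yz≈y∙xz; x∙yz≈z∙yx to *-x∙yz≈z∙yx; x∙yz≈z∙xy to *-x∙yz≈z∙xy;
    x∙yz≈y∙zx to *-x∙yz≈y∙zx; x∙yz≈yx∙z to *-x∙yz≈yx∙z; xy∙z≈y∙xz to *-xy∙z≈y∙xz)
open import Data.Bool using (Bool; true; false; not; _∧_; if_then_else_)
import Data.Bool as Bool
import Data.Bool.Properties as Bool
open import Data.Fin using (Fin; fromℕ<; zero; suc)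
import Data.Fin.Properties as Fin
import Data.Integer as ℤ
import Data.Integer.Properties as ℤP
open import Data.List using ([]; _∷_; _++_; [_]; map; concatMap; filter; filterᵇ; foldr; take; drop; downFrom; applyDownFrom)
import Data.List.Membership.DecPropositional as Mem
open import Data.List.Membership.Propositional using (_∈_; _∉_; find)
open import Data.List.Membership.Propositional.Properties
  using (∈-map⁺; ∈-map⁻; ∈-++⁺ˡ; ∈-++⁺ʳ; ∈-++⁻; ∈-∃++; ∈-filter⁺; ∈-filter⁻; ∈-concatMap⁺; ∈-concatMap⁻;
    ∈-downFrom⁺; ∈-downFrom⁻; ∈-applyDownFrom⁻)
open import Data.List.Membership.Propositional.Properties.WithK using (unique∧set⇒bag)
import Data.List.Properties as ListP
open import Data.List.Properties using (length-downFrom; filter-accept; filter-reject; filter-all)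
open import Data.List.Relation.Binary.BagAndSetEquality using (∼bag⇒↭)
open import Data.List.Relation.Binary.Disjoint.Propositional using (Disjoint)
open import Data.List.Relation.Binary.Permutation.Propositional
  using (_↭_; ↭-refl; ↭-sym; ↭-trans; ↭-reflexive; prep; swap; ↭⇒↭ₛ)
import Data.List.Relation.Binary.Permutation.Propositional.Properties as Perm
open import Data.List.Relation.Binary.Permutation.Propositional.Properties using (∈-resp-↭; shift; drop-mid; ↭-length)
import Data.List.Relation.Binary.Permutation.Setoid.Properties as PermS
open import Data.List.Relation.Unary.All as All using ([]; _∷_)
import Data.List.Relation.Unary.All.Properties as AllP
open import Data.List.Relation.Unary.AllPairs as AllPairs using (AllPairs; []; _∷_)
import Data.List.Relation.Unary.AllPairs.Properties as AllPairsP
open import Data.List.Relation.Unary.Any as Any using (Any; here; there)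
open import Data.List.Relation.Unary.Linked.Properties using (Linked⇒AllPairs)
import Data.List.Relation.Unary.Unique.Propositional.Properties as UniqueP
open import Data.List.Relation.Unary.Unique.Propositional.Properties using (downFrom⁺)
import Data.List.Sort
open import Data.Maybe using (Maybe; just; nothing)
import Data.Maybe.Properties as Maybe
open import Data.Nat hiding (_≟_)
open import Data.Nat.Properties hiding (_≟_)
open import Data.Nat.DivMod using (m/n*n≤m; m≡m%n+[m/n]*n; m%n<n)
open import Data.Nat.Tactic.RingSolver using (solve-∀)
open import Data.Product using (_,_; proj₁; proj₂)
import Data.Product.Properties as Prod
open import Data.Rational as ℚ using (mkℚ; toℚᵘ; ↧ₙ_)
import Data.Rational.Properties as ℚP
open import Data.Rational.Unnormalised as ℚᵘ using (mkℚᵘ)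
import Data.Rational.Unnormalised.Properties as ℚᵘP
open import Data.Sum using (_⊎_; inj₁; inj₂)
open import Data.Unit using (⊤)
open import Data.Vec using ([]; _∷_; lookup; _[_]≔_; sum; replicate)
import Data.Vec.Properties as VecP
import Data.Vec.Relation.Binary.Pointwise.Inductive as PW
open import Data.Vec.Relation.Binary.Pointwise.Inductive using ([]; _∷_)
open import Function using (mk⇔)
import Relation.Binary.Construct.On as On
open import Relation.Binary.Definitions using (DecidableEquality; tri<; tri≈; tri>)
open import Relation.Binary.PropositionalEquality
  using (_≡_; _≢_; refl; sym; trans; cong; cong₂; subst; subst₂; setoid)
open import Relation.Nullary using (¬_; Dec; yes; no; contradiction; ¬?; _×-dec_; _⊎-dec_; _→-dec_)
open import Relation.Nullary.Decidable using (T?; dec-true; dec-false; decidable-stable)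


-- Finite sums

-- Letters can be moved forward only while some are left further on, so the argument at a value of X
-- needs a fixed fraction of the chain still to come. With `as` of length about 8g, the last eighth
-- serves: the relevant elements of `bs` precede the element of `as` of index 7g with probability
-- above ½. This is shown with the roles exchanged, `bs` giving the letters and `as` lying among the
-- columns. Not every column is free then; only the gaps between indices 2g and 7g may safely
-- receive further elements of `bs`, and for this reason the second chain is sought among the
-- elements that are not above the one of index 2g. The other obstacle is that a given pair of
-- columns may carry few letters. So T pairs are tried at once. If all of them carry fewer than R
-- letters, then R letters could be fed into any one of T columns with disjoint outcomes, at a price
-- c ^ R that does not depend on T. Hence the order of the constants: R beats K, T beats c ^ R, and
-- ρ, the number of candidate windows, beats T; none of them depends on the size of P.

𝟙 : {A : Set} → Dec A → ℕ
𝟙 (yes _) = 1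
𝟙 (no _) = 0

𝟙≤1 : {A : Set} (a? : Dec A) → 𝟙 a? ≤ 1
𝟙≤1 (yes _) = ≤-refl
𝟙≤1 (no _) = z≤n

𝟙-yes : {A : Set} (a? : Dec A) → A → 𝟙 a? ≡ 1
𝟙-yes (yes _) a = refl
𝟙-yes (no ¬a) a = contradiction a ¬a

𝟙-no : {A : Set} (a? : Dec A) → ¬ A → 𝟙 a? ≡ 0
𝟙-no (yes a) ¬a = contradiction a ¬a
𝟙-no (no _) ¬a = refl

𝟙-mono : {A B : Set} (a? : Dec A) (b? : Dec B) → (A → B) → 𝟙 a? ≤ 𝟙 b?
𝟙-mono (yes a) b? f = ≤-reflexive (sym (𝟙-yes b? (f a)))
𝟙-mono (no _) b? f = z≤n

𝟙-bound : {A : Set} (a? : Dec A) {x y : ℕ} → (A → x ≤ y) → 𝟙 a? * x ≤ 𝟙 a? * y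
𝟙-bound (yes a) f = *-monoʳ-≤ 1 (f a)
𝟙-bound (no _) f = z≤n

𝟙-pos : {A : Set} (a? : Dec A) {x : ℕ} → 0 < 𝟙 a? * x → A × 0 < x
𝟙-pos (yes a) {x} p = a , subst (0 <_) (+-identityʳ x) p

𝟙-true : {A : Set} (a? : Dec A) → 0 < 𝟙 a? → A
𝟙-true (yes a) _ = a

module _ {A : Set} where

  ∑ : List A → (A → ℕ) → ℕ
  ∑ [] g = 0
  ∑ (x ∷ xs) g = g x + ∑ xs g

  ∑-mono : ∀ xs {g h : A → ℕ} → (∀ {x} → x ∈ xs → g x ≤ h x) → ∑ xs g ≤ ∑ xs h
  ∑-mono [] le = z≤n
  ∑-mono (x ∷ xs) le = +-mono-≤ (le (here refl)) (∑-mono xs (λ m → le (there m)))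

  ∑-cong : ∀ xs {g h : A → ℕ} → (∀ {x} → x ∈ xs → g x ≡ h x) → ∑ xs g ≡ ∑ xs h
  ∑-cong [] eq = refl
  ∑-cong (x ∷ xs) eq = cong₂ _+_ (eq (here refl)) (∑-cong xs (λ m → eq (there m)))

  ∑-+ : ∀ xs (g h : A → ℕ) → ∑ xs (λ x → g x + h x) ≡ ∑ xs g + ∑ xs h
  ∑-+ [] g h = refl
  ∑-+ (x ∷ xs) g h rewrite ∑-+ xs g h = +-interchange (g x) (h x) (∑ xs g) (∑ xs h)

  ∑-* : ∀ xs (g : A → ℕ) c → ∑ xs (λ x → g x * c) ≡ ∑ xs g * c
  ∑-* [] g c = refl
  ∑-* (x ∷ xs) g c rewrite ∑-* xs g c = sym (*-distribʳ-+ c (g x) (∑ xs g))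

  ∑-const : ∀ xs c → ∑ xs (λ _ → c) ≡ length xs * c
  ∑-const [] c = refl
  ∑-const (x ∷ xs) c = cong (c +_) (∑-const xs c)

  ∑-0 : ∀ xs → ∑ xs (λ _ → 0) ≡ 0
  ∑-0 [] = refl
  ∑-0 (x ∷ xs) = ∑-0 xs

  ∑-++ : ∀ xs ys (g : A → ℕ) → ∑ (xs ++ ys) g ≡ ∑ xs g + ∑ ys g
  ∑-++ [] ys g = refl
  ∑-++ (x ∷ xs) ys g rewrite ∑-++ xs ys g = sym (+-assoc (g x) _ _)

  ∑-↭ : ∀ {xs ys} (g : A → ℕ) → xs ↭ ys → ∑ xs g ≡ ∑ ys g
  ∑-↭ g _↭_.refl = refl
  ∑-↭ g (prep x p) = cong (g x +_) (∑-↭ g p)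
  ∑-↭ g (swap x y p) rewrite ∑-↭ g p = +-x∙yz≈y∙xz (g x) (g y) _
  ∑-↭ g (_↭_.trans p q) = trans (∑-↭ g p) (∑-↭ g q)

  ∑-member : ∀ {xs x} (g : A → ℕ) → x ∈ xs → g x ≤ ∑ xs g
  ∑-member g (here refl) = m≤m+n _ _
  ∑-member {y ∷ xs} g (there m) = ≤-trans (∑-member g m) (m≤n+m _ (g y))

∑-map : {A B : Set} (f : A → B) (xs : List A) (g : B → ℕ) → ∑ (map f xs) g ≡ ∑ xs (λ x → g (f x))
∑-map f [] g = refl
∑-map f (x ∷ xs) g = cong (g (f x) +_) (∑-map f xs g)

∑-swap : {A B : Set} (xs : List A) (ys : List B) (g : A → B → ℕ) →
  ∑ xs (λ x → ∑ ys (g x)) ≡ ∑ ys (λ y → ∑ xs (λ x → g x y))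
∑-swap [] ys g = sym (∑-0 ys)
∑-swap (x ∷ xs) ys g = trans (cong (∑ ys (g x) +_) (∑-swap xs ys g))
  (sym (∑-+ ys (g x) (λ y → ∑ xs (λ x → g x y))))

-- The common form of the comparisons of counts below. A move of letters is a total function, but it
-- stays in the family and is injective only where the weight `g` is positive, so both conditions
-- are asked only there. Each value `f x` is taken out of `ys` once it has been used.
∑-inject : {A B : Set} (xs : List A) (ys : List B) {g : A → ℕ} {h : B → ℕ} (f : A → B) →
  Unique xs →
  (∀ {x} → x ∈ xs → 0 < g x → f x ∈ ys × g x ≤ h (f x)) →
  (∀ {x y} → x ∈ xs → y ∈ xs → 0 < g x → 0 < g y → f x ≡ f y → x ≡ y) →
  ∑ xs g ≤ ∑ ys h
∑-inject [] ys f u into inj = z≤n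
∑-inject (x ∷ xs) ys {g} {h} f (x∉ ∷ u) into inj with g x in eq
... | zero = ∑-inject xs ys f u (λ m → into (there m)) (λ m n → inj (there m) (there n))
... | suc k with into (here refl) (subst (0 <_) (sym eq) (s≤s z≤n))
...   | fx∈ , gx≤ with ∈-∃++ fx∈
...     | as , bs , refl = begin
      suc k + ∑ xs g  ≤⟨ +-mono-≤ (subst (_≤ h (f x)) eq gx≤) rest ⟩
      h (f x) + ∑ (as ++ bs) h  ≡⟨ cong (h (f x) +_) (∑-++ as bs h) ⟩
      h (f x) + (∑ as h + ∑ bs h)  ≡⟨ +-x∙yz≈y∙xz (h (f x)) (∑ as h) (∑ bs h) ⟩
      ∑ as h + (h (f x) + ∑ bs h)  ≡⟨ ∑-++ as (f x ∷ bs) h ⟨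
      ∑ (as ++ f x ∷ bs) h  ∎
  where
  open ≤-Reasoning
  0<gx : 0 < g x
  0<gx = subst (0 <_) (sym eq) (s≤s z≤n)
  drop-fx : ∀ {y} → y ∈ xs → 0 < g y → f y ∈ as ++ f x ∷ bs → f y ∈ as ++ bs
  drop-fx m p fy∈ with ∈-++⁻ as fy∈
  ... | inj₁ l = ∈-++⁺ˡ l
  ... | inj₂ (there r) = ∈-++⁺ʳ as r
  ... | inj₂ (here e) = contradiction (inj (here refl) (there m) 0<gx p (sym e)) (All.lookup x∉ m)
  rest : ∑ xs g ≤ ∑ (as ++ bs) h
  rest = ∑-inject xs (as ++ bs) f u
    (λ m p → drop-fx m p (proj₁ (into (there m) p)) , proj₂ (into (there m) p))
    (λ m n → inj (there m) (there n))

∑-⊆ : {A : Set} {xs ys : List A} (g : A → ℕ) → Unique xs → (∀ {x} → x ∈ xs → x ∈ ys) → ∑ xs g ≤ ∑ ys g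
∑-⊆ {xs = xs} {ys} g u sub = ∑-inject xs ys (λ x → x) u (λ m _ → sub m , ≤-refl) (λ _ _ _ _ e → e)

length-⊆ : {A : Set} {xs ys : List A} → Unique xs → (∀ {x} → x ∈ xs → x ∈ ys) → length xs ≤ length ys
length-⊆ {xs = xs} {ys} u sub = begin
  length xs  ≡⟨ *-identityʳ _ ⟨
  length xs * 1  ≡⟨ ∑-const xs 1 ⟨
  ∑ xs (λ _ → 1)  ≤⟨ ∑-⊆ (λ _ → 1) u sub ⟩
  ∑ ys (λ _ → 1)  ≡⟨ ∑-const ys 1 ⟩
  length ys * 1  ≡⟨ *-identityʳ _ ⟩
  length ys  ∎
  where open ≤-Reasoning

∑-exclusive : {A : Set} (xs : List A) {E : A → Set} (E? : ∀ x → Dec (E x)) → Unique xs →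
  (∀ {x y} → x ∈ xs → y ∈ xs → E x → E y → x ≡ y) → ∑ xs (λ x → 𝟙 (E? x)) ≤ 1
∑-exclusive [] E? u ex = z≤n
∑-exclusive (x ∷ xs) E? (x∉ ∷ u) ex with E? x
... | no _ = ∑-exclusive xs E? u (λ m n → ex (there m) (there n))
... | yes e = ≤-reflexive (cong suc (trans (∑-cong xs none) (∑-0 xs)))
  where
  none : ∀ {y} → y ∈ xs → 𝟙 (E? y) ≡ 0
  none {y} m = 𝟙-no (E? y) λ e′ → All.lookup x∉ m (ex (here refl) (there m) e e′)

-- Linear extensions

T⇒true : ∀ {b} → Bool.T b → b ≡ true
T⇒true {true} _ = refl

∈⇒nonempty : {A : Set} {x : A} {xs : List A} → x ∈ xs → 0 < length xs
∈⇒nonempty {xs = _ ∷ _} _ = s≤s z≤n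

Unique-++ˡ : {A : Set} (xs : List A) {ys : List A} → Unique (xs ++ ys) → Unique xs
Unique-++ˡ [] _ = []
Unique-++ˡ (x ∷ xs) (n ∷ u) = All.tabulate (λ m → All.lookup n (∈-++⁺ˡ m)) ∷ Unique-++ˡ xs u

Unique-map : {A B : Set} (f : A → B) {xs : List A} → (∀ {x y} → x ∈ xs → y ∈ xs → f x ≡ f y → x ≡ y) →
  Unique xs → Unique (map f xs)
Unique-map f inj [] = []
Unique-map f inj (n ∷ u) = AllP.map⁺ (All.tabulate (λ m e → All.lookup n m (inj (here refl) (there m) e)))
  ∷ Unique-map f (λ m m′ → inj (there m) (there m′)) u

Unique-resp-↭ : {A : Set} {xs ys : List A} → xs ↭ ys → Unique xs → Unique ys
Unique-resp-↭ {A} p = PermS.Unique-resp-↭ (setoid A) (↭⇒↭ₛ p)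

unique-set⇒↭ : {A : Set} {xs ys : List A} → Unique xs → Unique ys →
  (∀ {x} → x ∈ xs → x ∈ ys) → (∀ {x} → x ∈ ys → x ∈ xs) → xs ↭ ys
unique-set⇒↭ u v f g = ∼bag⇒↭ (unique∧set⇒bag u v (mk⇔ f g))

≤ᵖ-refl : ∀ {d} {x : Pt d} → x ≤ᵖ x
≤ᵖ-refl = PW.refl ≤-refl

≤ᵖ-trans : ∀ {d} {x y z : Pt d} → x ≤ᵖ y → y ≤ᵖ z → x ≤ᵖ z
≤ᵖ-trans = PW.trans ≤-trans

≤ᵖ-antisym : ∀ {d} {x y : Pt d} → x ≤ᵖ y → y ≤ᵖ x → x ≡ y
≤ᵖ-antisym [] [] = refl
≤ᵖ-antisym (p ∷ ps) (q ∷ qs) = cong₂ _∷_ (≤-antisym p q) (≤ᵖ-antisym ps qs)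

<ᵖ-trans : ∀ {d} {x y z : Pt d} → x <ᵖ y → y <ᵖ z → x <ᵖ z
<ᵖ-trans (p , n) (q , _) = ≤ᵖ-trans p q , λ { refl → n (≤ᵖ-antisym p q) }

<ᵖ-asym : ∀ {d} {x y : Pt d} → x <ᵖ y → ¬ (y <ᵖ x)
<ᵖ-asym p q = proj₂ (<ᵖ-trans p q) refl

_<ᵖ?_ : ∀ {d} (x y : Pt d) → Dec (x <ᵖ y)
x <ᵖ? y = x ≤ᵖ? y ×-dec ¬? (x ≟ᵖ y)

module _ {d : ℕ} where

  Respects : List (Pt d) → Set
  Respects = AllPairs (λ z u → ¬ (u <ᵖ z))

  respects⇒ : ∀ L → respectsᵇ L ≡ true → Respects L
  respects⇒ [] _ = []
  respects⇒ (z ∷ L) r = all L (proj₁ (split _ _ r)) ∷ respects⇒ L (proj₂ (split _ _ r))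
    where
    split : ∀ a b → a ∧ b ≡ true → a ≡ true × b ≡ true
    split true true _ = refl , refl
    all : ∀ L → allᵇ (λ u → not (ltᵇ u z)) L ≡ true → All (λ u → ¬ (u <ᵖ z)) L
    all [] _ = []
    all (u ∷ L) r = no-lt (proj₁ (split _ _ r)) ∷ all L (proj₂ (split _ _ r))
      where
      no-lt : not (ltᵇ u z) ≡ true → ¬ (u <ᵖ z)
      no-lt e lt rewrite dec-true (u <ᵖ? z) lt with () ← e

  respects⇐ : ∀ L → Respects L → respectsᵇ L ≡ true
  respects⇐ [] _ = refl
  respects⇐ (z ∷ L) (nz ∷ r) = cong₂ _∧_ (all L nz) (respects⇐ L r)
    where
    all : ∀ L → All (λ u → ¬ (u <ᵖ z)) L → allᵇ (λ u → not (ltᵇ u z)) L ≡ true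
    all [] _ = refl
    all (u ∷ L) (n ∷ ns) = cong₂ _∧_ (cong not (dec-false (u <ᵖ? z) n)) (all L ns)

  eqᵇ-refl : (x : Pt d) → eqᵇ x x ≡ true
  eqᵇ-refl x = dec-true (x ≟ᵖ x) refl

  eqᵇ-≢ : {x y : Pt d} → x ≢ y → eqᵇ x y ≡ false
  eqᵇ-≢ {x} {y} = dec-false (x ≟ᵖ y)

  memᵇ-∈ : {x : Pt d} {L : List (Pt d)} → x ∈ L → memᵇ x L ≡ true
  memᵇ-∈ {x} {y ∷ L} m with x ≟ᵖ y
  ... | yes _ = refl
  memᵇ-∈ {x} {y ∷ L} (here e) | no n = contradiction e n
  memᵇ-∈ {x} {y ∷ L} (there m) | no _ = memᵇ-∈ m

  before-flip : ∀ {x y : Pt d} L → x ≢ y → x ∈ L → y ∈ L → beforeᵇ y x L ≡ not (beforeᵇ x y L)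
  before-flip {x} {y} (z ∷ L) x≢y mx my = by (z ≟ᵖ x) (z ≟ᵖ y) mx my
    where
    by : Dec (z ≡ x) → Dec (z ≡ y) → x ∈ z ∷ L → y ∈ z ∷ L → beforeᵇ y x (z ∷ L) ≡ not (beforeᵇ x y (z ∷ L))
    by (yes refl) (yes refl) _ _ = contradiction refl x≢y
    by (yes refl) (no n) _ (here e) = contradiction (sym e) n
    by (yes refl) (no n) _ (there m) rewrite eqᵇ-refl x | eqᵇ-≢ n | memᵇ-∈ m = refl
    by (no n) (yes refl) (here e) _ = contradiction (sym e) n
    by (no n) (yes refl) (there m) _ rewrite eqᵇ-refl y | eqᵇ-≢ n | memᵇ-∈ m = refl
    by (no n) (no n′) (here e) _ = contradiction (sym e) n
    by (no n) (no n′) (there m) (here e) = contradiction (sym e) n′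
    by (no n) (no n′) (there m) (there m′) rewrite eqᵇ-≢ n | eqᵇ-≢ n′ = before-flip L x≢y m m′

-- Permutations, each enumerated exactly once

insertions-↭ : {A : Set} {x : A} (ys : List A) {zs : List A} → zs ∈ insertions x ys → zs ↭ x ∷ ys
insertions-↭ [] (here refl) = ↭-refl
insertions-↭ (y ∷ ys) (here refl) = ↭-refl
insertions-↭ {x = x} (y ∷ ys) (there m) with ∈-map⁻ (y ∷_) m
... | zs , m′ , refl = ↭-trans (prep y (insertions-↭ ys m′)) (swap y x ↭-refl)

insertions-∈ : {A : Set} {x : A} (as bs : List A) → as ++ x ∷ bs ∈ insertions x (as ++ bs)
insertions-∈ [] [] = here refl
insertions-∈ [] (b ∷ bs) = here refl
insertions-∈ (a ∷ as) bs = there (∈-map⁺ (a ∷_) (insertions-∈ as bs))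

perms-↭ : {A : Set} (xs : List A) {zs : List A} → zs ∈ perms xs → zs ↭ xs
perms-↭ [] (here refl) = ↭-refl
perms-↭ (x ∷ xs) m = go (perms xs) (perms-↭ xs) (∈-concatMap⁻ (insertions x) m)
  where
  go : ∀ pss → (∀ {zs} → zs ∈ pss → zs ↭ xs) → ∀ {zs} → Any.Any (λ ys → zs ∈ insertions x ys) pss → zs ↭ x ∷ xs
  go (ps ∷ pss) ih (here m) = ↭-trans (insertions-↭ ps m) (prep x (ih (here refl)))
  go (ps ∷ pss) ih (there m) = go pss (λ m → ih (there m)) m

perms-∈ : {A : Set} (xs : List A) {zs : List A} → zs ↭ xs → zs ∈ perms xs
perms-∈ [] {[]} p = here refl
perms-∈ [] {z ∷ zs} p with () ← ∈-resp-↭ p (here refl)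
perms-∈ (x ∷ xs) p with ∈-∃++ (∈-resp-↭ (↭-sym p) (here refl))
... | as , bs , refl = ∈-concatMap⁺ (insertions x)
  (Any.map (λ { refl → insertions-∈ as bs }) (perms-∈ xs (drop-mid as [] p)))

module _ {A : Set} (_≟_ : (x y : A) → Dec (x ≡ y)) where

  private
    remove : A → List A → List A
    remove x = filter (λ z → ¬? (x ≟ z))

    remove-fresh : ∀ {x ys} → All (x ≢_) ys → remove x ys ≡ ys
    remove-fresh {x} ne = filter-all (λ z → ¬? (x ≟ z)) ne

    remove-insertions : ∀ {x} ys {zs} → All (x ≢_) ys → zs ∈ insertions x ys → remove x zs ≡ ys
    remove-insertions {x} [] ne (here refl) = filter-reject (λ z → ¬? (x ≟ z)) (λ n → n refl)
    remove-insertions {x} (y ∷ ys) ne (here refl) =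
      trans (filter-reject (λ z → ¬? (x ≟ z)) (λ n → n refl)) (remove-fresh ne)
    remove-insertions {x} (y ∷ ys) (n ∷ ne) (there m) with ∈-map⁻ (y ∷_) m
    ... | zs , m′ , refl = trans (filter-accept (λ z → ¬? (x ≟ z)) n) (cong (y ∷_) (remove-insertions ys ne m′))

    insertions-unique : ∀ {x} ys → All (x ≢_) ys → Unique (insertions x ys)
    insertions-unique [] _ = [] ∷ []
    insertions-unique {x} (y ∷ ys) (n ∷ ne) =
      AllP.map⁺ (All.tabulate (λ _ e → n (cong first e)))
        ∷ UniqueP.map⁺ (λ e → cong tail e) (insertions-unique ys ne)
      where
      first : List A → A
      first [] = x
      first (a ∷ _) = a
      tail : List A → List A
      tail [] = []
      tail (_ ∷ as) = as

  -- Filtering `x` out of an insertion of `x` gives back the permutation it came from, so different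
  -- permutations have disjoint lists of insertions.
  perms-unique : ∀ xs → Unique xs → Unique (perms xs)
  perms-unique [] _ = [] ∷ []
  perms-unique (x ∷ xs) (x∉ ∷ u) = UniqueP.concat⁺
      (AllP.map⁺ (All.tabulate (λ {ys} m → insertions-unique ys (fresh m))))
      (AllPairsP.map⁺ (disjoint (perms xs) (λ m → m) (perms-unique xs u)))
    where
    fresh : ∀ {ys} → ys ∈ perms xs → All (x ≢_) ys
    fresh m = All.tabulate (λ y∈ → All.lookup x∉ (∈-resp-↭ (perms-↭ xs m) y∈))
    disjoint : ∀ pss → (∀ {ys} → ys ∈ pss → ys ∈ perms xs) → Unique pss →
      AllPairs (λ ys ys′ → Disjoint (insertions x ys) (insertions x ys′)) pss
    disjoint [] _ _ = []
    disjoint (ps ∷ pss) sub (ps∉ ∷ u) = All.tabulate (λ {ys} m (p , q) →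
        All.lookup ps∉ m (trans (sym (remove-insertions ps (fresh (sub (here refl))) p))
          (remove-insertions ys (fresh (sub (there m))) q)))
      ∷ disjoint pss (λ m → sub (there m)) u

module _ {d : ℕ} {P : List (Pt d)} where

  linExts⇒ : ∀ {L} → L ∈ linExts P → L ↭ P × Respects L
  linExts⇒ {L} m with ∈-filter⁻ (λ L → T? (respectsᵇ L)) {xs = perms P} m
  ... | m′ , r = perms-↭ P m′ , respects⇒ L (T⇒true r)

  linExts⇐ : ∀ {L} → L ↭ P → Respects L → L ∈ linExts P
  linExts⇐ {L} p r = ∈-filter⁺ (λ L → T? (respectsᵇ L)) (perms-∈ P p) (subst Bool.T (sym (respects⇐ L r)) _)

  linExts-unique : Unique P → Unique (linExts P)
  linExts-unique u = UniqueP.filter⁺ _ (perms-unique _≟ᵖ_ P u)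

filterᵇ-count : {A : Set} (p : A → Bool) (xs : List A) → length (filterᵇ p xs) ≡ ∑ xs (λ x → 𝟙 (p x Bool.≟ true))
filterᵇ-count p [] = refl
filterᵇ-count p (x ∷ xs) with p x
... | true = cong suc (filterᵇ-count p xs)
... | false = filterᵇ-count p xs

-- Words over a set of columns

module Words {K : Set} (_≟_ : DecidableEquality K) where

  Word : Set
  Word = List (ℕ × K)

  keys : Word → List K
  keys = map proj₂

  d : K → Word → ℕ
  d p [] = 0
  d p ((n , k) ∷ w) with k ≟ p
  ... | yes _ = n
  ... | no _ = d p w

  total : Word → ℕ
  total [] = 0
  total ((n , _) ∷ w) = n + total w

  -- The run of `q` itself is included, so for the word of a linear extension this is the number of
  -- chain elements preceding `q`.
  X : K → Word → ℕ
  X q [] = 0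
  X q ((n , k) ∷ w) with k ≟ q
  ... | yes _ = n
  ... | no _ = n + X q w

  -- Reflexive on the columns that occur: for them, `false` means that `p` comes strictly after `q`.
  le : K → K → List K → Bool
  le p q [] = false
  le p q (k ∷ ks) with k ≟ p | k ≟ q
  ... | yes _ | _ = true
  ... | no _ | yes _ = false
  ... | no _ | no _ = le p q ks

  set : K → ℕ → Word → Word
  set p x [] = []
  set p x ((n , k) ∷ w) with k ≟ p
  ... | yes _ = (x , k) ∷ w
  ... | no _ = (n , k) ∷ set p x w

  keys-set : ∀ p x w → keys (set p x w) ≡ keys w
  keys-set p x [] = refl
  keys-set p x ((n , k) ∷ w) with k ≟ p
  ... | yes _ = refl
  ... | no _ = cong (k ∷_) (keys-set p x w)

  d-set : ∀ {p} x w → p ∈ keys w → d p (set p x w) ≡ x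
  d-set {p} x ((n , k) ∷ w) m with k ≟ p
  ... | yes e with k ≟ p
  ...   | yes _ = refl
  ...   | no k≢p = contradiction e k≢p
  d-set {p} x ((n , k) ∷ w) (here e) | no k≢p = contradiction (sym e) k≢p
  d-set {p} x ((n , k) ∷ w) (there m) | no k≢p with k ≟ p
  ...   | yes e = contradiction e k≢p
  ...   | no _ = d-set x w m

  d-set-≢ : ∀ {p q} x w → p ≢ q → d q (set p x w) ≡ d q w
  d-set-≢ x [] p≢q = refl
  d-set-≢ {p} {q} x ((n , k) ∷ w) p≢q with k ≟ p
  ... | yes refl with k ≟ q
  ...   | yes e = contradiction e p≢q
  ...   | no _ = refl
  d-set-≢ {p} {q} x ((n , k) ∷ w) p≢q | no _ with k ≟ q
  ...   | yes _ = refl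
  ...   | no _ = d-set-≢ x w p≢q

  set-set : ∀ p x y w → set p x (set p y w) ≡ set p x w
  set-set p x y [] = refl
  set-set p x y ((n , k) ∷ w) with k ≟ p
  ... | yes e with k ≟ p
  ...   | yes _ = refl
  ...   | no k≢p = contradiction e k≢p
  set-set p x y ((n , k) ∷ w) | no k≢p with k ≟ p
  ...   | yes e = contradiction e k≢p
  ...   | no _ = cong (_ ∷_) (set-set p x y w)

  set-id : ∀ p w → set p (d p w) w ≡ w
  set-id p [] = refl
  set-id p ((n , k) ∷ w) with k ≟ p
  ... | yes _ = refl
  ... | no _ = cong (_ ∷_) (set-id p w)

  set-comm : ∀ {p q} x y w → p ≢ q → set p x (set q y w) ≡ set q y (set p x w)
  set-comm x y [] p≢q = refl
  set-comm {p} {q} x y ((n , k) ∷ w) p≢q with k ≟ q | k ≟ p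
  ... | yes refl | yes refl = contradiction refl p≢q
  set-comm {p} {q} x y ((n , k) ∷ w) p≢q | yes e | no k≢p with k ≟ p | k ≟ q
  ... | yes e′ | _ = contradiction e′ k≢p
  ... | no _ | no k≢q = contradiction e k≢q
  ... | no _ | yes _ = refl
  set-comm {p} {q} x y ((n , k) ∷ w) p≢q | no k≢q | yes e with k ≟ p | k ≟ q
  ... | no k≢p | _ = contradiction e k≢p
  ... | yes _ | yes e′ = contradiction e′ k≢q
  ... | yes _ | no _ = refl
  set-comm {p} {q} x y ((n , k) ∷ w) p≢q | no k≢q | no k≢p with k ≟ p | k ≟ q
  ... | yes e | _ = contradiction e k≢p
  ... | no _ | yes e = contradiction e k≢q
  ... | no _ | no _ = cong (_ ∷_) (set-comm x y w p≢q)

  le-refl : ∀ {p ks} → p ∈ ks → le p p ks ≡ true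
  le-refl {p} {k ∷ ks} m with k ≟ p
  ... | yes _ = refl
  le-refl {p} {k ∷ ks} (here e) | no k≢p = contradiction (sym e) k≢p
  le-refl {p} {k ∷ ks} (there m) | no _ = le-refl m

  le-∈ : ∀ {p q} ks → le p q ks ≡ true → p ∈ ks
  le-∈ {p} {q} (k ∷ ks) l with k ≟ p | k ≟ q
  ... | yes e | _ = here (sym e)
  ... | no _ | no _ = there (le-∈ ks l)

  le-antisym : ∀ {p q} ks → le p q ks ≡ true → le q p ks ≡ true → p ≡ q
  le-antisym {p} {q} (k ∷ ks) l l′ with k ≟ p | k ≟ q
  ... | yes refl | yes e = e
  ... | no _ | no _ = le-antisym ks l l′

  le-through : ∀ {p p′ q} e ks → le p e ks ≡ true → le p′ e ks ≡ false → le p′ q ks ≡ true → le p q ks ≡ true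
  le-through {p} {p′} {q} e (k ∷ ks) pe p′e p′q with k ≟ p
  ... | yes _ = refl
  ... | no _ with k ≟ e
  ...   | no _ with k ≟ p′
  ...     | no _ with k ≟ q
  ...       | no _ = le-through e ks pe p′e p′q

  le-sep-≢ : ∀ {p p′ e ks} → le p e ks ≡ true → le p′ e ks ≡ false → p ≢ p′
  le-sep-≢ pe p′e refl with () ← trans (sym pe) p′e

  -- The change from `d p w` to `x` can have either sign, so it is distributed over the two sides
  -- instead of using truncated subtraction. The lemmas on `X` have the same form.
  total-set : ∀ {p} x w → p ∈ keys w → total (set p x w) + d p w ≡ total w + x
  total-set {p} x ((n , k) ∷ w) m with k ≟ p
  ... | yes e = +-xy∙z≈zy∙x x (total w) n
  total-set {p} x ((n , k) ∷ w) (here e) | no k≢p = contradiction (sym e) k≢p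
  total-set {p} x ((n , k) ∷ w) (there m) | no _
    rewrite +-assoc n (total (set p x w)) (d p w) | total-set x w m = sym (+-assoc n (total w) x)

  X-set : ∀ {p q} x w → le p q (keys w) ≡ true → X q (set p x w) + d p w ≡ X q w + x
  X-set {p} {q} x ((n , k) ∷ w) l with k ≟ p
  X-set {p} {q} x ((n , k) ∷ w) l | yes _ with k ≟ q
  ... | yes _ = +-comm x n
  ... | no _ = +-xy∙z≈zy∙x x (X q w) n
  X-set {p} {q} x ((n , k) ∷ w) l | no _ with k ≟ q
  ... | no _ rewrite +-assoc n (X q (set p x w)) (d p w) | X-set x w l = sym (+-assoc n (X q w) x)

  X-set-after : ∀ {p q} x w → le p q (keys w) ≡ false → X q (set p x w) ≡ X q w
  X-set-after {p} {q} x [] l = refl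
  X-set-after {p} {q} x ((n , k) ∷ w) l with k ≟ p
  X-set-after {p} {q} x ((n , k) ∷ w) l | no _ with k ≟ q
  ... | yes _ = refl
  ... | no _ = cong (n +_) (X-set-after x w l)

  d≤X : ∀ {p q} w → le p q (keys w) ≡ true → d p w ≤ X q w
  d≤X {p} {q} ((n , k) ∷ w) l with k ≟ p | k ≟ q
  ... | yes _ | yes _ = ≤-refl
  ... | yes _ | no _ = m≤m+n n _
  ... | no _ | no _ = ≤-trans (d≤X w l) (m≤n+m _ n)

  X≤total : ∀ q w → X q w ≤ total w
  X≤total q [] = z≤n
  X≤total q ((n , k) ∷ w) with k ≟ q
  ... | yes _ = m≤m+n n _
  ... | no _ = +-monoʳ-≤ n (X≤total q w)

  X-mono : ∀ {p q} w → le p q (keys w) ≡ true → X p w ≤ X q w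
  X-mono {p} {q} ((n , k) ∷ w) l with k ≟ p | k ≟ q
  ... | yes _ | yes _ = ≤-refl
  ... | yes _ | no _ = m≤m+n n _
  ... | no _ | no _ = +-monoʳ-≤ n (X-mono w l)

  d-∷-≢ : ∀ {n k p} w → k ≢ p → d p ((n , k) ∷ w) ≡ d p w
  d-∷-≢ {n} {k} {p} w k≢p with k ≟ p
  ... | yes e = contradiction e k≢p
  ... | no _ = refl

  d-∷ : ∀ {n k} w → d k ((n , k) ∷ w) ≡ n
  d-∷ {n} {k} w with k ≟ k
  ... | yes _ = refl
  ... | no k≢k = contradiction refl k≢k

  le-∷ : ∀ {k p e ks} → k ≢ p → k ≢ e → le p e (k ∷ ks) ≡ le p e ks
  le-∷ {k} {p} {e} k≢p k≢e with k ≟ p | k ≟ e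
  ... | yes x | _ = contradiction x k≢p
  ... | no _ | yes x = contradiction x k≢e
  ... | no _ | no _ = refl

  le-here : ∀ {k e ks} → le k e (k ∷ ks) ≡ true
  le-here {k} {e} with k ≟ k
  ... | yes _ = refl
  ... | no k≢k = contradiction refl k≢k

  le-last : ∀ {k p ks} → k ≢ p → le p k (k ∷ ks) ≡ false
  le-last {k} {p} k≢p with k ≟ p | k ≟ k
  ... | yes x | _ = contradiction x k≢p
  ... | no _ | yes _ = refl
  ... | no _ | no x = contradiction refl x

  upto after : K → K → List K → ℕ
  upto p e ks = 𝟙 (le p e ks Bool.≟ true)
  after p e ks = 𝟙 (le p e ks Bool.≟ false)

  upto+after : ∀ p e ks → upto p e ks + after p e ks ≡ 1
  upto+after p e ks with le p e ks
  ... | true = refl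
  ... | false = refl

  ∑-d : ∀ w → Unique (keys w) → ∑ (keys w) (λ p → d p w) ≡ total w
  ∑-d [] u = refl
  ∑-d ((n , k) ∷ w) (k∉ ∷ u) = cong₂ _+_ (d-∷ w)
    (trans (∑-cong (keys w) (λ m → d-∷-≢ w (All.lookup k∉ m))) (∑-d w u))

  X-∷ : ∀ {n k} w → X k ((n , k) ∷ w) ≡ n
  X-∷ {n} {k} w with k ≟ k
  ... | yes _ = refl
  ... | no k≢k = contradiction refl k≢k

  X-∷-≢ : ∀ {n k q} w → k ≢ q → X q ((n , k) ∷ w) ≡ n + X q w
  X-∷-≢ {n} {k} {q} w k≢q with k ≟ q
  ... | yes e = contradiction e k≢q
  ... | no _ = refl

  ∑-upto : ∀ e w → Unique (keys w) → ∑ (keys w) (λ p → upto p e (keys w) * d p w) ≡ X e w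
  ∑-upto e [] u = refl
  ∑-upto e ((n , k) ∷ w) (k∉ ∷ u) = by (k ≟ e)
    where
    ks = k ∷ keys w
    first : upto k e ks * d k ((n , k) ∷ w) ≡ n
    first rewrite le-here {k} {e} {keys w} | d-∷ {n} {k} w = +-identityʳ n
    by : Dec (k ≡ e) → ∑ ks (λ p → upto p e ks * d p ((n , k) ∷ w)) ≡ X e ((n , k) ∷ w)
    by (yes refl) = trans (cong₂ _+_ first (trans (∑-cong (keys w) rest) (∑-0 (keys w))))
      (trans (+-identityʳ n) (sym (X-∷ w)))
      where
      rest : ∀ {p} → p ∈ keys w → upto p k ks * d p ((n , k) ∷ w) ≡ 0
      rest {p} m rewrite le-last {k} {p} {keys w} (All.lookup k∉ m) = refl
    by (no k≢e) = trans (cong₂ _+_ first (trans (∑-cong (keys w) rest) (∑-upto e w u))) (sym (X-∷-≢ w k≢e))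
      where
      rest : ∀ {p} → p ∈ keys w → upto p e ks * d p ((n , k) ∷ w) ≡ upto p e (keys w) * d p w
      rest {p} m rewrite le-∷ {k} {p} {e} {keys w} (All.lookup k∉ m) k≢e | d-∷-≢ {n} {k} {p} w (All.lookup k∉ m) = refl

  set₂ : K → K → ℕ → ℕ → Word → Word
  set₂ p p′ x y w = set p x (set p′ y w)

  keys-set₂ : ∀ p p′ x y w → keys (set₂ p p′ x y w) ≡ keys w
  keys-set₂ p p′ x y w = trans (keys-set p x _) (keys-set p′ y w)

  module _ {p p′ : K} (p≢p′ : p ≢ p′) where

    d-set₂ˡ : ∀ x y w → p ∈ keys w → d p (set₂ p p′ x y w) ≡ x
    d-set₂ˡ x y w m = d-set x (set p′ y w) (subst (p ∈_) (sym (keys-set p′ y w)) m)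

    d-set₂ʳ : ∀ x y w → p′ ∈ keys w → d p′ (set₂ p p′ x y w) ≡ y
    d-set₂ʳ x y w m = trans (d-set-≢ x (set p′ y w) p≢p′) (d-set y w m)

    set₂-undo : ∀ x y w → set₂ p p′ (d p w) (d p′ w) (set₂ p p′ x y w) ≡ w
    set₂-undo x y w
      rewrite set-comm {p′} {p} (d p′ w) x (set p′ y w) (λ e → p≢p′ (sym e))
            | set-set p (d p w) x (set p′ (d p′ w) (set p′ y w))
            | set-set p′ (d p′ w) y w | set-id p′ w = set-id p w

    total-set₂ : ∀ x y w → p ∈ keys w → p′ ∈ keys w → x + y ≡ d p w + d p′ w → total (set₂ p p′ x y w) ≡ total w
    total-set₂ x y w m m′ eq = +-cancelʳ-≡ (d p w + d p′ w) _ _ (trans (sym (+-assoc t₂ _ _)) (trans step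
        (trans (+-assoc (total w) y x) (cong (total w +_) (trans (+-comm y x) eq)))))
      where
      w₁ = set p′ y w
      t₂ = total (set₂ p p′ x y w)
      e₁ : total w₁ + d p′ w ≡ total w + y
      e₁ = total-set y w m′
      e₂ : t₂ + d p w₁ ≡ total w₁ + x
      e₂ = total-set x w₁ (subst (p ∈_) (sym (keys-set p′ y w)) m)
      step : t₂ + d p w + d p′ w ≡ total w + y + x
      step = trans (cong (λ z → t₂ + z + d p′ w) (sym (d-set-≢ y w (λ e → p≢p′ (sym e)))))
        (trans (cong (_+ d p′ w) e₂) (trans (+-xy∙z≈xz∙y (total w₁) x (d p′ w)) (cong (_+ x) e₁)))

  d-set₂-≢ : ∀ {p p′ q} x y w → p ≢ q → p′ ≢ q → d q (set₂ p p′ x y w) ≡ d q w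
  d-set₂-≢ {p} {p′} x y w p≢q p′≢q = trans (d-set-≢ x (set p′ y w) p≢q) (d-set-≢ y w p′≢q)

  -- set₂ p p′ moves letters from the column p′ back to the column p; here e separates the two columns.
  module _ {p p′ e : K} (x y : ℕ) (w : Word) (pe : le p e (keys w) ≡ true) (p′e : le p′ e (keys w) ≡ false) where

    private
      ks₁ : keys (set p′ y w) ≡ keys w
      ks₁ = keys-set p′ y w
      p′≢p : p′ ≢ p
      p′≢p eq = le-sep-≢ {ks = keys w} pe p′e (sym eq)

    X-set₂-between : ∀ {q} → le p q (keys w) ≡ true → le p′ q (keys w) ≡ false →
      X q (set₂ p p′ x y w) + d p w ≡ X q w + x
    X-set₂-between {q} l l′ = trans (cong (X q (set₂ p p′ x y w) +_) (sym (d-set-≢ y w p′≢p)))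
      (trans (X-set x (set p′ y w) (subst (λ ks → le p q ks ≡ true) (sym ks₁) l))
        (cong (_+ x) (X-set-after y w l′)))

    X-set₂-before : ∀ {q} → le p q (keys w) ≡ false → X q (set₂ p p′ x y w) ≡ X q w
    X-set₂-before {q} l = trans (X-set-after x (set p′ y w) (subst (λ ks → le p q ks ≡ false) (sym ks₁) l))
      (X-set-after y w l′)
      where
      l′ : le p′ q (keys w) ≡ false
      l′ with le p′ q (keys w) in eq
      ... | false = refl
      ... | true = trans (sym (le-through e (keys w) pe p′e eq)) l

    X-set₂-after : ∀ {q} → x + y ≡ d p w + d p′ w → le p′ q (keys w) ≡ true → X q (set₂ p p′ x y w) ≡ X q w
    X-set₂-after {q} eq l′ = +-cancelʳ-≡ (d p w + d p′ w) _ _ (trans (sym (+-assoc x₂ _ _)) (trans step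
        (trans (+-assoc (X q w) y x) (cong (X q w +_) (trans (+-comm y x) eq)))))
      where
      l = le-through e (keys w) pe p′e l′
      w₁ = set p′ y w
      x₂ = X q (set₂ p p′ x y w)
      e₁ : X q w₁ + d p′ w ≡ X q w + y
      e₁ = X-set y w l′
      e₂ : x₂ + d p w₁ ≡ X q w₁ + x
      e₂ = X-set x w₁ (subst (λ ks → le p q ks ≡ true) (sym ks₁) l)
      step : x₂ + d p w + d p′ w ≡ X q w + y + x
      step = trans (cong (λ z → x₂ + z + d p′ w) (sym (d-set-≢ y w p′≢p)))
        (trans (cong (_+ d p′ w) e₂) (trans (+-xy∙z≈xz∙y (X q w₁) x (d p′ w)) (cong (_+ x) e₁)))

    -- Only the columns from `p` on and strictly before `p′` gain letters in front of them. The
    -- conclusion has the shape of the hypothesis of `raise`.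
    X-set₂-mono : x + y ≡ d p w + d p′ w → d p w ≤ x →
      ∀ q → X q w ≤ X q (set₂ p p′ x y w) × (X q (set₂ p p′ x y w) ≡ X q w ⊎ le p q (keys w) ≡ true)
    X-set₂-mono eq dp≤x q with le p q (keys w) in l | le p′ q (keys w) in l′
    ... | false | _ = ≤-reflexive (sym (X-set₂-before l)) , inj₁ (X-set₂-before l)
    ... | true | true = ≤-reflexive (sym (X-set₂-after eq l′)) , inj₂ refl
    ... | true | false = +-cancelʳ-≤ (d p w) _ _
        (≤-trans (+-monoʳ-≤ (X q w) dp≤x) (≤-reflexive (sym (X-set₂-between l l′)))) , inj₂ refl

  -- Families of words closed under forward moves of letters

  _≟ʷ_ : DecidableEquality Word
  _≟ʷ_ = ListP.≡-dec (Prod.≡-dec ℕP._≟_ _≟_)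

  _∈ʷ?_ : (w : Word) (ws : List Word) → Dec (w ∈ ws)
  _∈ʷ?_ = Mem._∈?_ _≟ʷ_

  -- `raise` is all that the moves use of the partial order: while the order of the columns stays
  -- fixed, the number of letters before a free column may grow, since no relation forces such a
  -- column to precede a letter.
  record Model : Set₁ where
    field
      Ω : List Word
      unique : Unique Ω
      cols : List K
      cols-unique : Unique cols
      keys-↭ : ∀ {w} → w ∈ Ω → keys w ↭ cols
      N : ℕ
      total-N : ∀ {w} → w ∈ Ω → total w ≡ N
      Free : K → Set
      raise : ∀ {w w′} → w ∈ Ω → keys w′ ≡ keys w → total w′ ≡ total w →
        (∀ {q} → q ∈ cols → X q w ≤ X q w′ × (X q w′ ≡ X q w ⊎ Free q)) → w′ ∈ Ω

  -- The layer-cake form of `k`. It reduces a comparison of means to one comparison of counts for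
  -- each threshold.
  ∑-thresholds : ∀ n {k} → k ≤ n → ∑ (downFrom n) (λ u → 𝟙 (suc u ≤? k)) ≡ k
  ∑-thresholds zero z≤n = refl
  ∑-thresholds (suc n) {k} k≤ with suc n ≤? k
  ... | yes n<k = trans (cong suc (below n n<k)) (≤-antisym n<k k≤)
    where
    below : ∀ n → suc n ≤ k → ∑ (downFrom n) (λ u → 𝟙 (suc u ≤? k)) ≡ n
    below zero _ = refl
    below (suc n) p with suc n ≤? k
    ... | yes _ = cong suc (below n (<⇒≤ p))
    ... | no ¬p = contradiction (<⇒≤ p) ¬p
  ... | no n≮k = ∑-thresholds n (≤-pred (≰⇒> n≮k))

  set₂-set₂ : ∀ {p p′} x y x′ y′ w → p ≢ p′ → set₂ p p′ x y (set₂ p p′ x′ y′ w) ≡ set₂ p p′ x y w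
  set₂-set₂ {p} {p′} x y x′ y′ w p≢p′
    rewrite set-comm {p′} {p} y x′ (set p′ y′ w) (λ e → p≢p′ (sym e))
          | set-set p x x′ (set p′ y (set p′ y′ w)) | set-set p′ y y′ w = refl

  module Moves (M : Model) where
    open Model M

    S A : K → Word → ℕ
    S e w = ∑ cols (λ p → after p e (keys w) * d p w)
    A e w = ∑ cols (λ p → after p e (keys w))

    col∈ : ∀ {w p} → w ∈ Ω → p ∈ cols → p ∈ keys w
    col∈ w∈ m = ∈-resp-↭ (↭-sym (keys-↭ w∈)) m

    keys-unique : ∀ {w} → w ∈ Ω → Unique (keys w)
    keys-unique w∈ = Unique-resp-↭ (↭-sym (keys-↭ w∈)) cols-unique

    ∑-cols-d : ∀ {w} → w ∈ Ω → ∑ cols (λ p → d p w) ≡ N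
    ∑-cols-d {w} w∈ = trans (sym (∑-↭ _ (keys-↭ w∈))) (trans (∑-d w (keys-unique w∈)) (total-N w∈))

    ∑-cols-upto : ∀ {w} e → w ∈ Ω → ∑ cols (λ p → upto p e (keys w) * d p w) ≡ X e w
    ∑-cols-upto {w} e w∈ = trans (sym (∑-↭ _ (keys-↭ w∈))) (∑-upto e w (keys-unique w∈))

    X+S : ∀ {w} e → w ∈ Ω → X e w + S e w ≡ N
    X+S {w} e w∈ = trans (cong (_+ S e w) (sym (∑-cols-upto e w∈)))
      (trans (sym (∑-+ cols _ _)) (trans (∑-cong cols (λ {p} _ → term p)) (∑-cols-d w∈)))
      where
      term : ∀ p → upto p e (keys w) * d p w + after p e (keys w) * d p w ≡ d p w
      term p = trans (sym (*-distribʳ-+ (d p w) (upto p e (keys w)) (after p e (keys w))))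
        (trans (cong (_* d p w) (upto+after p e (keys w))) (+-identityʳ _))

    -- Columns strictly before `p` see no change of `X`, so freeness is asked only from `p` on. This
    -- weak requirement matters when the letters are the elements of `bs`, where some columns are
    -- not free.
    shift-∈ : ∀ {w p p′ e} x y → w ∈ Ω → p ∈ cols → p′ ∈ cols →
      le p e (keys w) ≡ true → le p′ e (keys w) ≡ false →
      (∀ {q} → q ∈ cols → le p q (keys w) ≡ true → Free q) →
      x + y ≡ d p w + d p′ w → d p w ≤ x → set₂ p p′ x y w ∈ Ω
    shift-∈ {w} {p} {p′} {e} x y w∈ p∈ p′∈ pe p′e free eq dp≤x =
      raise w∈ (keys-set₂ p p′ x y w)
        (total-set₂ (le-sep-≢ {ks = keys w} pe p′e) x y w (col∈ w∈ p∈) (col∈ w∈ p′∈) eq) cond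
      where
      cond : ∀ {q} → q ∈ cols → X q w ≤ X q (set₂ p p′ x y w) × (X q (set₂ p p′ x y w) ≡ X q w ⊎ Free q)
      cond {q} q∈ with X-set₂-mono x y w pe p′e eq dp≤x q
      ... | i , inj₁ eq′ = i , inj₁ eq′
      ... | i , inj₂ l = i , inj₂ (free q∈ l)

    move : K → K → Word → Word
    move p p′ w = set₂ p p′ (suc (d p w)) (d p′ w ∸ 1) w

    move-sum : ∀ p p′ w → 0 < d p′ w → suc (d p w) + (d p′ w ∸ 1) ≡ d p w + d p′ w
    move-sum p p′ w pos = trans (sym (+-suc (d p w) (d p′ w ∸ 1))) (cong (d p w +_) (m+[n∸m]≡n pos))

    -- A letter of the column p′ is moved to p. A column left with n letters had n + 1 before,
    -- so the columns after e contribute S e w + A e w on the right.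
    single-move : ∀ {p e} {E E′ : Word → Set} (E? : ∀ w → Dec (E w)) (E′? : ∀ w → Dec (E′ w)) → p ∈ cols →
      (∀ {w} → w ∈ Ω → E w → le p e (keys w) ≡ true) →
      (∀ {w q} → w ∈ Ω → E w → q ∈ cols → le p q (keys w) ≡ true → Free q) →
      (∀ {w p′} → w ∈ Ω → E w → p′ ∈ cols → le p′ e (keys w) ≡ false → 0 < d p′ w → E′ (move p p′ w)) →
      ∑ Ω (λ w → 𝟙 (E? w) * S e w) ≤ ∑ Ω (λ w → 𝟙 (E′? w) * (S e w + A e w))
    single-move {p} {e} {E} {E′} E? E′? p∈ pe free step = begin
      ∑ Ω (λ w → 𝟙 (E? w) * S e w)  ≡⟨ ∑-cong Ω (λ {w} _ → expand (𝟙 (E? w)) w) ⟩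
      ∑ Ω (λ w → ∑ cols (λ p′ → g p′ w))  ≡⟨ ∑-swap Ω cols _ ⟩
      ∑ cols (λ p′ → ∑ Ω (g p′))  ≤⟨ ∑-mono cols one ⟩
      ∑ cols (λ p′ → ∑ Ω (h p′))  ≡⟨ ∑-swap cols Ω _ ⟩
      ∑ Ω (λ w → ∑ cols (λ p′ → h p′ w))  ≡⟨ ∑-cong Ω (λ {w} _ → collect (𝟙 (E′? w)) w) ⟩
      ∑ Ω (λ w → 𝟙 (E′? w) * (S e w + A e w))  ∎
      where
      open ≤-Reasoning
      g h : K → Word → ℕ
      g p′ w = 𝟙 (E? w) * (after p′ e (keys w) * d p′ w)
      h p′ w = 𝟙 (E′? w) * (after p′ e (keys w) * suc (d p′ w))
      factor : ∀ c (f : K → ℕ) → c * ∑ cols f ≡ ∑ cols (λ p′ → c * f p′)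
      factor c f = trans (*-comm c _) (trans (sym (∑-* cols f c)) (∑-cong cols (λ {p′} _ → *-comm (f p′) c)))
      expand : ∀ c w → c * S e w ≡ ∑ cols (λ p′ → c * (after p′ e (keys w) * d p′ w))
      expand c w = factor c _
      collect : ∀ c w → ∑ cols (λ p′ → c * (after p′ e (keys w) * suc (d p′ w))) ≡ c * (S e w + A e w)
      collect c w = trans (sym (factor c _)) (cong (c *_) (trans (∑-cong cols (λ {p′} _ → lem (after p′ e (keys w)) (d p′ w)))
        (∑-+ cols _ _)))
        where
        lem : ∀ a b → a * suc b ≡ a * b + a
        lem = solve-∀
      fact : ∀ {w p′} → 0 < g p′ w → E w × le p′ e (keys w) ≡ false × 0 < d p′ w
      fact {w} {p′} pos with 𝟙-pos (E? w) pos
      ... | ew , pos′ with 𝟙-pos (le p′ e (keys w) Bool.≟ false) pos′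
      ...   | l , dp = ew , l , dp
      one : ∀ {p′} → p′ ∈ cols → ∑ Ω (g p′) ≤ ∑ Ω (h p′)
      one {p′} p′∈ = ∑-inject Ω Ω (move p p′) unique into inj
        where
        into : ∀ {w} → w ∈ Ω → 0 < g p′ w → move p p′ w ∈ Ω × g p′ w ≤ h p′ (move p p′ w)
        into {w} w∈ pos with fact {w} {p′} pos
        ... | ew , l , dp = shift-∈ _ _ w∈ p∈ p′∈ (pe w∈ ew) l (free w∈ ew) (move-sum p p′ w dp) (n≤1+n _) , bound
          where
          v = move p p′ w
          bound : 𝟙 (E? w) * (after p′ e (keys w) * d p′ w) ≤ 𝟙 (E′? v) * (after p′ e (keys v) * suc (d p′ v))
          bound rewrite keys-set₂ p p′ (suc (d p w)) (d p′ w ∸ 1) w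
                      | d-set₂ʳ (le-sep-≢ {ks = keys w} (pe w∈ ew) l) (suc (d p w)) (d p′ w ∸ 1) w (col∈ w∈ p′∈)
                      | 𝟙-yes (E′? v) (step w∈ ew p′∈ l dp) | 𝟙-yes (E? w) ew
                      = *-monoʳ-≤ 1 (*-monoʳ-≤ (after p′ e (keys w)) (≤-reflexive (sym (m+[n∸m]≡n dp))))
        inj : ∀ {w v} → w ∈ Ω → v ∈ Ω → 0 < g p′ w → 0 < g p′ v → move p p′ w ≡ move p p′ v → w ≡ v
        inj {w} {v} w∈ v∈ pos pos′ eq with fact {w} {p′} pos | fact {v} {p′} pos′
        ... | ew , l , dp | ev , l′ , dp′ = trans (sym (set₂-undo distinct _ _ w))
            (trans (cong₂ (λ a b → set₂ p p′ a b (move p p′ w)) same same′)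
              (trans (cong (set₂ p p′ (d p v) (d p′ v)) eq) (set₂-undo distinct _ _ v)))
          where
          distinct = le-sep-≢ {ks = keys w} (pe w∈ ew) l
          same : d p w ≡ d p v
          same = suc-injective (trans (sym (d-set₂ˡ distinct _ _ w (col∈ w∈ p∈)))
            (trans (cong (d p) eq) (d-set₂ˡ distinct _ _ v (col∈ v∈ p∈))))
          same′ : d p′ w ≡ d p′ v
          same′ = ∸-cancelʳ-≡ dp dp′ (trans (sym (d-set₂ʳ distinct _ _ w (col∈ w∈ p′∈)))
            (trans (cong (d p′) eq) (d-set₂ʳ distinct _ _ v (col∈ v∈ p′∈))))

    module Pair {s s′ e : K} (s∈ : s ∈ cols) (s′∈ : s′ ∈ cols)
      (se : ∀ {w} → w ∈ Ω → le s e (keys w) ≡ true) (s′e : ∀ {w} → w ∈ Ω → le s′ e (keys w) ≡ false)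
      (free : ∀ {q} → q ∈ cols → Free q) where

      -- With everything fixed except how `s` and `s′` share their letters, the admissible sizes of
      -- the run of `s` are closed upwards, by `shift-∈`; a word is bad when 0 is not among them.
      Bad : Word → Set
      Bad w = ¬ (set₂ s s′ 0 (d s w + d s′ w) w ∈ Ω)

      Bad? : ∀ w → Dec (Bad w)
      Bad? w = ¬? (set₂ s s′ 0 (d s w + d s′ w) w ∈ʷ? Ω)

      private
        distinct : ∀ {w} → w ∈ Ω → s ≢ s′
        distinct {w} w∈ = le-sep-≢ {ks = keys w} (se w∈) (s′e w∈)

        up : ℕ → Word → Word
        up u w = set₂ s s′ (d s w + suc u) (d s′ w ∸ suc u) w

        down : ℕ → Word → Word
        down u w = set₂ s s′ (d s w ∸ suc u) (d s′ w + suc u) w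

        Low : ℕ → Word → Set
        Low u w = suc u ≤ d s w × down u w ∈ Ω

        Low? : ∀ u w → Dec (Low u w)
        Low? u w = suc u ≤? d s w ×-dec down u w ∈ʷ? Ω

        d≤N : ∀ {w p} → w ∈ Ω → p ∈ cols → d p w ≤ N
        d≤N {w} w∈ p∈ = ≤-trans (∑-member (λ p → d p w) p∈) (≤-reflexive (∑-cols-d w∈))

        up-sum : ∀ u w → suc u ≤ d s′ w → d s w + suc u + (d s′ w ∸ suc u) ≡ d s w + d s′ w
        up-sum u w le = trans (+-assoc (d s w) _ _) (cong (d s w +_) (m+[n∸m]≡n le))

        down-up : ∀ {u w} → w ∈ Ω → suc u ≤ d s′ w → down u (up u w) ≡ w
        down-up {u} {w} w∈ le
          rewrite d-set₂ˡ (distinct w∈) (d s w + suc u) (d s′ w ∸ suc u) w (col∈ w∈ s∈)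
                | d-set₂ʳ (distinct w∈) (d s w + suc u) (d s′ w ∸ suc u) w (col∈ w∈ s′∈)
                | m+n∸n≡m (d s w) (suc u) | m∸n+n≡m le = set₂-undo (distinct w∈) _ _ w

        -- `down u` undoes `up u`, so the words reached by `up u` are words from which `suc u`
        -- letters can be moved back within Ω.
        raised : ∀ u → ∑ Ω (λ w → 𝟙 (suc u ≤? d s′ w)) ≤ ∑ Ω (λ w → 𝟙 (Low? u w))
        raised u = ∑-inject Ω Ω (up u) unique into inj
          where
          pos⇒ : ∀ w → 0 < 𝟙 (suc u ≤? d s′ w) → suc u ≤ d s′ w
          pos⇒ w = 𝟙-true (suc u ≤? d s′ w)
          into : ∀ {w} → w ∈ Ω → 0 < 𝟙 (suc u ≤? d s′ w) → up u w ∈ Ω × 𝟙 (suc u ≤? d s′ w) ≤ 𝟙 (Low? u (up u w))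
          into {w} w∈ pos = shift-∈ _ _ w∈ s∈ s′∈ (se w∈) (s′e w∈) (λ q∈ _ → free q∈) (up-sum u w (pos⇒ w pos)) (m≤m+n _ _)
            , 𝟙-mono (suc u ≤? d s′ w) (Low? u (up u w)) λ le →
                subst (suc u ≤_) (sym (d-set₂ˡ (distinct w∈) _ _ w (col∈ w∈ s∈))) (m≤n+m (suc u) (d s w))
                , subst (_∈ Ω) (sym (down-up w∈ le)) w∈
          inj : ∀ {w v} → w ∈ Ω → v ∈ Ω → 0 < 𝟙 (suc u ≤? d s′ w) → 0 < 𝟙 (suc u ≤? d s′ v) → up u w ≡ up u v → w ≡ v
          inj {w} {v} w∈ v∈ pos pos′ eq = trans (sym (down-up w∈ (pos⇒ w pos))) (trans (cong (down u) eq) (down-up v∈ (pos⇒ v pos′)))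

        -- Of the `d s w` amounts that could be moved from `s` to `s′`, a bad word forbids at least
        -- the full one. A word with `d s w` equal to 0 is never bad, since then the move changes
        -- nothing.
        low-count : ∀ {w} → w ∈ Ω → 𝟙 (Bad? w) + ∑ (downFrom N) (λ u → 𝟙 (Low? u w)) ≤ d s w
        low-count {w} w∈ with Bad? w
        ... | no _ = ≤-trans (∑-mono (downFrom N) (λ {u} _ → 𝟙-mono (Low? u w) (suc u ≤? d s w) proj₁))
            (≤-reflexive (∑-thresholds N (d≤N w∈ s∈)))
        ... | yes bad with d s w in eq
        ...   | zero = contradiction
            (subst (_∈ Ω) (sym (trans (cong (λ z → set₂ s s′ z (d s′ w) w) (sym eq))
              (trans (cong (set s (d s w)) (set-id s′ w)) (set-id s w)))) w∈) bad
        ...   | suc k = s≤s (≤-trans (∑-mono (downFrom N) (λ {u} _ → 𝟙-mono (suc u ≤? suc k ×-dec _) (suc u ≤? k) (strict u)))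
            (≤-reflexive (∑-thresholds N (≤-trans (n≤1+n k) (subst (_≤ N) eq (d≤N w∈ s∈))))))
          where
          strict : ∀ u → suc u ≤ suc k × set₂ s s′ (suc k ∸ suc u) (d s′ w + suc u) w ∈ Ω → suc u ≤ k
          strict u (le , low) with m≤n⇒m<n∨m≡n le
          ... | inj₁ lt = ≤-pred lt
          ... | inj₂ refl = contradiction (subst₂ (λ a b → set₂ s s′ a b w ∈ Ω) (n∸n≡0 k) (+-comm (d s′ w) (suc k)) low) bad

      -- Moving u letters from s′ to s is injective, and for u = d s its image misses the bad words.
      bad-bound : ∑ Ω (λ w → 𝟙 (Bad? w)) + ∑ Ω (d s′) ≤ ∑ Ω (d s)
      bad-bound = begin
        ∑ Ω (λ w → 𝟙 (Bad? w)) + ∑ Ω (d s′)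
          ≡⟨ cong (∑ Ω (λ w → 𝟙 (Bad? w)) +_) (∑-cong Ω λ w∈ → sym (∑-thresholds N (d≤N w∈ s′∈))) ⟩
        ∑ Ω (λ w → 𝟙 (Bad? w)) + ∑ Ω (λ w → ∑ (downFrom N) (λ u → 𝟙 (suc u ≤? d s′ w)))
          ≡⟨ cong (∑ Ω (λ w → 𝟙 (Bad? w)) +_) (∑-swap Ω (downFrom N) _) ⟩
        ∑ Ω (λ w → 𝟙 (Bad? w)) + ∑ (downFrom N) (λ u → ∑ Ω (λ w → 𝟙 (suc u ≤? d s′ w)))
          ≤⟨ +-monoʳ-≤ _ (∑-mono (downFrom N) (λ {u} _ → raised u)) ⟩
        ∑ Ω (λ w → 𝟙 (Bad? w)) + ∑ (downFrom N) (λ u → ∑ Ω (λ w → 𝟙 (Low? u w)))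
          ≡⟨ cong (∑ Ω (λ w → 𝟙 (Bad? w)) +_) (∑-swap (downFrom N) Ω _) ⟩
        ∑ Ω (λ w → 𝟙 (Bad? w)) + ∑ Ω (λ w → ∑ (downFrom N) (λ u → 𝟙 (Low? u w)))
          ≡⟨ ∑-+ Ω _ _ ⟨
        ∑ Ω (λ w → 𝟙 (Bad? w) + ∑ (downFrom N) (λ u → 𝟙 (Low? u w)))
          ≤⟨ ∑-mono Ω low-count ⟩
        ∑ Ω (d s) ∎
        where open ≤-Reasoning

      -- With everything else fixed, d s is uniform on {0, …, d s + d s′}, and X e determines it.
      pair-spread : ∀ {I : Word → Set} (I? : ∀ w → Dec (I w)) k R
        (G? : ∀ w → Dec (I w × ¬ Bad w × X e w ≡ k × R ≤ d s w + d s′ w)) →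
        (∀ {w} x y → w ∈ Ω → x + y ≡ d s w + d s′ w → I w → I (set₂ s s′ x y w)) →
        ∑ Ω (λ w → 𝟙 (G? w)) * suc R ≤ ∑ Ω (λ w → 𝟙 (I? w))
      pair-spread {I} I? k R G? inv = begin
        ∑ Ω (λ w → 𝟙 (G? w)) * suc R  ≡⟨ *-comm _ (suc R) ⟩
        suc R * ∑ Ω (λ w → 𝟙 (G? w))  ≡⟨ cong (_* ∑ Ω (λ w → 𝟙 (G? w))) (length-downFrom (suc R)) ⟨
        length (downFrom (suc R)) * ∑ Ω (λ w → 𝟙 (G? w))  ≡⟨ ∑-const (downFrom (suc R)) _ ⟨
        ∑ (downFrom (suc R)) (λ u → ∑ Ω (λ w → 𝟙 (G? w)))  ≤⟨ ∑-mono (downFrom (suc R)) spread ⟩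
        ∑ (downFrom (suc R)) (λ u → ∑ Ω (λ w → 𝟙 (H? w u)))  ≡⟨ ∑-swap (downFrom (suc R)) Ω _ ⟩
        ∑ Ω (λ w → ∑ (downFrom (suc R)) (λ u → 𝟙 (H? w u)))  ≤⟨ ∑-mono Ω (λ {w} _ → disjoint w) ⟩
        ∑ Ω (λ w → 𝟙 (I? w))  ∎
        where
        open ≤-Reasoning
        H? : ∀ w u → Dec (I w × d s w ≡ u)
        H? w u = I? w ×-dec d s w ℕP.≟ u
        disjoint : ∀ w → ∑ (downFrom (suc R)) (λ u → 𝟙 (H? w u)) ≤ 𝟙 (I? w)
        disjoint w with I? w
        ... | yes i = ∑-exclusive (downFrom (suc R)) (λ u → yes i ×-dec d s w ℕP.≟ u) (downFrom⁺ (suc R))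
                        (λ _ _ h h′ → trans (sym (proj₂ h)) (proj₂ h′))
        ... | no ¬i = ≤-reflexive (trans (∑-cong (downFrom (suc R))
                        (λ {u} _ → 𝟙-no (no ¬i ×-dec d s w ℕP.≟ u) (λ h → ¬i (proj₁ h)))) (∑-0 (downFrom (suc R))))
        spread : ∀ {u} → u ∈ downFrom (suc R) → ∑ Ω (λ w → 𝟙 (G? w)) ≤ ∑ Ω (λ w → 𝟙 (H? w u))
        spread {u} u∈ = ∑-inject Ω Ω f unique into inj
          where
          u≤R : u ≤ R
          u≤R = ≤-pred (∈-downFrom⁻ u∈)
          f : Word → Word
          f w = set₂ s s′ u (d s w + d s′ w ∸ u) w
          G⇒ : ∀ {w} → 0 < 𝟙 (G? w) → I w × ¬ Bad w × X e w ≡ k × R ≤ d s w + d s′ w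
          G⇒ {w} = 𝟙-true (G? w)
          into : ∀ {w} → w ∈ Ω → 0 < 𝟙 (G? w) → f w ∈ Ω × 𝟙 (G? w) ≤ 𝟙 (H? (f w) u)
          into {w} w∈ pos with G⇒ {w} pos
          -- Setting the run of `s` to `u` directly could shrink it, which `raise` does not cover.
          -- The detour through `w₀`, where this run is empty and which lies in Ω because `w` is not
          -- bad, makes it a forward move of `u` letters.
          ... | i , ¬bad , _ , R≤ = subst (_∈ Ω) (set₂-set₂ u _ 0 _ w (distinct w∈)) lifted
              , 𝟙-mono (G? w) (H? (f w) u) (λ _ → inv u _ w∈ parts i , d-set₂ˡ (distinct w∈) _ _ w (col∈ w∈ s∈))
            where
            S₀ = d s w + d s′ w
            w₀ = set₂ s s′ 0 S₀ w
            w₀∈ : w₀ ∈ Ω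
            w₀∈ = decidable-stable (w₀ ∈ʷ? Ω) ¬bad
            parts : u + (S₀ ∸ u) ≡ S₀
            parts = m+[n∸m]≡n (≤-trans u≤R R≤)
            d₀ : d s w₀ ≡ 0
            d₀ = d-set₂ˡ (distinct w∈) 0 S₀ w (col∈ w∈ s∈)
            lifted : set₂ s s′ u (S₀ ∸ u) w₀ ∈ Ω
            lifted = shift-∈ u (S₀ ∸ u) w₀∈ s∈ s′∈ (se w₀∈) (s′e w₀∈) (λ q∈ _ → free q∈)
              (trans parts (sym (cong₂ _+_ d₀ (d-set₂ʳ (distinct w∈) 0 S₀ w (col∈ w∈ s′∈)))))
              (subst (_≤ u) (sym d₀) z≤n)
          inj : ∀ {w v} → w ∈ Ω → v ∈ Ω → 0 < 𝟙 (G? w) → 0 < 𝟙 (G? v) → f w ≡ f v → w ≡ v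
          inj {w} {v} w∈ v∈ pos pos′ eq with G⇒ {w} pos | G⇒ {v} pos′
          ... | _ , _ , Xw , R≤ | _ , _ , Xv , R≤′ = trans (sym (set₂-undo (distinct w∈) _ _ w))
              (trans (cong₂ (λ a b → set₂ s s′ a b (f w)) same same′)
                (trans (cong (set₂ s s′ (d s v) (d s′ v)) eq) (set₂-undo (distinct w∈) _ _ v)))
            where
            at : ∀ {w} → w ∈ Ω → X e w ≡ k → X e (f w) + d s w ≡ k + u
            at {w} w∈ Xw = trans (X-set₂-between u _ w (se w∈) (s′e w∈) (se w∈) (s′e w∈)) (cong (_+ u) Xw)
            same : d s w ≡ d s v
            same = +-cancelˡ-≡ (X e (f w)) _ _ (trans (at w∈ Xw) (trans (sym (at v∈ Xv)) (cong (λ z → X e z + d s v) (sym eq))))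
            sums : d s w + d s′ w ≡ d s v + d s′ v
            sums = ∸-cancelʳ-≡ (≤-trans u≤R R≤) (≤-trans u≤R R≤′)
              (trans (sym (d-set₂ʳ (distinct w∈) _ _ w (col∈ w∈ s′∈))) (trans (cong (d s′) eq) (d-set₂ʳ (distinct w∈) _ _ v (col∈ v∈ s′∈))))
            same′ : d s′ w ≡ d s′ v
            same′ = +-cancelˡ-≡ (d s w) _ _ (trans sums (cong (_+ d s′ v) (sym same)))

  -- The distribution of `X q` when every column is free

  module _ (M : Model) (free : ∀ {q} → q ∈ Model.cols M → Model.Free M q) where
    open Model M
    open Moves M

    atom : K → ℕ → ℕ
    atom q k = ∑ Ω (λ w → 𝟙 (X q w ℕP.≟ k))

    A≤cols : ∀ e w → A e w ≤ length cols
    A≤cols e w = ≤-trans (∑-mono cols (λ _ → 𝟙≤1 _)) (≤-reflexive (trans (∑-const cols 1) (*-identityʳ _)))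

    S≡ : ∀ {w e x} → w ∈ Ω → X e w ≡ x → S e w ≡ N ∸ x
    S≡ {w} {e} w∈ refl = sym (trans (cong (_∸ X e w) (sym (X+S e w∈))) (m+n∸m≡n (X e w) (S e w)))

    -- The `N ∸ k` letters after `q` are the candidates for a move to `q`. In a resulting word
    -- `N ∸ suc k` letters and at most `suc n` columns come after `q`, so it arises with
    -- multiplicity at most `N ∸ k + n`.
    atom-step : ∀ {q} k n → q ∈ cols → length cols ≡ suc n → k < N →
      (N ∸ k) * atom q k ≤ (N ∸ k + n) * atom q (suc k)
    atom-step {q} k n q∈ len k<N = begin
      (N ∸ k) * atom q k  ≡⟨ *-comm (N ∸ k) _ ⟩
      atom q k * (N ∸ k)  ≡⟨ ∑-* Ω _ (N ∸ k) ⟨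
      ∑ Ω (λ w → 𝟙 (X q w ℕP.≟ k) * (N ∸ k))  ≤⟨ ∑-mono Ω (λ {w} w∈ → 𝟙-bound (X q w ℕP.≟ k) (λ h → ≤-reflexive (sym (S≡ w∈ h)))) ⟩
      ∑ Ω (λ w → 𝟙 (X q w ℕP.≟ k) * S q w)  ≤⟨ single-move (λ w → X q w ℕP.≟ k) (λ w → X q w ℕP.≟ suc k) q∈
                                                                             (λ w∈ _ → le-refl (col∈ w∈ q∈)) (λ _ _ q∈ _ → free q∈) step ⟩
      ∑ Ω (λ w → 𝟙 (X q w ℕP.≟ suc k) * (S q w + A q w))  ≤⟨ ∑-mono Ω (λ {w} w∈ → 𝟙-bound (X q w ℕP.≟ suc k) (bound w∈)) ⟩
      ∑ Ω (λ w → 𝟙 (X q w ℕP.≟ suc k) * (N ∸ k + n))  ≡⟨ ∑-* Ω _ (N ∸ k + n) ⟩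
      atom q (suc k) * (N ∸ k + n)  ≡⟨ *-comm _ (N ∸ k + n) ⟩
      (N ∸ k + n) * atom q (suc k)  ∎
      where
      open ≤-Reasoning
      step : ∀ {w p′} → w ∈ Ω → X q w ≡ k → p′ ∈ cols → le p′ q (keys w) ≡ false → 0 < d p′ w → X q (move q p′ w) ≡ suc k
      step {w} {p′} w∈ h p′∈ l pos = +-cancelʳ-≡ (d q w) _ _ (trans
        (X-set₂-between {e = q} (suc (d q w)) _ w (le-refl (col∈ w∈ q∈)) l (le-refl (col∈ w∈ q∈)) l)
        (trans (cong (_+ suc (d q w)) h) (+-suc k (d q w))))
      bound : ∀ {w} → w ∈ Ω → X q w ≡ suc k → S q w + A q w ≤ N ∸ k + n
      bound {w} w∈ h = begin
        S q w + A q w  ≤⟨ +-mono-≤ (≤-reflexive (S≡ w∈ h)) (≤-trans (A≤cols q w) (≤-reflexive len)) ⟩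
        N ∸ suc k + suc n  ≡⟨ +-suc _ n ⟩
        suc (N ∸ suc k) + n  ≡⟨ cong (_+ n) (sym (+-∸-assoc 1 k<N)) ⟩
        N ∸ k + n  ∎

    atoms-disjoint : ∀ q (ks : List ℕ) → Unique ks → ∑ ks (atom q) ≤ length Ω
    atoms-disjoint q ks u = begin
      ∑ ks (atom q)  ≡⟨ ∑-swap ks Ω _ ⟩
      ∑ Ω (λ w → ∑ ks (λ k → 𝟙 (X q w ℕP.≟ k)))  ≤⟨ ∑-mono Ω (λ {w} _ → ∑-exclusive ks (λ k → X q w ℕP.≟ k) u (λ _ _ e e′ → trans (sym e) e′)) ⟩
      ∑ Ω (λ _ → 1)  ≡⟨ ∑-const Ω 1 ⟩
      length Ω * 1  ≡⟨ *-identityʳ _ ⟩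
      length Ω  ∎
      where open ≤-Reasoning

    -- When the chain dominates, successive atoms are nearly equal.
    sparse-atom : ∀ {q} k n R → q ∈ cols → length cols ≡ suc n → k + R + suc (2 * R * n) ≤ N →
      R * atom q k ≤ 2 * length Ω
    sparse-atom {q} k n R q∈ len room = begin
      R * atom q k  ≡⟨ cong (_* atom q k) (length-downFrom R) ⟨
      length (downFrom R) * atom q k  ≡⟨ ∑-const (downFrom R) _ ⟨
      ∑ (downFrom R) (λ _ → atom q k)  ≤⟨ ∑-mono (downFrom R) (λ {j} j∈ → half j (∈-downFrom⁻ j∈)) ⟩
      ∑ (downFrom R) (λ j → atom q (k + j) * 2)  ≡⟨ ∑-* (downFrom R) _ 2 ⟩
      ∑ (downFrom R) (λ j → atom q (k + j)) * 2  ≡⟨ cong (_* 2) (∑-map (k +_) (downFrom R) (atom q)) ⟨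
      ∑ (map (k +_) (downFrom R)) (atom q) * 2  ≤⟨ *-monoˡ-≤ 2 (atoms-disjoint q _ (UniqueP.map⁺ (+-cancelˡ-≡ k _ _) (downFrom⁺ R))) ⟩
      length Ω * 2  ≡⟨ *-comm (length Ω) 2 ⟩
      2 * length Ω  ∎
      where
      open ≤-Reasoning
      -- One step loses at most a fraction 1/(H + 1) of the atom, so fewer than `R` steps lose less
      -- than half of it.
      H = 2 * R
      a : ℕ → ℕ
      a j = atom q (k + j)
      step : ∀ j → j ≤ R → H * a j ≤ suc H * a (suc j)
      step j j≤R = *-cancelˡ-≤ m {{>-nonZero m>0}} (begin
        m * (H * a j)  ≡⟨ *-x∙yz≈y∙xz m H (a j) ⟩
        H * (m * a j)  ≤⟨ *-monoʳ-≤ H (subst (λ z → m * a j ≤ (m + n) * atom q z) (sym (+-suc k j)) (atom-step (k + j) n q∈ len k+j<N)) ⟩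
        H * ((m + n) * a (suc j))  ≡⟨ lem₂ H m n (a (suc j)) ⟩
        (m * H + H * n) * a (suc j)  ≤⟨ *-monoˡ-≤ (a (suc j)) (+-monoʳ-≤ (m * H) (≤-trans (n≤1+n _) Hn<m)) ⟩
        (m * H + m) * a (suc j)  ≡⟨ lem₃ m H (a (suc j)) ⟩
        m * (suc H * a (suc j))  ∎)
        where
        m = N ∸ (k + j)
        lem₂ : ∀ x y z u → x * ((y + z) * u) ≡ (y * x + x * z) * u
        lem₂ = solve-∀
        lem₃ : ∀ x y z → (x * y + x) * z ≡ x * (suc y * z)
        lem₃ = solve-∀
        Hn<m : suc (H * n) ≤ m
        Hn<m = m+n≤o⇒m≤o∸n (suc (H * n)) (≤-trans (≤-trans (≤-reflexive (+-comm (suc (H * n)) (k + j)))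
          (+-monoˡ-≤ (suc (H * n)) (+-monoʳ-≤ k j≤R))) room)
        m>0 : 0 < m
        m>0 = ≤-trans (s≤s z≤n) Hn<m
        k+j<N : k + j < N
        k+j<N = m∸n≢0⇒n<m (λ e → <⇒≢ m>0 (sym e))
      -- While `a j` is at most `a 0`, the loss of a step is at most `a 0` / (H + 1) and is added to
      -- the previous losses. If `a j` exceeds `a 0`, the count of losses starts afresh from `a 0`.
      slow : ∀ j → j ≤ R → suc H * a 0 ≤ suc H * a j + j * a 0
      slow zero _ = m≤m+n _ 0
      slow (suc j) j<R with ≤-total (a j) (a 0)
      ... | inj₁ aj≤ = +-cancelʳ-≤ (a j) _ _ (begin
        suc H * a 0 + a j  ≤⟨ +-monoˡ-≤ (a j) (slow j (<⇒≤ j<R)) ⟩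
        suc H * a j + j * a 0 + a j  ≡⟨ lem₁ H (a j) (j * a 0) ⟩
        H * a j + a j + (j * a 0 + a j)  ≤⟨ +-mono-≤ (+-monoˡ-≤ (a j) (step j (<⇒≤ j<R))) (+-monoʳ-≤ (j * a 0) aj≤) ⟩
        suc H * a (suc j) + a j + (j * a 0 + a 0)  ≡⟨ lem₂ (suc H * a (suc j)) (a j) j (a 0) ⟩
        suc H * a (suc j) + suc j * a 0 + a j  ∎)
        where
        lem₁ : ∀ h x y → suc h * x + y + x ≡ h * x + x + (y + x)
        lem₁ = solve-∀
        lem₂ : ∀ p x j y → p + x + (j * y + y) ≡ p + suc j * y + x
        lem₂ = solve-∀
      ... | inj₂ a0≤ = begin
        suc H * a 0  ≡⟨ +-comm (a 0) (H * a 0) ⟩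
        H * a 0 + a 0  ≤⟨ +-monoˡ-≤ (a 0) (*-monoʳ-≤ H a0≤) ⟩
        H * a j + a 0  ≤⟨ +-mono-≤ (step j (<⇒≤ j<R)) (m≤m+n (a 0) (j * a 0)) ⟩
        suc H * a (suc j) + suc j * a 0  ∎
      half : ∀ j → j < R → atom q k ≤ a j * 2
      half j j<R = *-cancelˡ-≤ (suc H) (+-cancelʳ-≤ (H * a 0) _ _ (begin
        suc H * atom q k + H * a 0  ≡⟨ cong (λ z → suc H * atom q z + H * a 0) (sym (+-identityʳ k)) ⟩
        suc H * a 0 + H * a 0  ≤⟨ +-monoʳ-≤ (suc H * a 0) (*-monoˡ-≤ (a 0) (n≤1+n H)) ⟩
        suc H * a 0 + suc H * a 0  ≤⟨ +-mono-≤ (slow j (<⇒≤ j<R)) (slow j (<⇒≤ j<R)) ⟩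
        suc H * a j + j * a 0 + (suc H * a j + j * a 0) ≡⟨ lem (suc H) (a j) (j * a 0) ⟩
        suc H * (a j * 2) + 2 * (j * a 0)  ≤⟨ +-monoʳ-≤ (suc H * (a j * 2)) (≤-trans (≤-reflexive (sym (*-assoc 2 j (a 0)))) (*-monoˡ-≤ (a 0) (*-monoʳ-≤ 2 (<⇒≤ j<R)))) ⟩
        suc H * (a j * 2) + H * a 0  ∎))
        where
        lem : ∀ h x y → h * x + y + (h * x + y) ≡ h * (x * 2) + 2 * y
        lem = solve-∀

    -- Mean run lengths along a chain of columns, and windows of columns

    module Columns (col : ℕ → K) (u : ℕ) (col-∈ : ∀ {i} → i ≤ u → col i ∈ cols)
      (col-≤ : ∀ {w i j} → w ∈ Ω → i ≤ j → j ≤ u → le (col i) (col j) (keys w) ≡ true)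
      (col-> : ∀ {w i j} → w ∈ Ω → i < j → j ≤ u → le (col j) (col i) (keys w) ≡ false) where

      col-≢ : ∀ {w i j} → w ∈ Ω → i < j → j ≤ u → col i ≢ col j
      col-≢ {w} {i} {j} w∈ i<j j≤u e = contradiction
        (trans (sym (col-≤ w∈ ≤-refl j≤u)) (subst (λ c → le (col j) c (keys w) ≡ false) e (col-> w∈ i<j j≤u))) λ ()

      col-injective : ∀ {w i j} → w ∈ Ω → i ≤ u → j ≤ u → col i ≡ col j → i ≡ j
      col-injective {i = i} {j} w∈ i≤u j≤u e with <-cmp i j
      ... | tri< i<j _ _ = contradiction e (col-≢ w∈ i<j j≤u)
      ... | tri≈ _ i≡j _ = i≡j
      ... | tri> _ _ j<i = contradiction (sym e) (col-≢ w∈ j<i i≤u)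

      mean : ℕ → ℕ
      mean i = ∑ Ω (d (col i))

      mean-antitone : ∀ {i j} → i ≤ j → j ≤ u → mean j ≤ mean i
      mean-antitone {i} {j} i≤j j≤u with m≤n⇒m<n∨m≡n i≤j
      ... | inj₂ refl = ≤-refl
      ... | inj₁ i<j = ≤-trans (m≤n+m _ _) (Pair.bad-bound {e = col i} (col-∈ (≤-trans i≤j j≤u)) (col-∈ j≤u)
              (λ w∈ → col-≤ w∈ ≤-refl (≤-trans i≤j j≤u)) (λ w∈ → col-> w∈ i<j j≤u) free)

      -- By monotonicity each of the `h` earlier columns has a mean of at least `mean h`, and their
      -- runs together hold at most `N` letters.
      mean-bound : ∀ h → h ≤ u → h * mean h ≤ N * length Ω
      mean-bound h h≤u = begin
        h * mean h  ≡⟨ cong (_* mean h) (length-downFrom h) ⟨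
        length (downFrom h) * mean h  ≡⟨ ∑-const (downFrom h) _ ⟨
        ∑ (downFrom h) (λ _ → mean h)  ≤⟨ ∑-mono (downFrom h) (λ m → mean-antitone (<⇒≤ (∈-downFrom⁻ m)) h≤u) ⟩
        ∑ (downFrom h) mean  ≡⟨ ∑-swap (downFrom h) Ω _ ⟩
        ∑ Ω (λ w → ∑ (downFrom h) (λ i → d (col i) w))  ≤⟨ ∑-mono Ω total-bound ⟩
        ∑ Ω (λ _ → N)  ≡⟨ ∑-const Ω N ⟩
        length Ω * N  ≡⟨ *-comm (length Ω) N ⟩
        N * length Ω  ∎
        where
        open ≤-Reasoning
        below : ∀ {i} → i ∈ downFrom h → i ≤ u
        below m = ≤-trans (<⇒≤ (∈-downFrom⁻ m)) h≤u
        total-bound : ∀ {w} → w ∈ Ω → ∑ (downFrom h) (λ i → d (col i) w) ≤ N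
        total-bound {w} w∈ = ≤-trans (∑-inject (downFrom h) cols col (downFrom⁺ h)
            (λ m _ → col-∈ (below m) , ≤-refl) (λ m m′ _ _ e → col-injective w∈ (below m) (below m′) e))
          (≤-reflexive (∑-cols-d w∈))

      -- The columns h, …, h + T − 1 are paired with the columns h + T + 1, …, h + 2T around q = col (h + T).
      module Window (h T : ℕ) (T>0 : 0 < T) (fits : h + (T + T) ≤ u) (k : ℕ) where

        s s′ : ℕ → K
        s r = col (h + r)
        s′ r = col (h + (T + suc r))

        q e : K
        q = col (h + T)
        e = col (h + (T + T))

        private
          right≤ : ∀ {r} → r < T → h + (T + suc r) ≤ h + (T + T)
          right≤ r<T = +-monoʳ-≤ h (+-monoʳ-≤ T r<T)
          right-u : ∀ {r} → r < T → h + (T + suc r) ≤ u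
          right-u r<T = ≤-trans (right≤ r<T) fits
          q-u : h + T ≤ u
          q-u = ≤-trans (+-monoʳ-≤ h (m≤m+n T T)) fits
          left≤ : ∀ {r} → r < T → h + r ≤ h + T
          left≤ r<T = +-monoʳ-≤ h (<⇒≤ r<T)
          left-u : ∀ {r} → r < T → h + r ≤ u
          left-u r<T = ≤-trans (left≤ r<T) q-u
          q<right : ∀ r → h + T < h + (T + suc r)
          q<right r = +-monoʳ-< h (m<m+n T (s≤s z≤n))

          s-q : ∀ {r w} → r < T → w ∈ Ω → le (s r) q (keys w) ≡ true
          s-q r<T w∈ = col-≤ w∈ (left≤ r<T) q-u
          s′-q : ∀ {r w} → r < T → w ∈ Ω → le (s′ r) q (keys w) ≡ false
          s′-q {r} r<T w∈ = col-> w∈ (q<right r) (right-u r<T)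
          s′-e : ∀ {r w} → r < T → w ∈ Ω → le (s′ r) e (keys w) ≡ true
          s′-e r<T w∈ = col-≤ w∈ (right≤ r<T) fits

          s-injective : ∀ {r r′ w} → r < T → r′ < T → w ∈ Ω → s r ≡ s r′ → r ≡ r′
          s-injective p p′ w∈ e = +-cancelˡ-≡ h _ _ (col-injective w∈ (left-u p) (left-u p′) e)
          s′-injective : ∀ {r r′ w} → r < T → r′ < T → w ∈ Ω → s′ r ≡ s′ r′ → r ≡ r′
          s′-injective p p′ w∈ e = suc-injective (+-cancelˡ-≡ T _ _ (+-cancelˡ-≡ h _ _ (col-injective w∈ (right-u p) (right-u p′) e)))
          s≢s′ : ∀ {r r′ w} → r < T → r′ < T → w ∈ Ω → s r ≢ s′ r′
          s≢s′ {r} {r′} p p′ w∈ = col-≢ w∈ (<-≤-trans (+-monoʳ-< h p) (<⇒≤ (q<right r′))) (right-u p′)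

          module P {r} (r<T : r < T) = Pair {s = s r} {s′ r} {q} (col-∈ (left-u r<T)) (col-∈ (right-u r<T))
            (s-q r<T) (s′-q r<T) free

        module _ (R : ℕ) where

          Small : ℕ → Word → Set
          Small r w = d (s r) w + d (s′ r) w < R

          -- Splitting by the first pair with at least `R` letters serves two ends. The events for
          -- different `r` are disjoint, so the `T` uses of `pair-spread` add up to at most |Ω|; and
          -- each event depends only on the sums over the pairs, so it survives a redistribution
          -- inside pair `r`.
          First : ℕ → Word → Set
          First r w = ¬ Small r w × All (λ r′ → Small r′ w) (downFrom r)

          First? : ∀ r w → Dec (First r w)
          First? r w = ¬? (d (s r) w + d (s′ r) w <? R) ×-dec All.all? (λ r′ → d (s r′) w + d (s′ r′) w <? R) (downFrom r)

          AllSmall : Word → Set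
          AllSmall w = All (λ r → Small r w) (downFrom T)

          first-or-small : ∀ w t → All (λ r → Small r w) (downFrom t) ⊎ (∃[ r ] r < t × First r w)
          first-or-small w zero = inj₁ []
          first-or-small w (suc t) with first-or-small w t
          ... | inj₂ (r , r<t , f) = inj₂ (r , m<n⇒m<1+n r<t , f)
          ... | inj₁ small with d (s t) w + d (s′ t) w <? R
          ...   | yes p = inj₁ (p ∷ small)
          ...   | no ¬p = inj₂ (t , ≤-refl , ¬p , small)

          -- The results on a pair need a proof of `r < T`; the value 0 for other `r` makes these
          -- functions summable over all of `downFrom T`.
          bad good : ℕ → Word → ℕ
          bad r w with r <? T
          ... | yes r<T = 𝟙 (P.Bad? r<T w)
          ... | no _ = 0
          good r w with r <? T
          ... | yes r<T = 𝟙 (First? r w ×-dec ¬? (P.Bad? r<T w) ×-dec (X q w ℕP.≟ k) ×-dec (R ≤? d (s r) w + d (s′ r) w))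
          ... | no _ = 0

          -- By `bad-bound` a pair has at most as many bad words as the difference of its two means.
          -- Monotonicity replaces this by the difference between the two ends of the window.
          bad-total : ∑ Ω (λ w → ∑ (downFrom T) (λ r → bad r w)) + T * mean (h + (T + T)) ≤ T * mean h
          bad-total = begin
            ∑ Ω (λ w → ∑ (downFrom T) (λ r → bad r w)) + T * μ′  ≡⟨ cong₂ _+_ (∑-swap Ω (downFrom T) _) (const μ′) ⟩
            ∑ (downFrom T) (λ r → ∑ Ω (bad r)) + ∑ (downFrom T) (λ _ → μ′)  ≡⟨ ∑-+ (downFrom T) _ _ ⟨
            ∑ (downFrom T) (λ r → ∑ Ω (bad r) + μ′)  ≤⟨ ∑-mono (downFrom T) (λ m → one _ (∈-downFrom⁻ m)) ⟩
            ∑ (downFrom T) (λ _ → mean h)  ≡⟨ const (mean h) ⟨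
            T * mean h  ∎
            where
            open ≤-Reasoning
            μ′ = mean (h + (T + T))
            const : ∀ c → T * c ≡ ∑ (downFrom T) (λ _ → c)
            const c = trans (cong (_* c) (sym (length-downFrom T))) (sym (∑-const (downFrom T) c))
            one : ∀ r → r < T → ∑ Ω (bad r) + μ′ ≤ mean h
            one r r<T with r <? T
            ... | no n = contradiction r<T n
            ... | yes p = ≤-trans (+-monoʳ-≤ _ (mean-antitone (right≤ p) fits))
                    (≤-trans (P.bad-bound p) (mean-antitone (m≤m+n h r) (left-u p)))

          good-total : ∑ Ω (λ w → ∑ (downFrom T) (λ r → good r w)) * suc R ≤ length Ω
          good-total = begin
            ∑ Ω (λ w → ∑ (downFrom T) (λ r → good r w)) * suc R  ≡⟨ cong (_* suc R) (∑-swap Ω (downFrom T) _) ⟩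
            ∑ (downFrom T) (λ r → ∑ Ω (good r)) * suc R  ≡⟨ ∑-* (downFrom T) _ (suc R) ⟨
            ∑ (downFrom T) (λ r → ∑ Ω (good r) * suc R)  ≤⟨ ∑-mono (downFrom T) (λ m → one _ (∈-downFrom⁻ m)) ⟩
            ∑ (downFrom T) (λ r → ∑ Ω (λ w → 𝟙 (First? r w)))  ≡⟨ ∑-swap (downFrom T) Ω _ ⟩
            ∑ Ω (λ w → ∑ (downFrom T) (λ r → 𝟙 (First? r w)))  ≤⟨ ∑-mono Ω (λ {w} _ → ∑-exclusive (downFrom T) (λ r → First? r w) (downFrom⁺ T) (λ _ _ → same w)) ⟩
            ∑ Ω (λ _ → 1)  ≡⟨ ∑-const Ω 1 ⟩
            length Ω * 1  ≡⟨ *-identityʳ _ ⟩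
            length Ω  ∎
            where
            open ≤-Reasoning
            same : ∀ w {r r′} → First r w → First r′ w → r ≡ r′
            same w {r} {r′} (¬p , small) (¬p′ , small′) with <-cmp r r′
            ... | tri< lt _ _ = contradiction (All.lookup small′ (∈-downFrom⁺ lt)) ¬p
            ... | tri≈ _ eq _ = eq
            ... | tri> _ _ gt = contradiction (All.lookup small (∈-downFrom⁺ gt)) ¬p′
            one : ∀ r → r < T → ∑ Ω (good r) * suc R ≤ ∑ Ω (λ w → 𝟙 (First? r w))
            one r r<T with r <? T
            ... | no n = contradiction r<T n
            ... | yes p = P.pair-spread p (First? r) k R _ invariant
              where
              invariant : ∀ {w} x y → w ∈ Ω → x + y ≡ d (s r) w + d (s′ r) w → First r w → First r (set₂ (s r) (s′ r) x y w)
              invariant {w} x y w∈ eq (¬p , small) =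
                (λ lt → ¬p (subst (_< R) (trans (cong₂ _+_ (d-set₂ˡ (s≢s′ p p w∈) x y w (col∈ w∈ (col-∈ (left-u p))))
                  (d-set₂ʳ (s≢s′ p p w∈) x y w (col∈ w∈ (col-∈ (right-u p))))) eq) lt))
                , All.tabulate λ {r′} m → subst (_< R) (sym (other r′ (∈-downFrom⁻ m))) (All.lookup small m)
                where
                other : ∀ r′ → r′ < r → d (s r′) (set₂ (s r) (s′ r) x y w) + d (s′ r′) (set₂ (s r) (s′ r) x y w) ≡ d (s r′) w + d (s′ r′) w
                other r′ r′<r = cong₂ _+_
                  (d-set₂-≢ x y w (λ e → <⇒≢ r′<r (sym (s-injective p p′ w∈ e))) (λ e → s≢s′ p′ p w∈ (sym e)))
                  (d-set₂-≢ x y w (s≢s′ p p′ w∈) (λ e → <⇒≢ r′<r (sym (s′-injective p p′ w∈ e))))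
                  where
                  p′ = <-trans r′<r p

          module _ (J m c : ℕ) (room : J + (m + R) ≤ N) (m>0 : 0 < m) (c>0 : 0 < c)
            (crowd : N + length cols ≤ c * m) where

            Φ? : ∀ w → Dec (X q w ≡ k × X e w ≤ J × AllSmall w)
            Φ? w = (X q w ℕP.≟ k) ×-dec (X e w ≤? J) ×-dec All.all? (λ r → d (s r) w + d (s′ r) w <? R) (downFrom T)

            -- The state while letters from beyond `e` are fed into the right column `j`. Each
            -- letter raises `r` and `X e` by one, so the inequality persists, and for `r` up to `R`
            -- it guarantees at least `m` letters beyond `e`. At `r = R` the column `j` is the only
            -- right column with `R` letters, so the word reveals `j`.
            Big : ℕ → ℕ → Word → Set
            Big j r w = X q w ≡ k × X e w + (m + R) ≤ N + r × d (s′ j) w ≡ r × All (λ j′ → j′ ≡ j ⊎ d (s′ j′) w < R) (downFrom T)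

            Big? : ∀ j r w → Dec (Big j r w)
            Big? j r w = (X q w ℕP.≟ k) ×-dec (X e w + (m + R) ≤? N + r) ×-dec (d (s′ j) w ℕP.≟ r)
              ×-dec All.all? (λ j′ → (j′ ℕP.≟ j) ⊎-dec (d (s′ j′) w <? R)) (downFrom T)

            big : ℕ → ℕ → ℕ
            big j r = ∑ Ω (λ w → 𝟙 (Big? j r w))

            -- At least `m` letters beyond `e` can be fed, while by `crowd` a resulting word has
            -- multiplicity at most `c * m`; hence the factor `c`. The fed column lies after `q`, so
            -- `X q` keeps its value `k`.
            big-step : ∀ {j} r → j < T → r < R → big j r ≤ c * big j (suc r)
            big-step {j} r j<T r<R = *-cancelˡ-≤ m {{>-nonZero m>0}} (begin
              m * big j r  ≡⟨ *-comm m _ ⟩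
              big j r * m  ≡⟨ ∑-* Ω _ m ⟨
              ∑ Ω (λ w → 𝟙 (Big? j r w) * m)  ≤⟨ ∑-mono Ω (λ {w} w∈ → 𝟙-bound (Big? j r w) (many w∈)) ⟩
              ∑ Ω (λ w → 𝟙 (Big? j r w) * S e w)  ≤⟨ single-move (Big? j r) (Big? j (suc r)) (col-∈ (right-u j<T))
                                                                            (λ w∈ _ → s′-e j<T w∈) (λ _ _ q∈ _ → free q∈) step ⟩
              ∑ Ω (λ w → 𝟙 (Big? j (suc r) w) * (S e w + A e w))  ≤⟨ ∑-mono Ω (λ {w} w∈ → *-monoʳ-≤ (𝟙 (Big? j (suc r) w)) (few w∈)) ⟩
              ∑ Ω (λ w → 𝟙 (Big? j (suc r) w) * (c * m))  ≡⟨ ∑-* Ω _ (c * m) ⟩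
              big j (suc r) * (c * m)  ≡⟨ *-x∙yz≈z∙yx (big j (suc r)) c m ⟩
              m * (c * big j (suc r))  ∎)
              where
              open ≤-Reasoning
              many : ∀ {w} → w ∈ Ω → Big j r w → m ≤ S e w
              many {w} w∈ (_ , le , _ , _) = +-cancelˡ-≤ (X e w) _ _ (+-cancelʳ-≤ R _ _ (begin
                X e w + m + R  ≡⟨ +-assoc (X e w) m R ⟩
                X e w + (m + R)  ≤⟨ le ⟩
                N + r  ≤⟨ +-monoʳ-≤ N (<⇒≤ r<R) ⟩
                N + R  ≡⟨ cong (_+ R) (X+S e w∈) ⟨
                X e w + S e w + R  ∎))
              few : ∀ {w} → w ∈ Ω → S e w + A e w ≤ c * m
              few {w} w∈ = ≤-trans (+-mono-≤ (≤-trans (m≤n+m _ (X e w)) (≤-reflexive (X+S e w∈))) (A≤cols e w)) crowd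
              step : ∀ {w p′} → w ∈ Ω → Big j r w → p′ ∈ cols → le p′ e (keys w) ≡ false → 0 < d p′ w → Big j (suc r) (move (s′ j) p′ w)
              step {w} {p′} w∈ (Xq , Xe , dj , others) p′∈ l pos =
                  trans (X-set₂-before {e = e} _ _ w j-e l (s′-q j<T w∈)) Xq
                , ≤-trans (≤-reflexive (cong (_+ (m + R)) X′≡)) (≤-trans (s≤s Xe) (≤-reflexive (sym (+-suc N r))))
                , trans (d-set₂ˡ (le-sep-≢ {ks = keys w} j-e l) _ _ w (col∈ w∈ (col-∈ (right-u j<T)))) (cong suc dj)
                , All.tabulate (λ {j′} m → keep j′ (∈-downFrom⁻ m) (All.lookup others m))
                where
                j-e = s′-e j<T w∈
                v = move (s′ j) p′ w
                X′≡ : X e v ≡ suc (X e w)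
                X′≡ = +-cancelʳ-≡ (d (s′ j) w) _ _ (trans (X-set₂-between {e = e} _ _ w j-e l j-e l) (+-suc (X e w) _))
                keep : ∀ j′ → j′ < T → j′ ≡ j ⊎ d (s′ j′) w < R → j′ ≡ j ⊎ d (s′ j′) v < R
                keep j′ _ (inj₁ eq) = inj₁ eq
                keep j′ j′<T (inj₂ lt) with j′ ℕP.≟ j
                ... | yes eq = inj₁ eq
                ... | no j′≢j = inj₂ (subst (_< R) (sym (d-set₂-≢ _ _ w (λ e → j′≢j (sym (s′-injective j<T j′<T w∈ e)))
                        (λ e → le-sep-≢ {ks = keys w} (s′-e j′<T w∈) l (sym e)))) lt)

            big-grow : ∀ {j} → j < T → ∀ t r → r + t ≡ R → big j r ≤ c ^ t * big j R
            big-grow {j} j<T zero r eq = ≤-reflexive (trans (cong (big j) (trans (sym (+-identityʳ r)) eq)) (sym (*-identityˡ _)))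
            big-grow {j} j<T (suc t) r eq = begin
              big j r  ≤⟨ big-step r j<T (subst (r <_) eq (m<m+n r (s≤s z≤n))) ⟩
              c * big j (suc r)  ≤⟨ *-monoʳ-≤ c (big-grow j<T t (suc r) (trans (sym (+-suc r t)) eq)) ⟩
              c * (c ^ t * big j R)  ≡⟨ *-assoc c (c ^ t) _ ⟨
              c ^ suc t * big j R  ∎
              where open ≤-Reasoning

            -- Letters from beyond e can be fed into any one of the T right columns until it has R of them;
            -- the T outcomes are disjoint.
            Φ-total : T * ∑ Ω (λ w → 𝟙 (Φ? w)) ≤ R * (c ^ R * length Ω)
            Φ-total = begin
              T * ∑ Ω (λ w → 𝟙 (Φ? w))  ≡⟨ cong (_* ∑ Ω (λ w → 𝟙 (Φ? w))) (length-downFrom T) ⟨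
              length (downFrom T) * ∑ Ω (λ w → 𝟙 (Φ? w))  ≡⟨ ∑-const (downFrom T) _ ⟨
              ∑ (downFrom T) (λ j → ∑ Ω (λ w → 𝟙 (Φ? w)))  ≤⟨ ∑-mono (downFrom T) (λ m → spread (∈-downFrom⁻ m)) ⟩
              ∑ (downFrom T) (λ j → R * (c ^ R * big j R))  ≡⟨ ∑-cong (downFrom T) (λ {j} _ → *-x∙yz≈z∙xy R (c ^ R) (big j R)) ⟩
              ∑ (downFrom T) (λ j → big j R * (R * c ^ R))  ≡⟨ ∑-* (downFrom T) _ (R * c ^ R) ⟩
              ∑ (downFrom T) (λ j → big j R) * (R * c ^ R)  ≡⟨ cong (_* (R * c ^ R)) (∑-swap (downFrom T) Ω _) ⟩
              ∑ Ω (λ w → ∑ (downFrom T) (λ j → 𝟙 (Big? j R w))) * (R * c ^ R)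
                ≤⟨ *-monoˡ-≤ (R * c ^ R) (∑-mono Ω (λ {w} _ → ∑-exclusive (downFrom T) (λ j → Big? j R w) (downFrom⁺ T) (exclusive w))) ⟩
              ∑ Ω (λ _ → 1) * (R * c ^ R)  ≡⟨ cong (_* (R * c ^ R)) (trans (∑-const Ω 1) (*-identityʳ (length Ω))) ⟩
              length Ω * (R * c ^ R)  ≡⟨ *-x∙yz≈z∙xy R (c ^ R) (length Ω) ⟨
              R * (c ^ R * length Ω)  ∎
              where
              open ≤-Reasoning
              exclusive : ∀ w {j j′} → j ∈ downFrom T → j′ ∈ downFrom T → Big j R w → Big j′ R w → j ≡ j′
              exclusive w j∈ j′∈ (_ , _ , dj , _) (_ , _ , _ , others) with All.lookup others j∈
              ... | inj₁ eq = eq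
              ... | inj₂ lt = contradiction dj (<⇒≢ lt)
              spread : ∀ {j} → j < T → ∑ Ω (λ w → 𝟙 (Φ? w)) ≤ R * (c ^ R * big j R)
              spread {j} j<T = begin
                ∑ Ω (λ w → 𝟙 (Φ? w))  ≤⟨ ∑-mono Ω (λ {w} w∈ → classify w) ⟩
                ∑ Ω (λ w → ∑ (downFrom R) (λ r → 𝟙 (Big? j r w)))  ≡⟨ ∑-swap Ω (downFrom R) _ ⟩
                ∑ (downFrom R) (λ r → big j r)  ≤⟨ ∑-mono (downFrom R) (λ m → top (∈-downFrom⁻ m)) ⟩
                ∑ (downFrom R) (λ _ → c ^ R * big j R)  ≡⟨ ∑-const (downFrom R) _ ⟩
                length (downFrom R) * (c ^ R * big j R)  ≡⟨ cong (_* (c ^ R * big j R)) (length-downFrom R) ⟩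
                R * (c ^ R * big j R)  ∎
                where
                top : ∀ {r} → r < R → big j r ≤ c ^ R * big j R
                top {r} r<R = ≤-trans (big-grow j<T (R ∸ r) r (m+[n∸m]≡n (<⇒≤ r<R)))
                  (*-monoˡ-≤ (big j R) (^-monoʳ-≤ c {{>-nonZero c>0}} (m∸n≤m R r)))
                classify : ∀ w → 𝟙 (Φ? w) ≤ ∑ (downFrom R) (λ r → 𝟙 (Big? j r w))
                classify w with Φ? w
                ... | no _ = z≤n
                ... | yes (Xq , Xe , small) = ≤-trans (≤-reflexive (sym (𝟙-yes (Big? j (d (s′ j) w) w) isBig)))
                        (∑-member (λ r → 𝟙 (Big? j r w)) (∈-downFrom⁺ (right< (∈-downFrom⁺ j<T))))
                  where
                  right< : ∀ {j′} → j′ ∈ downFrom T → d (s′ j′) w < R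
                  right< m = ≤-<-trans (m≤n+m _ _) (All.lookup small m)
                  isBig : Big j (d (s′ j) w) w
                  isBig = Xq , ≤-trans (≤-trans (+-monoˡ-≤ (m + R) Xe) room) (m≤m+n N _) , refl , All.tabulate (λ m → inj₂ (right< m))

            -- A word with `X q w ≡ k` either has more than `J` letters before the last column, or
            -- has only small pairs and then satisfies `Φ?`, or has a first pair that is not small,
            -- which is bad or good.
            window-atom : atom q k ≤ ∑ Ω (λ w → 𝟙 (suc J ≤? X (col u) w)) + ∑ Ω (λ w → ∑ (downFrom T) (λ r → bad r w))
              + ∑ Ω (λ w → ∑ (downFrom T) (λ r → good r w)) + ∑ Ω (λ w → 𝟙 (Φ? w))
            window-atom = ≤-trans (∑-mono Ω classify) (≤-reflexive
              (trans (∑-+ Ω _ _) (cong (_+ ∑ Ω (λ w → 𝟙 (Φ? w))) (trans (∑-+ Ω _ _)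
                (cong (_+ ∑ Ω (λ w → ∑ (downFrom T) (λ r → good r w))) (∑-+ Ω _ _))))))
              where
              classify : ∀ {w} → w ∈ Ω → 𝟙 (X q w ℕP.≟ k) ≤ 𝟙 (suc J ≤? X (col u) w) + ∑ (downFrom T) (λ r → bad r w)
                + ∑ (downFrom T) (λ r → good r w) + 𝟙 (Φ? w)
              classify {w} w∈ = by (X q w ℕP.≟ k) (suc J ≤? X (col u) w) (first-or-small w T)
                where
                late = 𝟙 (suc J ≤? X (col u) w)
                bads = ∑ (downFrom T) (λ r → bad r w)
                goods = ∑ (downFrom T) (λ r → good r w)
                by : Dec (X q w ≡ k) → Dec (suc J ≤ X (col u) w) → AllSmall w ⊎ (∃[ r ] r < T × First r w) →
                  𝟙 (X q w ℕP.≟ k) ≤ late + bads + goods + 𝟙 (Φ? w)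
                by (no n) _ _ = ≤-trans (≤-reflexive (𝟙-no (X q w ℕP.≟ k) n)) z≤n
                by (yes Xq) (yes l) _ = ≤-trans (𝟙≤1 _) (≤-trans (≤-reflexive (sym (𝟙-yes (suc J ≤? X (col u) w) l)))
                  (≤-trans (m≤m+n late bads) (≤-trans (m≤m+n (late + bads) goods) (m≤m+n (late + bads + goods) _))))
                by (yes Xq) (no early) (inj₁ small) = ≤-trans (𝟙≤1 _) (≤-trans (≤-reflexive (sym (𝟙-yes (Φ? w)
                  (Xq , ≤-trans (X-mono w (col-≤ w∈ fits ≤-refl)) (≤-pred (≰⇒> early)) , small)))) (m≤n+m _ (late + bads + goods)))
                by (yes Xq) (no early) (inj₂ (r , r<T , first)) = ≤-trans (𝟙≤1 _) (≤-trans hit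
                  (≤-trans (+-monoˡ-≤ goods (m≤n+m bads late)) (m≤m+n (late + bads + goods) _)))
                  where
                  one : 1 ≤ bad r w + good r w
                  one with r <? T
                  ... | no n = contradiction r<T n
                  ... | yes p = pick (P.Bad? p w)
                    where
                    good? = First? r w ×-dec ¬? (P.Bad? p w) ×-dec (X q w ℕP.≟ k) ×-dec (R ≤? d (s r) w + d (s′ r) w)
                    pick : Dec (P.Bad p w) → 1 ≤ 𝟙 (P.Bad? p w) + 𝟙 good?
                    pick (yes b) = ≤-trans (≤-reflexive (sym (𝟙-yes (P.Bad? p w) b))) (m≤m+n _ _)
                    pick (no ¬b) = ≤-trans (≤-reflexive (sym (𝟙-yes good? (first , ¬b , Xq , ≮⇒≥ (proj₁ first))))) (m≤n+m _ (𝟙 (P.Bad? p w)))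
                  hit : 1 ≤ bads + goods
                  hit = ≤-trans one (+-mono-≤ (∑-member (λ r → bad r w) (∈-downFrom⁺ r<T)) (∑-member (λ r → good r w) (∈-downFrom⁺ r<T)))

-- Linear extensions as words

module _ {d : ℕ} where

  _≟ᴷ_ : (x y : Maybe (Pt d)) → Dec (x ≡ y)
  _≟ᴷ_ = Maybe.≡-dec _≟ᵖ_

  _∈ᵖ?_ : (x : Pt d) (xs : List (Pt d)) → Dec (x ∈ xs)
  _∈ᵖ?_ = Mem._∈?_ _≟ᵖ_

  open Words (_≟ᴷ_) public renaming (d to run)

  bump : Word → Word
  bump [] = []
  bump ((n , k) ∷ w) = (suc n , k) ∷ w

  -- The letters of the chain are the elements of cs, in increasing order in every linear extension;
  -- the word of an extension lists the remaining elements, each with the number of letters just before it,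
  -- and ends with the number of trailing letters, attached to nothing.
  encode : List (Pt d) → List (Pt d) → Word
  encode cs [] = [ 0 , nothing ]
  encode cs (p ∷ L) with p ∈ᵖ? cs
  ... | yes _ = bump (encode cs L)
  ... | no _ = (0 , just p) ∷ encode cs L

  interleave : List (Pt d) → Word → List (Pt d)
  interleave cs [] = []
  interleave cs ((zero , nothing) ∷ w) = []
  interleave cs ((zero , just q) ∷ w) = q ∷ interleave cs w
  interleave [] ((suc n , k) ∷ w) = []
  interleave (c ∷ cs) ((suc n , k) ∷ w) = c ∷ interleave cs ((n , k) ∷ w)

  columns : List (Pt d) → List (Maybe (Pt d))
  columns τ = map just τ ++ [ nothing ]

  inside outside : List (Pt d) → List (Pt d) → List (Pt d)
  inside cs = filter (_∈ᵖ? cs)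
  outside cs = filter (λ x → ¬? (x ∈ᵖ? cs))

  encode-∷ : ∀ cs L → ∃[ n ] ∃[ k ] ∃[ w ] encode cs L ≡ (n , k) ∷ w
  encode-∷ cs [] = 0 , nothing , [] , refl
  encode-∷ cs (p ∷ L) with p ∈ᵖ? cs
  ... | no _ = 0 , just p , encode cs L , refl
  ... | yes _ with encode-∷ cs L
  ...   | n , k , w , eq = suc n , k , w , cong bump eq

  interleave-encode : ∀ cs L → interleave (inside cs L) (encode cs L) ≡ L
  interleave-encode cs [] = refl
  interleave-encode cs (p ∷ L) with p ∈ᵖ? cs
  ... | no _ = cong (p ∷_) (interleave-encode cs L)
  ... | yes _ = trans (step (encode-∷ cs L)) (cong (p ∷_) (interleave-encode cs L))
    where
    step : (∃[ n ] ∃[ k ] ∃[ w ] encode cs L ≡ (n , k) ∷ w) →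
      interleave (p ∷ inside cs L) (bump (encode cs L)) ≡ p ∷ interleave (inside cs L) (encode cs L)
    step (n , k , w , eq) rewrite eq = refl

  keys-bump : ∀ w → keys (bump w) ≡ keys w
  keys-bump [] = refl
  keys-bump (_ ∷ _) = refl

  keys-encode : ∀ cs L → keys (encode cs L) ≡ columns (outside cs L)
  keys-encode cs [] = refl
  keys-encode cs (p ∷ L) with p ∈ᵖ? cs
  ... | no _ = cong (just p ∷_) (keys-encode cs L)
  ... | yes _ = trans (keys-bump (encode cs L)) (keys-encode cs L)

  total-encode : ∀ cs L → total (encode cs L) ≡ length (inside cs L)
  total-encode cs [] = refl
  total-encode cs (p ∷ L) with p ∈ᵖ? cs
  ... | no _ = total-encode cs L
  ... | yes _ with encode-∷ cs L
  ...   | n , k , w , eq = trans (cong total (cong bump eq)) (cong suc (trans (sym (cong total eq)) (total-encode cs L)))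

  encode-interleave : ∀ {C} cs w {τ} → keys w ≡ columns τ → total w ≡ length cs →
    (∀ {c} → c ∈ cs → c ∈ C) → (∀ {q} → q ∈ τ → q ∉ C) → encode C (interleave cs w) ≡ w
  encode-interleave cs [] {[]} ()
  encode-interleave cs [] {_ ∷ _} ()
  encode-interleave [] ((zero , nothing) ∷ []) {[]} _ _ _ _ = refl
  encode-interleave (_ ∷ _) ((zero , nothing) ∷ []) {[]} _ () _ _
  encode-interleave cs ((zero , nothing) ∷ _ ∷ _) {[]} () _ _ _
  encode-interleave cs ((zero , nothing) ∷ _) {_ ∷ _} () _ _ _
  encode-interleave cs ((zero , just q) ∷ w) {[]} () _ _ _
  encode-interleave {C} cs ((zero , just q) ∷ w) {t ∷ τ} ke te sub out with ListP.∷-injective ke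
  ... | refl , ke′ with q ∈ᵖ? C
  ...   | yes m = contradiction m (out (here refl))
  ...   | no _ = cong (_ ∷_) (encode-interleave cs w ke′ te sub (λ m → out (there m)))
  encode-interleave {C} (c ∷ cs) ((suc n , k) ∷ w) ke te sub out with c ∈ᵖ? C
  ... | no n∉ = contradiction (sub (here refl)) n∉
  ... | yes _ = cong bump (encode-interleave cs ((n , k) ∷ w) ke (suc-injective te) (λ m → sub (there m)) out)

  interleave-↭ : ∀ cs w {τ} → keys w ≡ columns τ → total w ≡ length cs → interleave cs w ↭ cs ++ τ
  interleave-↭ cs [] {[]} ()
  interleave-↭ cs [] {_ ∷ _} ()
  interleave-↭ [] ((zero , nothing) ∷ []) {[]} _ _ = ↭-refl
  interleave-↭ (_ ∷ _) ((zero , nothing) ∷ []) {[]} _ ()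
  interleave-↭ cs ((zero , nothing) ∷ _ ∷ _) {[]} () _
  interleave-↭ cs ((zero , nothing) ∷ _) {_ ∷ _} () _
  interleave-↭ cs ((zero , just q) ∷ w) {[]} () _
  interleave-↭ cs ((zero , just q) ∷ w) {t ∷ τ} ke te with ListP.∷-injective ke
  ... | refl , ke′ = ↭-trans (prep q (interleave-↭ cs w ke′ te)) (↭-sym (shift q cs τ))
  interleave-↭ (c ∷ cs) ((suc n , k) ∷ w) ke te = prep c (interleave-↭ cs ((n , k) ∷ w) ke (suc-injective te))

  X-suc : ∀ q n k w → X q ((suc n , k) ∷ w) ≡ suc (X q ((n , k) ∷ w))
  X-suc q n k w with k ≟ᴷ q
  ... | yes _ = refl
  ... | no _ = refl

  -- The letters occur in a fixed order, so the relations between `q` and the chain constrain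
  -- nothing but the number `x` of letters before `q`.
  Fits : List (Pt d) → Pt d → ℕ → Set
  Fits cs q x = All (λ c → ¬ (c <ᵖ q)) (drop x cs) × All (λ c → ¬ (q <ᵖ c)) (take x cs)

  interleave-respects : ∀ cs w {τ} → keys w ≡ columns τ → total w ≡ length cs →
    AllPairs _<ᵖ_ cs → Unique τ → Respects τ → (∀ {q} → q ∈ τ → Fits cs q (X (just q) w)) →
    Respects (interleave cs w)
  interleave-respects cs [] {[]} ()
  interleave-respects cs [] {_ ∷ _} ()
  interleave-respects cs ((zero , nothing) ∷ w) _ _ _ _ _ _ = []
  interleave-respects cs ((zero , just q) ∷ w) {[]} () _ _ _ _ _
  interleave-respects cs ((zero , just q) ∷ w) {t ∷ τ} ke te srt (q∉ ∷ u) (r ∷ rs) fits with ListP.∷-injective ke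
  ... | refl , ke′ = Perm.All-resp-↭ (↭-sym (interleave-↭ cs w ke′ te)) (AllP.++⁺ above r)
      ∷ interleave-respects cs w ke′ te srt u rs λ {q′} m →
          subst (Fits cs q′) (X-∷-≢ w (λ e → All.lookup q∉ m (Maybe.just-injective e))) (fits (there m))
    where
    above : All (λ c → ¬ (c <ᵖ q)) cs
    above = subst (λ x → All (λ c → ¬ (c <ᵖ q)) (drop x cs)) (X-∷ {0} {just q} w) (proj₁ (fits (here refl)))
  interleave-respects (c ∷ cs) ((suc n , k) ∷ w) {τ} ke te (c< ∷ srt) u rs fits =
    Perm.All-resp-↭ (↭-sym (interleave-↭ cs ((n , k) ∷ w) ke (suc-injective te)))
      (AllP.++⁺ (All.map <ᵖ-asym c<) (All.tabulate (λ m → All.head (proj₂ (fits′ m)))))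
    ∷ interleave-respects cs ((n , k) ∷ w) ke (suc-injective te) srt u rs
        (λ m → proj₁ (fits′ m) , All.tail (proj₂ (fits′ m)))
    where
    fits′ : ∀ {q} → q ∈ τ → Fits (c ∷ cs) q (suc (X (just q) ((n , k) ∷ w)))
    fits′ {q} m = subst (Fits (c ∷ cs) q) (X-suc (just q) n k w) (fits m)

  before-interleave : ∀ as c bs w {τ p} → keys w ≡ columns τ → total w ≡ length (as ++ c ∷ bs) →
    p ∈ τ → c ∉ as → c ∉ τ → p ∉ as ++ c ∷ bs →
    beforeᵇ c p (interleave (as ++ c ∷ bs) w) ≡ (length as <ᵇ X (just p) w)
  before-interleave as c bs [] {[]} ()
  before-interleave as c bs [] {_ ∷ _} ()
  before-interleave as c bs ((zero , nothing) ∷ w) {[]} _ _ () _ _ _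
  before-interleave as c bs ((zero , nothing) ∷ w) {_ ∷ _} () _ _ _ _ _
  before-interleave as c bs ((zero , just q) ∷ w) {[]} () _ _ _ _ _
  before-interleave as c bs ((zero , just q) ∷ w) {t ∷ τ} {p} ke te p∈ c∉as c∉τ p∉ with ListP.∷-injective ke
  ... | refl , ke′ rewrite eqᵇ-≢ {x = q} {c} (λ e → c∉τ (here (sym e))) = by (q ≟ᵖ p) p∈
    where
    by : Dec (q ≡ p) → p ∈ q ∷ τ →
      (if eqᵇ q p then false else beforeᵇ c p (interleave (as ++ c ∷ bs) w)) ≡ (length as <ᵇ X (just p) ((zero , just q) ∷ w))
    by (yes refl) _ rewrite eqᵇ-refl q | X-∷ {0} {just q} w = refl
    by (no n) (here e) = contradiction (sym e) n
    by (no n) (there m) rewrite eqᵇ-≢ n | X-∷-≢ {0} {just q} {just p} w (λ e → n (Maybe.just-injective e)) =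
      before-interleave as c bs w ke′ te m c∉as (λ m → c∉τ (there m)) p∉
  before-interleave [] c bs ((suc n , k) ∷ w) {τ} {p} ke te p∈ c∉as c∉τ p∉
    rewrite eqᵇ-refl c | X-suc (just p) n k w =
    memᵇ-∈ (∈-resp-↭ (↭-sym (interleave-↭ bs ((n , k) ∷ w) ke (suc-injective te))) (∈-++⁺ʳ bs p∈))
  before-interleave (a ∷ as) c bs ((suc n , k) ∷ w) {τ} {p} ke te p∈ c∉as c∉τ p∉
    rewrite eqᵇ-≢ {x = a} {c} (λ e → c∉as (here (sym e))) | eqᵇ-≢ {x = a} {p} (λ e → p∉ (here (sym e)))
          | X-suc (just p) n k w =
    before-interleave as c bs ((n , k) ∷ w) ke (suc-injective te) p∈ (λ m → c∉as (there m)) c∉τ (λ m → p∉ (there m))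

  encode-fits : ∀ C L → Respects L → ∀ {q} → q ∈ L → q ∉ C → Fits (inside C L) q (X (just q) (encode C L))
  encode-fits C (p ∷ L) (r ∷ rs) {q} m q∉ with p ∈ᵖ? C
  encode-fits C (p ∷ L) (r ∷ rs) {q} (here refl) q∉ | yes p∈ = contradiction p∈ q∉
  encode-fits C (p ∷ L) (r ∷ rs) {q} (there m) q∉ | yes p∈ with encode-∷ C L
  ... | n , k , w , eq = subst (Fits (p ∷ inside C L) q) (sym X≡) (proj₁ ih , All.lookup r m ∷ proj₂ ih)
    where
    ih = encode-fits C L rs m q∉
    X≡ : X (just q) (bump (encode C L)) ≡ suc (X (just q) (encode C L))
    X≡ rewrite eq = X-suc (just q) n k w
  encode-fits C (p ∷ L) (r ∷ rs) {q} m q∉ | no p∉ = by (p ≟ᵖ q) m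
    where
    by : Dec (p ≡ q) → q ∈ p ∷ L → Fits (inside C L) q (X (just q) ((0 , just p) ∷ encode C L))
    by (yes refl) _ rewrite X-∷ {0} {just p} (encode C L) =
      All.tabulate (λ m → All.lookup r (proj₁ (∈-filter⁻ (_∈ᵖ? C) m))) , []
    by (no n) (here e) = contradiction (sym e) n
    by (no n) (there m) rewrite X-∷-≢ {0} {just p} {just q} (encode C L) (λ e → n (Maybe.just-injective e)) =
      encode-fits C L rs m q∉

  sorted-≡ : ∀ {xs ys : List (Pt d)} → AllPairs _<ᵖ_ xs → Respects ys → xs ↭ ys → xs ≡ ys
  sorted-≡ {[]} {[]} _ _ _ = refl
  sorted-≡ {[]} {y ∷ ys} _ _ p with () ← ∈-resp-↭ (↭-sym p) (here refl)
  sorted-≡ {x ∷ xs} {[]} _ _ p with () ← ∈-resp-↭ p (here refl)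
  sorted-≡ {x ∷ xs} {y ∷ ys} (x< ∷ s) (r ∷ rs) p with x ≟ᵖ y
  ... | yes refl = cong (x ∷_) (sorted-≡ s rs (Perm.drop-∷ p))
  ... | no x≢y = contradiction (All.lookup x< y∈) (All.lookup r x∈)
    where
    x∈ : x ∈ ys
    x∈ with ∈-resp-↭ p (here refl)
    ... | here e = contradiction e x≢y
    ... | there m = m
    y∈ : y ∈ xs
    y∈ with ∈-resp-↭ (↭-sym p) (here refl)
    ... | here e = contradiction (sym e) x≢y
    ... | there m = m

  Uncapped : List (Pt d) → Maybe (Pt d) → Set
  Uncapped cs nothing = ⊤
  Uncapped cs (just q) = ∀ {c} → c ∈ cs → ¬ (q <ᵖ c)

  -- The model of a poset with a distinguished chain

  module Chain {P cs rs : List (Pt d)} (uP : Unique P) (P↭ : P ↭ cs ++ rs) (srt : AllPairs _<ᵖ_ cs) where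

    uu : Unique (cs ++ rs)
    uu = Unique-resp-↭ P↭ uP

    disjoint : ∀ {x} → x ∈ cs → x ∉ rs
    disjoint = go cs uu
      where
      go : ∀ cs → Unique (cs ++ rs) → ∀ {x} → x ∈ cs → x ∉ rs
      go (c ∷ cs) (n ∷ u) (here refl) m = All.lookup n (∈-++⁺ʳ cs m) refl
      go (c ∷ cs) (n ∷ u) (there m′) m = go cs u m′ m

    unique-cs : Unique cs
    unique-cs = AllPairs.map proj₂ srt

    unique-rs : Unique rs
    unique-rs = go cs uu
      where
      go : ∀ cs → Unique (cs ++ rs) → Unique rs
      go [] u = u
      go (_ ∷ cs) (_ ∷ u) = go cs u

    -- Describes the words of linear extensions without naming an extension. Counts of letters enter
    -- only through `total` and `Fits`, which is what makes `raise` easy to verify.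
    record Valid (w : Word) : Set where
      constructor valid
      field
        τ : List (Pt d)
        keys-τ : keys w ≡ columns τ
        τ↭ : τ ↭ rs
        τ-respects : Respects τ
        total≡ : total w ≡ length cs
        fits : ∀ {q} → q ∈ τ → Fits cs q (X (just q) w)

    inside-cs : ∀ {L} → L ∈ linExts P → inside cs L ≡ cs
    inside-cs {L} m with linExts⇒ {P = P} m
    ... | p , r = sym (sorted-≡ srt (AllPairsP.filter⁺ (_∈ᵖ? cs) r)
        (unique-set⇒↭ unique-cs (UniqueP.filter⁺ (_∈ᵖ? cs) (Unique-resp-↭ (↭-sym p) uP))
          (λ c∈ → ∈-filter⁺ (_∈ᵖ? cs) (∈-resp-↭ (↭-sym p) (∈-resp-↭ (↭-sym P↭) (∈-++⁺ˡ c∈))) c∈)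
          (λ m → proj₂ (∈-filter⁻ (_∈ᵖ? cs) {xs = L} m))))

    outside-↭ : ∀ {L} → L ∈ linExts P → outside cs L ↭ rs
    outside-↭ {L} m with linExts⇒ {P = P} m
    ... | p , r = unique-set⇒↭ (UniqueP.filter⁺ _ (Unique-resp-↭ (↭-sym p) uP)) unique-rs to from
      where
      out? = λ x → ¬? (x ∈ᵖ? cs)
      to : ∀ {x} → x ∈ outside cs L → x ∈ rs
      to m with ∈-filter⁻ out? {xs = L} m
      ... | m′ , n with ∈-++⁻ cs (∈-resp-↭ P↭ (∈-resp-↭ p m′))
      ...   | inj₁ c = contradiction c n
      ...   | inj₂ c = c
      from : ∀ {x} → x ∈ rs → x ∈ outside cs L
      from x∈ = ∈-filter⁺ out? (∈-resp-↭ (↭-sym p) (∈-resp-↭ (↭-sym P↭) (∈-++⁺ʳ cs x∈))) (λ c∈ → disjoint c∈ x∈)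

    encode-valid : ∀ {L} → L ∈ linExts P → Valid (encode cs L)
    encode-valid {L} m with linExts⇒ {P = P} m
    ... | p , r = valid (outside cs L) (keys-encode cs L) (outside-↭ m) (AllPairsP.filter⁺ _ r)
      (trans (total-encode cs L) (cong length (inside-cs m)))
      (λ {q} q∈ → subst (λ xs → Fits xs q (X (just q) (encode cs L))) (inside-cs m)
        (encode-fits cs L r (proj₁ (∈-filter⁻ out? {xs = L} q∈)) (proj₂ (∈-filter⁻ out? {xs = L} q∈))))
      where
      out? = λ x → ¬? (x ∈ᵖ? cs)

    recover : ∀ {L} → L ∈ linExts P → interleave cs (encode cs L) ≡ L
    recover {L} m = trans (cong (λ xs → interleave xs (encode cs L)) (sym (inside-cs m))) (interleave-encode cs L)

    words : List Word
    words = map (encode cs) (linExts P)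

    valid⇒∈ : ∀ {w} → Valid w → w ∈ words
    valid⇒∈ {w} (valid τ ke τ↭ r te fits) = subst (_∈ words)
      (encode-interleave cs w ke te (λ m → m) (λ q∈ c∈ → disjoint c∈ (∈-resp-↭ τ↭ q∈)))
      (∈-map⁺ (encode cs) (linExts⇐ (↭-trans (interleave-↭ cs w ke te) (↭-trans (Perm.++⁺ˡ cs τ↭) (↭-sym P↭)))
        (interleave-respects cs w ke te srt (Unique-resp-↭ (↭-sym τ↭) unique-rs) r fits)))

    ∈⇒valid : ∀ {w} → w ∈ words → Valid w
    ∈⇒valid m with ∈-map⁻ (encode cs) m
    ... | L , L∈ , refl = encode-valid L∈

    model : Model
    model = record
      { Ω = words
      ; unique = Unique-map (encode cs) (λ m m′ e → trans (sym (recover m)) (trans (cong (interleave cs) e) (recover m′)))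
          (linExts-unique uP)
      ; cols = columns rs
      ; cols-unique = UniqueP.++⁺ (UniqueP.map⁺ Maybe.just-injective unique-rs) ([] ∷ [])
          (λ { (m , here refl) → nothing∉ m })
      ; keys-↭ = λ m → let open Valid (∈⇒valid m) in
          ↭-trans (↭-reflexive keys-τ) (Perm.++⁺ʳ [ nothing ] (Perm.map⁺ just τ↭))
      ; N = length cs
      ; total-N = λ m → Valid.total≡ (∈⇒valid m)
      ; Free = Uncapped cs
      ; raise = λ m ke te ge → let open Valid (∈⇒valid m) in
          valid⇒∈ (valid τ (trans ke keys-τ) τ↭ τ-respects (trans te total≡)
            (λ {q} q∈ → raised q (fits q∈) (ge (∈-++⁺ˡ (∈-map⁺ just (∈-resp-↭ τ↭ q∈))))))
      }
      where
      nothing∉ : ∀ {xs : List (Pt d)} → nothing ∉ map just xs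
      nothing∉ m with ∈-map⁻ just m
      ... | _ , _ , ()
      -- With more letters before `q`, fewer remain that must not lie below it, so the first half of
      -- `Fits` persists. The second half then concerns more letters, and freeness supplies it.
      raised : ∀ q {x x′} → Fits cs q x → x ≤ x′ × (x′ ≡ x ⊎ Uncapped cs (just q)) → Fits cs q x′
      raised q f (_ , inj₁ refl) = f
      raised q {x} {x′} (f , _) (x≤ , inj₂ free) =
        subst (All _) (trans (ListP.drop-drop x (x′ ∸ x) cs) (cong (λ z → drop z cs) (m+[n∸m]≡n x≤))) (AllP.drop⁺ (x′ ∸ x) f)
        , AllP.take⁺ x′ (All.tabulate free)

    le-order : ∀ {w p q} → w ∈ words → p ∈ rs → q ∈ rs → p <ᵖ q →
      le (just p) (just q) (keys w) ≡ true × le (just q) (just p) (keys w) ≡ false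
    le-order {w} {p} {q} m p∈ q∈ lt = first , Bool.¬-not λ second →
        proj₂ lt (Maybe.just-injective (le-antisym (keys w) first second))
      where
      open Valid (∈⇒valid m)
      go : ∀ τ → Respects τ → p ∈ τ → le (just p) (just q) (columns τ) ≡ true
      go (t ∷ τ) (r ∷ rs) m = by (t ≟ᵖ p) (t ≟ᵖ q) m
        where
        by : Dec (t ≡ p) → Dec (t ≡ q) → p ∈ t ∷ τ → le (just p) (just q) (columns (t ∷ τ)) ≡ true
        by (yes refl) _ _ = le-here {just t} {just q} {columns τ}
        by (no n) _ (here e) = contradiction (sym e) n
        by (no n) (yes refl) (there m) = contradiction lt (All.lookup r m)
        by (no n) (no n′) (there m) = trans (le-∷ {just t} {just p} {just q} {columns τ}
          (λ e → n (Maybe.just-injective e)) (λ e → n′ (Maybe.just-injective e))) (go τ rs m)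
      first : le (just p) (just q) (keys w) ≡ true
      first = trans (cong (le (just p) (just q)) keys-τ) (go τ τ-respects (∈-resp-↭ (↭-sym τ↭) p∈))

    before-X : ∀ as c bs {p L} → cs ≡ as ++ c ∷ bs → p ∈ rs → L ∈ linExts P →
      beforeᵇ c p L ≡ (length as <ᵇ X (just p) (encode cs L))
    before-X as c bs {p} {L} refl p∈ m = trans (cong (beforeᵇ c p) (sym (recover m)))
      (before-interleave as c bs (encode cs L) keys-τ total≡ (∈-resp-↭ (↭-sym τ↭) p∈)
        c∉as (λ c∈τ → disjoint (∈-++⁺ʳ as (here refl)) (∈-resp-↭ τ↭ c∈τ)) (λ p∈cs → disjoint p∈cs p∈))
      where
      open Valid (encode-valid m)
      c∉as : c ∉ as
      c∉as = go as unique-cs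
        where
        go : ∀ as → Unique (as ++ c ∷ bs) → c ∉ as
        go (a ∷ as) (n ∷ u) (here refl) = All.lookup n (∈-++⁺ʳ as (here refl)) refl
        go (a ∷ as) (n ∷ u) (there m) = go as u m

AllPairs-++ : {A : Set} {R : A → A → Set} (xs : List A) {ys : List A} → AllPairs R (xs ++ ys) →
  ∀ {x y} → x ∈ xs → y ∈ ys → R x y
AllPairs-++ (x ∷ xs) (r ∷ rs) (here refl) m = All.lookup r (∈-++⁺ʳ xs m)
AllPairs-++ (x ∷ xs) (r ∷ rs) (there m′) m = AllPairs-++ xs rs m′ m

-- The last field allows the elements of bs to be moved forward past all of as but its first cut elements.
record Decomposition {d : ℕ} (P : List (Pt d)) : Set where
  field
    as bs rs : List (Pt d)
    cut : ℕ
    P-unique : Unique P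
    P↭ : P ↭ as ++ bs ++ rs
    as-sorted : AllPairs _<ᵖ_ as
    bs-sorted : AllPairs _<ᵖ_ bs
    not-below-as : ∀ {q a} → q ∈ bs ++ rs → a ∈ as → ¬ (q <ᵖ a)
    not-below-bs : ∀ {q b} → q ∈ rs → b ∈ bs → ¬ (q <ᵖ b)
    not-above-cut : ∀ {a b} → a ∈ drop cut as → b ∈ bs → ¬ (a <ᵖ b)

countBefore : ∀ {d} → List (Pt d) → Pt d → Pt d → ℕ
countBefore P x y = ∑ (linExts P) (λ L → 𝟙 (beforeᵇ x y L Bool.≟ true))

-- The roles exchanged: `bs` as the chain of letters

module _ {d : ℕ} {P : List (Pt d)} (D : Decomposition P) where
  open Decomposition D

  P↭′ : P ↭ bs ++ as ++ rs
  P↭′ = ↭-trans P↭ (↭-trans (↭-reflexive (sym (ListP.++-assoc as bs rs)))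
    (↭-trans (Perm.++⁺ʳ rs (Perm.++-comm as bs)) (↭-reflexive (ListP.++-assoc bs as rs))))

  module _ (as₁ : List (Pt d)) (e : Pt d) (as₂ : List (Pt d)) (as≡ : as ≡ as₁ ++ e ∷ as₂) where
    private
      module C = Chain {P = P} {cs = bs} {rs = as ++ rs} P-unique P↭′ bs-sorted
      M = C.model
      open Model M
      open Moves M

      head : List (Pt d)
      head = as₁ ++ [ e ]

      as≡head : as ≡ head ++ as₂
      as≡head = trans as≡ (sym (ListP.++-assoc as₁ [ e ] as₂))

      head∈ : ∀ {a} → a ∈ head → a ∈ as
      head∈ m = subst (_ ∈_) (sym as≡head) (∈-++⁺ˡ m)

      e∈ : e ∈ as
      e∈ = head∈ (∈-++⁺ʳ as₁ (here refl))

      col-∈ : ∀ {a} → a ∈ as → just a ∈ cols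
      col-∈ m = ∈-++⁺ˡ (∈-map⁺ just (∈-++⁺ˡ m))

      le-e : ∀ {w a} → w ∈ Ω → a ∈ head → le (just a) (just e) (keys w) ≡ true
      le-e {w} {a} w∈ m with ∈-++⁻ as₁ m
      ... | inj₂ (here refl) = le-refl (col∈ w∈ (col-∈ e∈))
      ... | inj₁ m′ = proj₁ (C.le-order w∈ (∈-++⁺ˡ (head∈ m)) (∈-++⁺ˡ e∈)
              (AllPairs-++ as₁ (subst (AllPairs _<ᵖ_) as≡ as-sorted) m′ (here refl)))

      late-cols : ℕ
      late-cols = length (as₂ ++ rs) + 1

      A≤ : ∀ {w} → w ∈ Ω → A (just e) w ≤ late-cols
      A≤ {w} w∈ = begin
        ∑ (columns (as ++ rs)) f  ≡⟨ ∑-++ (map just (as ++ rs)) [ nothing ] f ⟩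
        ∑ (map just (as ++ rs)) f + (f nothing + 0)  ≡⟨ cong (_+ (f nothing + 0)) (∑-map just (as ++ rs) f) ⟩
        ∑ (as ++ rs) g + (f nothing + 0)  ≡⟨ cong (λ xs → ∑ xs g + (f nothing + 0)) split ⟩
        ∑ (head ++ as₂ ++ rs) g + (f nothing + 0)  ≡⟨ cong (_+ (f nothing + 0)) (∑-++ head (as₂ ++ rs) g) ⟩
        ∑ head g + ∑ (as₂ ++ rs) g + (f nothing + 0)  ≤⟨ +-mono-≤ (+-mono-≤ (≤-reflexive zeros) ones) (≤-trans (≤-reflexive (+-identityʳ _)) (𝟙≤1 _)) ⟩
        length (as₂ ++ rs) + 1 ∎
        where
        open ≤-Reasoning
        f = λ p → after p (just e) (keys w)
        g = λ a → f (just a)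
        split : as ++ rs ≡ head ++ as₂ ++ rs
        split = trans (cong (_++ rs) as≡head) (ListP.++-assoc head as₂ rs)
        zeros : ∑ head g ≡ 0
        zeros = trans (∑-cong head (λ m → 𝟙-no (_ Bool.≟ false) λ z → contradiction (trans (sym z) (le-e w∈ m)) λ ())) (∑-0 head)
        ones : ∑ (as₂ ++ rs) g ≤ length (as₂ ++ rs)
        ones = ≤-trans (∑-mono (as₂ ++ rs) (λ _ → 𝟙≤1 _)) (≤-reflexive (trans (∑-const (as₂ ++ rs) 1) (*-identityʳ _)))

      early : List (Pt d)
      early = drop cut head

      early-head : ∀ {a} → a ∈ early → a ∈ head
      early-head m = subst (_ ∈_) (ListP.take++drop≡id cut head) (∈-++⁺ʳ (take cut head) m)

      early-drop : ∀ {a} → a ∈ early → a ∈ drop cut as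
      early-drop {a} m rewrite as≡head = go cut head m
        where
        go : ∀ n xs → a ∈ drop n xs → a ∈ drop n (xs ++ as₂)
        go zero xs m = ∈-++⁺ˡ m
        go (suc n) (x ∷ xs) m = go n xs m

      as-cut : ∀ {a a′} → a ∈ drop cut as → a′ ∈ as → a′ ∈ drop cut as ⊎ a′ <ᵖ a
      as-cut {a} {a′} m m′ with ∈-++⁻ (take cut as) (subst (a′ ∈_) (sym (ListP.take++drop≡id cut as)) m′)
      ... | inj₁ t = inj₂ (AllPairs-++ (take cut as) (subst (AllPairs _<ᵖ_) (sym (ListP.take++drop≡id cut as)) as-sorted) t m)
      ... | inj₂ t = inj₁ t

      -- A column at or after `a` in the word is an element of `rs`, or of `as` from the cut on, or
      -- the end: an element of `as` before the cut is below `a` and so precedes it. None of these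
      -- is below an element of `bs`.
      free : ∀ {w a q} → w ∈ Ω → a ∈ early → q ∈ cols → le (just a) q (keys w) ≡ true → Free q
      free {q = nothing} _ _ _ _ = _
      free {w} {a} {q = just q} w∈ m q∈ l {b} b∈ q<b with ∈-++⁻ as (in-rest q∈)
        where
        in-rest : just q ∈ columns (as ++ rs) → q ∈ as ++ rs
        in-rest m with ∈-++⁻ (map just (as ++ rs)) m
        ... | inj₂ (here ())
        ... | inj₁ m′ with ∈-map⁻ just m′
        ...   | _ , m″ , refl = m″
      ... | inj₂ q∈rs = not-below-bs q∈rs b∈ q<b
      ... | inj₁ q∈as with as-cut (early-drop m) q∈as
      ...   | inj₁ t = not-above-cut t b∈ q<b
      ...   | inj₂ q<a = contradiction (trans (sym l)
                (proj₂ (C.le-order w∈ (∈-++⁺ˡ q∈as) (∈-++⁺ˡ (head∈ (early-head m))) q<a))) λ ()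

    -- Moving a later element of bs into one of the gaps just before the elements of early
    -- never violates an order relation, so it is unlikely that few elements of bs precede e.
    late-bound : ∀ bs₁ b bs₂ → bs ≡ bs₁ ++ b ∷ bs₂ →
      (suc (length as₁) ∸ cut) * ((length bs ∸ length bs₁) * countBefore P e b) ≤
        suc (length bs₁) * ((length bs + (length (as₂ ++ rs) + 1)) * length (linExts P))
    late-bound bs₁ b bs₂ bs≡ = begin
      (suc (length as₁) ∸ cut) * (β * countBefore P e b)
        ≡⟨ cong (_* (β * countBefore P e b)) (sym early-length) ⟩
      length early * (β * countBefore P e b)
        ≡⟨ cong (λ z → length early * (β * z)) counts ⟩
      length early * (β * ∑ Ω (λ w → 𝟙 (E? w)))
        ≡⟨ cong (length early *_) (trans (*-comm β _) (sym (∑-* Ω (λ w → 𝟙 (E? w)) β))) ⟩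
      length early * ∑ Ω (λ w → 𝟙 (E? w) * β)
        ≡⟨ sym (∑-const early _) ⟩
      ∑ early (λ a → ∑ Ω (λ w → 𝟙 (E? w) * β))
        ≤⟨ ∑-mono early (λ {a} a∈ → ≤-trans (∑-mono Ω (λ {w} w∈ → 𝟙-bound (E? w) (β≤S w∈))) (moved a∈)) ⟩
      ∑ early (λ a → ∑ Ω (λ w → 𝟙 (E′? a w) * (S (just e) w + A (just e) w)))
        ≤⟨ ∑-mono early (λ {a} a∈ → ∑-mono Ω (λ {w} w∈ → *-monoʳ-≤ (𝟙 (E′? a w)) (S+A≤ w∈))) ⟩
      ∑ early (λ a → ∑ Ω (λ w → 𝟙 (E′? a w) * C₀))
        ≡⟨ ∑-swap early Ω _ ⟩
      ∑ Ω (λ w → ∑ early (λ a → 𝟙 (E′? a w) * C₀))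
        ≤⟨ ∑-mono Ω (λ {w} w∈ → ≤-trans (≤-reflexive (∑-* early (λ a → 𝟙 (E′? a w)) C₀)) (*-monoˡ-≤ C₀ (few w∈))) ⟩
      ∑ Ω (λ w → suc u * C₀)
        ≡⟨ ∑-const Ω _ ⟩
      length Ω * (suc u * C₀)
        ≡⟨ cong (_* (suc u * C₀)) (ListP.length-map (encode bs) (linExts P)) ⟩
      length (linExts P) * (suc u * C₀)
        ≡⟨ *-x∙yz≈y∙zx (length (linExts P)) (suc u) C₀ ⟩
      suc u * (C₀ * length (linExts P)) ∎
      where
      open ≤-Reasoning
      u = length bs₁
      β = length bs ∸ u
      C₀ = length bs + late-cols
      -- The element `b` has index `u` in `bs`, so `e` precedes `b` exactly when at most `u` letters
      -- precede `e`.
      E? : ∀ w → Dec (X (just e) w ≤ u)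
      E? w = X (just e) w ≤? u
      E′? : ∀ a w → Dec (X (just e) w ≤ suc u × 0 < run (just a) w)
      E′? a w = X (just e) w ≤? suc u ×-dec 0 <? run (just a) w
      early-length : length early ≡ suc (length as₁) ∸ cut
      early-length = trans (ListP.length-drop cut head) (cong (_∸ cut) (trans (ListP.length-++ as₁) (+-comm _ 1)))
      e≢b : e ≢ b
      e≢b refl = C.disjoint (subst (_ ∈_) (sym bs≡) (∈-++⁺ʳ bs₁ (here refl))) (∈-++⁺ˡ e∈)
      counts : countBefore P e b ≡ ∑ Ω (λ w → 𝟙 (E? w))
      counts = trans (∑-cong (linExts P) pointwise) (sym (∑-map (encode bs) (linExts P) _))
        where
        <ᵇ-≤ : ∀ {m n} → not (m <ᵇ n) ≡ true → n ≤ m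
        <ᵇ-≤ {m} {n} h with m <ᵇ n in eq
        ... | false = ≮⇒≥ (λ lt → contradiction (trans (sym (T⇒true (<⇒<ᵇ lt))) eq) λ ())
        ≤-<ᵇ : ∀ {m n} → n ≤ m → not (m <ᵇ n) ≡ true
        ≤-<ᵇ {m} {n} h with m <ᵇ n in eq
        ... | false = refl
        ... | true = contradiction (<ᵇ⇒< m n (subst Bool.T (sym eq) _)) (≤⇒≯ h)
        pointwise : ∀ {L} → L ∈ linExts P → 𝟙 (beforeᵇ e b L Bool.≟ true) ≡ 𝟙 (E? (encode bs L))
        pointwise {L} L∈ = ≤-antisym
            (𝟙-mono (beforeᵇ e b L Bool.≟ true) (E? (encode bs L)) (λ h → <ᵇ-≤ (trans (sym flip) h)))
            (𝟙-mono (E? (encode bs L)) (beforeᵇ e b L Bool.≟ true) (λ h → trans flip (≤-<ᵇ h)))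
          where
          L↭ = proj₁ (linExts⇒ {P = P} L∈)
          b∈L : b ∈ L
          b∈L = ∈-resp-↭ (↭-sym L↭) (∈-resp-↭ (↭-sym P↭′) (∈-++⁺ˡ (subst (b ∈_) (sym bs≡) (∈-++⁺ʳ bs₁ (here refl)))))
          e∈L : e ∈ L
          e∈L = ∈-resp-↭ (↭-sym L↭) (∈-resp-↭ (↭-sym P↭) (∈-++⁺ˡ e∈))
          flip : beforeᵇ e b L ≡ not (u <ᵇ X (just e) (encode bs L))
          flip = trans (before-flip L (λ x → e≢b (sym x)) b∈L e∈L)
            (cong not (C.before-X bs₁ b bs₂ bs≡ (∈-++⁺ˡ e∈) L∈))
      β≤S : ∀ {w} → w ∈ Ω → X (just e) w ≤ u → β ≤ S (just e) w
      β≤S {w} w∈ h = m≤n+o⇒m∸n≤o (length bs) u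
        (≤-trans (≤-reflexive (sym (X+S (just e) w∈))) (+-monoˡ-≤ (S (just e) w) h))
      S+A≤ : ∀ {w} → w ∈ Ω → S (just e) w + A (just e) w ≤ C₀
      S+A≤ {w} w∈ = +-mono-≤ (≤-trans (m≤n+m _ (X (just e) w)) (≤-reflexive (X+S (just e) w∈))) (A≤ w∈)
      moved : ∀ {a} → a ∈ early → ∑ Ω (λ w → 𝟙 (E? w) * S (just e) w) ≤
        ∑ Ω (λ w → 𝟙 (E′? a w) * (S (just e) w + A (just e) w))
      moved {a} a∈ = single-move E? (E′? a) a-col (λ w∈ _ → le-e w∈ (early-head a∈)) (λ w∈ _ → free w∈ a∈) step
        where
        a-col : just a ∈ cols
        a-col = col-∈ (head∈ (early-head a∈))
        step : ∀ {w p′} → w ∈ Ω → X (just e) w ≤ u → p′ ∈ cols → le p′ (just e) (keys w) ≡ false → 0 < run p′ w →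
          X (just e) (move (just a) p′ w) ≤ suc u × 0 < run (just a) (move (just a) p′ w)
        step {w} {p′} w∈ h p′∈ l pos =
          +-cancelʳ-≤ (run (just a) w) _ _ (≤-trans (≤-reflexive
            (X-set₂-between {e = just e} (suc (run (just a) w)) _ w a≤e l a≤e l))
            (≤-trans (+-monoˡ-≤ _ h) (≤-reflexive (+-suc u _))))
          , subst (0 <_) (sym (d-set₂ˡ (le-sep-≢ {ks = keys w} a≤e l) _ _ w (col∈ w∈ a-col))) (s≤s z≤n)
          where
          a≤e = le-e w∈ (early-head a∈)
      -- At most `suc u` letters before `e` fill at most `suc u` of the gaps, so a word is counted
      -- for at most that many `a`. This is the factor `suc u` against the gain of `length early`.
      few : ∀ {w} → w ∈ Ω → ∑ early (λ a → 𝟙 (E′? a w)) ≤ suc u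
      few {w} w∈ = by (X (just e) w ≤? suc u)
        where
        by : Dec (X (just e) w ≤ suc u) → ∑ early (λ a → 𝟙 (E′? a w)) ≤ suc u
        by (no n) = ≤-trans (≤-reflexive (trans (∑-cong early (λ {a} _ → 𝟙-no (E′? a w) (λ h → n (proj₁ h)))) (∑-0 early))) z≤n
        by (yes h) = begin
          ∑ early (λ a → 𝟙 (E′? a w))  ≤⟨ ∑-mono early (λ {a} a∈ → present a∈) ⟩
          ∑ early (λ a → upto (just a) (just e) (keys w) * run (just a) w)  ≡⟨ ∑-map just early _ ⟨
          ∑ (map just early) (λ p → upto p (just e) (keys w) * run p w)  ≤⟨ ∑-⊆ _ (UniqueP.map⁺ Maybe.just-injective early-unique) early-cols ⟩
          ∑ cols (λ p → upto p (just e) (keys w) * run p w)  ≡⟨ ∑-cols-upto (just e) w∈ ⟩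
          X (just e) w  ≤⟨ h ⟩
          suc u  ∎
          where
          early-unique : Unique early
          early-unique = UniqueP.drop⁺ cut (Unique-++ˡ head (subst Unique as≡head (AllPairs.map proj₂ as-sorted)))
          early-cols : ∀ {p} → p ∈ map just early → p ∈ cols
          early-cols m with ∈-map⁻ just m
          ... | a , a∈ , refl = col-∈ (head∈ (early-head a∈))
          present : ∀ {a} → a ∈ early → 𝟙 (E′? a w) ≤ upto (just a) (just e) (keys w) * run (just a) w
          present {a} a∈ rewrite 𝟙-yes (le (just a) (just e) (keys w) Bool.≟ true) (le-e w∈ (early-head a∈))
            | +-identityʳ (run (just a) w) with 0 <? run (just a) w
          ... | yes pos = ≤-trans (𝟙≤1 (X (just e) w ≤? suc u ×-dec yes pos)) pos
          ... | no n = ≤-trans (≤-reflexive (𝟙-no (X (just e) w ≤? suc u ×-dec no n) (λ h → n (proj₂ h)))) z≤n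

-- Balanced pairs

split-at : {A : Set} (xs : List A) (i : ℕ) → i < length xs → ∃[ ys ] ∃[ x ] ∃[ zs ] xs ≡ ys ++ x ∷ zs × length ys ≡ i
split-at (x ∷ xs) zero _ = [] , x , xs , refl , refl
split-at (x ∷ xs) (suc i) (s≤s p) with split-at xs i p
... | ys , y , zs , refl , refl = x ∷ ys , y , zs , refl , refl

crossing : ∀ (f : ℕ → ℕ) Λ j → Λ ≤ 2 * f 0 → 2 * f (suc j) < Λ → ∃[ t ] t ≤ j × Λ ≤ 2 * f t × 2 * f (suc t) < Λ
crossing f Λ zero lo hi = zero , z≤n , lo , hi
crossing f Λ (suc j) lo hi with Λ ≤? 2 * f (suc j)
... | yes p = suc j , ≤-refl , p , hi
... | no n with crossing f Λ j lo (≰⇒> n)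
...   | t , t≤j , p = t , m≤n⇒m≤1+n t≤j , p

-- If each of the first ρ drops exceeded `f 0` / ρ, their sum would exceed `f 0`. The summand `t` in
-- `go` collects the strictness of the inequalities and yields the contradiction at ρ.
slow-drop : ∀ (f : ℕ → ℕ) ρ → 0 < ρ → ∃[ g ] g < ρ × ρ * f g ≤ ρ * f (suc g) + f 0
slow-drop f ρ ρ>0 with go ρ
  where
  go : ∀ t → (∃[ g ] g < t × ρ * f g ≤ ρ * f (suc g) + f 0) ⊎ (ρ * f t + t * f 0 + t ≤ ρ * f 0)
  go zero = inj₂ (≤-reflexive (trans (+-identityʳ _) (+-identityʳ _)))
  go (suc t) with go t
  ... | inj₁ (g , g<t , p) = inj₁ (g , m<n⇒m<1+n g<t , p)
  ... | inj₂ le with ρ * f t ≤? ρ * f (suc t) + f 0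
  ...   | yes p = inj₁ (t , ≤-refl , p)
  ...   | no n = inj₂ (≤-trans (≤-reflexive (lem (ρ * f (suc t)) (f 0) t))
                   (≤-trans (+-monoˡ-≤ t (+-monoˡ-≤ (t * f 0) (≰⇒> n))) le))
    where
    lem : ∀ a b t → a + suc t * b + suc t ≡ suc (a + b) + t * b + t
    lem = solve-∀
... | inj₁ p = p
... | inj₂ le = contradiction (≤-trans (m≤n+m (ρ * f 0 + ρ) (ρ * f ρ)) (≤-trans (≤-reflexive (sym (+-assoc (ρ * f ρ) _ _))) le))
      (<⇒≱ (m<m+n (ρ * f 0) ρ>0))

-- Cleared of denominators, `upper` and `lower` say that x precedes y with probability at most ½ and
-- above ½ - 1/K.
record Balanced {d} (P : List (Pt d)) (K : ℕ) : Set where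
  field
    x y : Pt d
    x∈ : x ∈ P
    y∈ : y ∈ P
    x≢y : x ≢ y
    nonempty : 0 < length (linExts P)
    upper : 2 * countBefore P x y ≤ length (linExts P)
    lower : K * length (linExts P) < 2 * (K * countBefore P x y) + 2 * length (linExts P)

module _ {d : ℕ} {P : List (Pt d)} (D : Decomposition P) (Λ>0 : 0 < length (linExts P)) where
  open Decomposition D
  private
    module C = Chain {P = P} {cs = as} {rs = bs ++ rs} P-unique P↭ as-sorted
    Λ = length (linExts P)

  open Model C.model
  open Moves C.model

  Ω-length : length Ω ≡ Λ
  Ω-length = ListP.length-map (encode as) (linExts P)

  uncapped : ∀ {q} → q ∈ cols → Free q
  uncapped {nothing} _ = _
  uncapped {just q} q∈ {a} a∈ q<a with ∈-++⁻ (map just (bs ++ rs)) q∈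
  ... | inj₂ (here ())
  ... | inj₁ m with ∈-map⁻ just m
  ...   | _ , m′ , refl = not-below-as m′ a∈ q<a

  reach : Pt d → ℕ → ℕ
  reach b t = ∑ Ω (λ w → 𝟙 (t ≤? X (just b) w))

  reach-0 : ∀ b → reach b 0 ≡ Λ
  reach-0 b = trans (∑-cong Ω (λ {w} _ → 𝟙-yes (0 ≤? X (just b) w) z≤n)) (trans (∑-const Ω 1) (trans (*-identityʳ _) Ω-length))

  reach-step : ∀ b t → reach b t ≡ atom C.model uncapped (just b) t + reach b (suc t)
  reach-step b t = trans (∑-cong Ω (λ {w} _ → split (X (just b) w))) (∑-+ Ω _ _)
    where
    split : ∀ x → 𝟙 (t ≤? x) ≡ 𝟙 (x ℕP.≟ t) + 𝟙 (suc t ≤? x)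
    split x with <-cmp x t
    ... | tri< lt ne _ = trans (𝟙-no (t ≤? x) (<⇒≱ lt)) (sym (cong₂ _+_ (𝟙-no (x ℕP.≟ t) ne) (𝟙-no (suc t ≤? x) (λ p → <⇒≱ lt (<⇒≤ p)))))
    ... | tri≈ ne refl _ = trans (𝟙-yes (t ≤? x) ≤-refl) (sym (cong₂ _+_ (𝟙-yes (x ℕP.≟ t) refl) (𝟙-no (suc t ≤? x) (<-irrefl refl))))
    ... | tri> _ ne gt = trans (𝟙-yes (t ≤? x) (<⇒≤ gt)) (sym (cong₂ _+_ (𝟙-no (x ℕP.≟ t) ne) (𝟙-yes (suc t ≤? x) gt)))

  reach-count : ∀ as₁ a as₂ → as ≡ as₁ ++ a ∷ as₂ → ∀ {b} → b ∈ bs ++ rs → countBefore P a b ≡ reach b (suc (length as₁))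
  reach-count as₁ a as₂ eq {b} b∈ = trans (∑-cong (linExts P) pointwise) (sym (∑-map (encode as) (linExts P) _))
    where
    pointwise : ∀ {L} → L ∈ linExts P → 𝟙 (beforeᵇ a b L Bool.≟ true) ≡ 𝟙 (suc (length as₁) ≤? X (just b) (encode as L))
    pointwise {L} L∈ = ≤-antisym
      (𝟙-mono (beforeᵇ a b L Bool.≟ true) _ (λ h → <ᵇ⇒< _ _ (subst Bool.T (trans (sym h) (C.before-X as₁ a as₂ eq b∈ L∈)) _)))
      (𝟙-mono _ (beforeᵇ a b L Bool.≟ true) (λ h → trans (C.before-X as₁ a as₂ eq b∈ L∈) (T⇒true (<⇒<ᵇ h))))

  -- The median of X b is at most j, and stepping across it changes the probability by one small atom.
  balanced : ∀ K j {b} → b ∈ bs → j < length as → 2 * reach b (suc j) < Λ →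
    (∀ k → k ≤ j → K * atom C.model uncapped (just b) k < Λ) → Balanced P K
  balanced K j {b} b∈ j<m late small with crossing (reach b) Λ j (≤-trans (≤-reflexive (sym (reach-0 b))) (m≤m+n _ _)) late
  ... | t , t≤j , lo , hi with split-at as t (≤-<-trans t≤j j<m)
  ...   | as₁ , a , as₂ , eq , refl = record
    { x = a ; y = b
    ; x∈ = ∈-resp-↭ (↭-sym P↭) (∈-++⁺ˡ a∈) ; y∈ = ∈-resp-↭ (↭-sym P↭) (∈-++⁺ʳ as b∈′)
    ; x≢y = λ { refl → C.disjoint a∈ b∈′ }
    ; nonempty = Λ>0
    ; upper = subst (λ c → 2 * c ≤ Λ) (sym count) (<⇒≤ hi)
    ; lower = subst (λ c → K * Λ < 2 * (K * c) + 2 * Λ) (sym count) (begin-strict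
        K * Λ  ≤⟨ *-monoʳ-≤ K lo ⟩
        K * (2 * reach b t)  ≡⟨ cong (λ z → K * (2 * z)) (reach-step b t) ⟩
        K * (2 * (α + reach b (suc t)))  ≡⟨ lem K α (reach b (suc t)) ⟩
        2 * (K * reach b (suc t)) + 2 * (K * α)  <⟨ +-monoʳ-< (2 * (K * reach b (suc t))) (*-monoʳ-< 2 (small t t≤j)) ⟩
        2 * (K * reach b (suc t)) + 2 * Λ  ∎)
    }
    where
    open ≤-Reasoning
    α = atom C.model uncapped (just b) t
    b∈′ : b ∈ bs ++ rs
    b∈′ = ∈-++⁺ˡ b∈
    a∈ : a ∈ as
    a∈ = subst (a ∈_) (sym eq) (∈-++⁺ʳ as₁ (here refl))
    count : countBefore P a b ≡ reach b (suc t)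
    count = reach-count as₁ a as₂ eq b∈′
    lem : ∀ k x y → k * (2 * (x + y)) ≡ 2 * (k * y) + 2 * (k * x)
    lem = solve-∀

nth : ∀ {d} → List (Pt d) → ℕ → Pt d
nth [] _ = replicate _ 0
nth (x ∷ _) zero = x
nth (_ ∷ xs) (suc i) = nth xs i

nth-split : ∀ {d} (xs : List (Pt d)) {i} → i < length xs → ∃[ ys ] ∃[ zs ] xs ≡ ys ++ nth xs i ∷ zs × length ys ≡ i
nth-split (x ∷ xs) {zero} _ = [] , xs , refl , refl
nth-split (x ∷ xs) {suc i} (s≤s p) with nth-split xs p
... | ys , zs , eq , len = x ∷ ys , zs , cong (x ∷_) eq , cong suc len

nth-∈ : ∀ {d} (xs : List (Pt d)) {i} → i < length xs → nth xs i ∈ xs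
nth-∈ (x ∷ xs) {zero} _ = here refl
nth-∈ (x ∷ xs) {suc i} (s≤s p) = there (nth-∈ xs p)

nth-sorted : ∀ {d} {R : Pt d → Pt d → Set} {xs i j} → AllPairs R xs → i < j → j < length xs → R (nth xs i) (nth xs j)
nth-sorted {xs = x ∷ xs} {zero} {suc j} (r ∷ _) _ (s≤s p) = All.lookup r (nth-∈ xs p)
nth-sorted {xs = x ∷ xs} {suc i} {suc j} (_ ∷ rs) (s≤s q) (s≤s p) = nth-sorted rs q p

-- The sparse and the dense regime

module Regimes {d : ℕ} {P : List (Pt d)} (D : Decomposition P) (Λ>0 : 0 < length (linExts P))
  (g : ℕ) (cut≡ : Decomposition.cut D ≡ 2 * g) (g>0 : 0 < g) (8g≤m : 8 * g ≤ length (Decomposition.as D)) where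
  open Decomposition D
  private
    module C = Chain {P = P} {cs = as} {rs = bs ++ rs} P-unique P↭ as-sorted
    Λ = length (linExts P)
    p = length P
    m = length as
    β = length bs
    n = length (bs ++ rs)
  open Model C.model
  open Moves C.model

  -- Between the cut at index 2g and the element of index 7g there are at least 5g gaps that can
  -- take elements of `bs`, the factor in `lateness`; at least g letters remain from index 7g on, as
  -- a supply for the moves.
  j : ℕ
  j = 7 * g

  j<m : j < m
  j<m = ≤-trans (≤-trans (+-monoˡ-≤ j g>0) (≤-reflexive (lem g))) 8g≤m
    where
    lem : ∀ g → g + 7 * g ≡ 8 * g
    lem = solve-∀

  p≡m+n : p ≡ m + n
  p≡m+n = trans (↭-length P↭) (ListP.length-++ as)

  cols-length : length cols ≡ suc n
  cols-length = trans (ListP.length-++ (map just (bs ++ rs)))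
    (trans (cong (_+ 1) (ListP.length-map just (bs ++ rs))) (+-comm n 1))

  late : ℕ → ℕ
  late u = reach D Λ>0 (nth bs u) (suc j)

  lateness : ∀ u → u < β → 5 * g * ((β ∸ u) * late u) ≤ suc u * ((p ∸ j) * Λ)
  lateness u u<β with nth-split as j<m | nth-split bs u<β
  ... | as₁ , as₂ , as≡ , len | bs₁ , bs₂ , bs≡ , refl = begin
    5 * g * ((β ∸ u) * late u)  ≤⟨ *-monoˡ-≤ ((β ∸ u) * late u) slots ⟩
    (suc (length as₁) ∸ cut) * ((β ∸ u) * late u)  ≡⟨ cong (λ z → (suc (length as₁) ∸ cut) * ((β ∸ u) * z)) count ⟨
    (suc (length as₁) ∸ cut) * ((β ∸ u) * countBefore P (nth as j) (nth bs u))
                                                   ≤⟨ late-bound D as₁ (nth as j) as₂ as≡ bs₁ (nth bs u) bs₂ bs≡ ⟩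
    suc u * ((β + (length (as₂ ++ rs) + 1)) * Λ)  ≡⟨ cong (λ z → suc u * (z * Λ)) size ⟩
    suc u * ((p ∸ j) * Λ)  ∎
    where
    open ≤-Reasoning
    count : countBefore P (nth as j) (nth bs u) ≡ late u
    count = trans (reach-count D Λ>0 as₁ (nth as j) as₂ as≡ (∈-++⁺ˡ (nth-∈ bs u<β)))
      (cong (λ z → reach D Λ>0 (nth bs u) (suc z)) len)
    slots : 5 * g ≤ suc (length as₁) ∸ cut
    slots rewrite len | cut≡ = m+n≤o⇒m≤o∸n (5 * g) (≤-trans (≤-reflexive (lem g)) (n≤1+n j))
      where
      lem : ∀ g → 5 * g + 2 * g ≡ 7 * g
      lem = solve-∀
    size : β + (length (as₂ ++ rs) + 1) ≡ p ∸ j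
    size = sym (trans (cong (_∸ j) total-size) (m+n∸m≡n j _))
      where
      lem : ∀ j x b y → j + suc x + (b + y) ≡ j + (b + (x + y + 1))
      lem = solve-∀
      total-size : p ≡ j + (β + (length (as₂ ++ rs) + 1))
      total-size = trans p≡m+n (trans (cong₂ _+_
          (trans (cong length as≡) (trans (ListP.length-++ as₁) (cong (_+ suc (length as₂)) len)))
          (ListP.length-++ bs))
        (trans (lem j (length as₂) β (length rs)) (cong (λ z → j + (β + (z + 1))) (sym (ListP.length-++ as₂)))))

  atom-of : ℕ → ℕ → ℕ
  atom-of u k = atom C.model (uncapped D Λ>0) (just (nth bs u)) k

  -- The last hypothesis makes the element of index `j` precede the first element of `bs` with
  -- probability below ½. The `room` lets `sparse-atom` apply at every value up to `j`, and `R`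
  -- above 2K turns its bound into one below 1/K.
  sparse-balanced : ∀ K R → 0 < β → 2 * K < R → j + R + suc (2 * R * n) ≤ m → 2 * (p ∸ j) < 5 * g → Balanced P K
  sparse-balanced K R β>0 2K<R room few = balanced D Λ>0 K j (nth-∈ bs β>0) j<m small-late small
    where
    open ≤-Reasoning
    small-late : 2 * late 0 < Λ
    small-late = *-cancelˡ-< (5 * g) _ _ (begin-strict
      5 * g * (2 * late 0)  ≡⟨ *-x∙yz≈y∙xz (5 * g) 2 (late 0) ⟩
      2 * (5 * g * late 0)  ≤⟨ *-monoʳ-≤ 2 (*-monoʳ-≤ (5 * g) (≤-trans (≤-reflexive (sym (*-identityˡ _))) (*-monoˡ-≤ (late 0) β>0))) ⟩
      2 * (5 * g * (β * late 0))  ≤⟨ *-monoʳ-≤ 2 (lateness 0 β>0) ⟩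
      2 * (1 * ((p ∸ j) * Λ))  ≡⟨ lem₂ (p ∸ j) Λ ⟩
      2 * (p ∸ j) * Λ  <⟨ *-monoˡ-< Λ {{>-nonZero Λ>0}} few ⟩
      5 * g * Λ  ∎)
      where
      lem₂ : ∀ x y → 2 * (1 * (x * y)) ≡ 2 * x * y
      lem₂ = solve-∀
    small : ∀ k → k ≤ j → K * atom-of 0 k < Λ
    small k k≤j with atom-of 0 k in eq
    ... | zero = subst (_< Λ) (sym (*-zeroʳ K)) Λ>0
    ... | suc a = *-cancelˡ-< 2 _ _ (begin-strict
      2 * (K * suc a)  ≡⟨ *-assoc 2 K (suc a) ⟨
      2 * K * suc a  <⟨ *-monoˡ-< (suc a) 2K<R ⟩
      R * suc a  ≡⟨ cong (R *_) eq ⟨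
      R * atom-of 0 k  ≤⟨ sparse-atom C.model (uncapped D Λ>0) k n R (∈-++⁺ˡ (∈-map⁺ just (∈-++⁺ˡ (nth-∈ bs β>0)))) cols-length
                               (≤-trans (+-monoˡ-≤ (suc (2 * R * n)) (+-monoˡ-≤ R k≤j)) room) ⟩
      2 * length Ω  ≡⟨ cong (2 *_) (Ω-length D Λ>0) ⟩
      2 * Λ  ∎)

  module Dense (u : ℕ) (u<β : u < β) where
    private
      lt : ∀ {i} → i ≤ u → i < β
      lt i≤u = ≤-<-trans i≤u u<β
      col : ℕ → Maybe (Pt d)
      col i = just (nth bs i)
      rest-∈ : ∀ {i} → i ≤ u → nth bs i ∈ bs ++ rs
      rest-∈ i≤u = ∈-++⁺ˡ (nth-∈ bs (lt i≤u))
      col-∈ : ∀ {i} → i ≤ u → col i ∈ cols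
      col-∈ i≤u = ∈-++⁺ˡ (∈-map⁺ just (rest-∈ i≤u))
      order : ∀ {w i j} → w ∈ Ω → i < j → j ≤ u → le (col i) (col j) (keys w) ≡ true × le (col j) (col i) (keys w) ≡ false
      order w∈ i<j j≤u = C.le-order w∈ (rest-∈ (≤-trans (<⇒≤ i<j) j≤u)) (rest-∈ j≤u) (nth-sorted bs-sorted i<j (lt j≤u))
      col-≤ : ∀ {w i j} → w ∈ Ω → i ≤ j → j ≤ u → le (col i) (col j) (keys w) ≡ true
      col-≤ {w} w∈ i≤j j≤u with m≤n⇒m<n∨m≡n i≤j
      ... | inj₁ i<j = proj₁ (order w∈ i<j j≤u)
      ... | inj₂ refl = le-refl {ks = keys w} (col∈ w∈ (col-∈ j≤u))
      col-> : ∀ {w i j} → w ∈ Ω → i < j → j ≤ u → le (col j) (col i) (keys w) ≡ false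
      col-> w∈ i<j j≤u = proj₂ (order w∈ i<j j≤u)
      module Cs = Columns C.model (uncapped D Λ>0) col u col-∈ col-≤ col->

    -- Among the ρ adjacent windows that start at `h`, `slow-drop` selects one across which the mean
    -- falls by at most 1/ρ of the mean at `h`; by `mean-bound` and the hypothesis on ρ * h, bad
    -- pairs are then rare. Each of the four terms of `window-atom` is at most Λ/(5K), which leaves
    -- a fifth to spare for strictness.
    dense-balanced : ∀ K R T c ρ h → 0 < K → 5 * K ≤ suc R → 0 < R → 0 < T → 5 * K * (R * c ^ R) ≤ T → 0 < c → R < g →
      suc p ≤ c * (g ∸ R) → 0 < ρ → h + ρ * (T + T) ≤ u → 5 * K * (T * m) ≤ ρ * h → 5 * K * late u ≤ Λ → Balanced P K
    dense-balanced K R T c ρ h K>0 5K≤R R>0 T>0 T-large c>0 R<g crowd ρ>0 room heavy late-small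
      with slow-drop (λ i → Cs.mean (h + i * (T + T))) ρ ρ>0
    ... | i , i<ρ , drop-small = balanced D Λ>0 K j (nth-∈ bs (lt q≤u)) j<m small-late small
      where
      open ≤-Reasoning
      hᵢ = h + i * (T + T)
      next : hᵢ + (T + T) ≡ h + suc i * (T + T)
      next = lem h i (T + T)
        where
        lem : ∀ h i t → h + i * t + t ≡ h + suc i * t
        lem = solve-∀
      fits : hᵢ + (T + T) ≤ u
      fits = ≤-trans (≤-reflexive next) (≤-trans (+-monoʳ-≤ h (*-monoˡ-≤ (T + T) i<ρ)) room)
      q≤u : hᵢ + T ≤ u
      q≤u = ≤-trans (+-monoʳ-≤ hᵢ (m≤m+n T T)) fits
      fifth : ∀ {x} → 5 * K * x ≤ Λ → 5 * (K * x) ≤ Λ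
      fifth {x} = ≤-trans (≤-reflexive (sym (*-assoc 5 K x)))
      small-late : 2 * late (hᵢ + T) < Λ
      small-late = *-cancelˡ-< 5 _ _ (begin-strict
        5 * (2 * late (hᵢ + T))  ≤⟨ *-monoʳ-≤ 5 (*-monoʳ-≤ 2 earlier) ⟩
        5 * (2 * late u)  ≡⟨ *-x∙yz≈y∙xz 5 2 (late u) ⟩
        2 * (5 * late u)  ≤⟨ *-monoʳ-≤ 2 (*-monoʳ-≤ 5 (≤-trans (≤-reflexive (sym (*-identityˡ _))) (*-monoˡ-≤ (late u) K>0))) ⟩
        2 * (5 * (K * late u))  ≤⟨ *-monoʳ-≤ 2 (fifth late-small) ⟩
        2 * Λ  <⟨ *-monoˡ-< Λ {{>-nonZero Λ>0}} {2} {5} (s≤s (s≤s (s≤s z≤n))) ⟩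
        5 * Λ  ∎)
        where
        earlier : late (hᵢ + T) ≤ late u
        earlier = ∑-mono Ω (λ {w} w∈ → 𝟙-mono (suc j ≤? X (col (hᵢ + T)) w) (suc j ≤? X (col u) w)
          (λ le → ≤-trans le (X-mono w (col-≤ w∈ q≤u ≤-refl))))
      small : ∀ k → k ≤ j → K * atom-of (hᵢ + T) k < Λ
      small k k≤j = *-cancelˡ-< 5 _ _ (begin-strict
        5 * (K * atom-of (hᵢ + T) k)  ≤⟨ *-monoʳ-≤ 5 (*-monoʳ-≤ K (W.window-atom R j (g ∸ R) c room′ (m<n⇒0<n∸m R<g) c>0 crowd′)) ⟩
        5 * (K * (late u + B + G + F))  ≡⟨ lem K (late u) B G F ⟩
        5 * K * late u + 5 * K * B + 5 * K * G + 5 * K * F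
                                          ≤⟨ +-mono-≤ (+-mono-≤ (+-mono-≤ late-small B-small) G-small) F-small ⟩
        Λ + Λ + Λ + Λ  <⟨ m<m+n (Λ + Λ + Λ + Λ) Λ>0 ⟩
        Λ + Λ + Λ + Λ + Λ  ≡⟨ lem₅ Λ ⟩
        5 * Λ  ∎)
        where
        module W = Cs.Window hᵢ T T>0 fits k
        B = ∑ Ω (λ w → ∑ (downFrom T) (λ r → W.bad R r w))
        G = ∑ Ω (λ w → ∑ (downFrom T) (λ r → W.good R r w))
        lem : ∀ k a b c e → 5 * (k * (a + b + c + e)) ≡ 5 * k * a + 5 * k * b + 5 * k * c + 5 * k * e
        lem = solve-∀
        lem₅ : ∀ x → x + x + x + x + x ≡ 5 * x
        lem₅ = solve-∀
        -- Of the g letters in reserve, `R` are available for feeding and `g ∸ R` always remain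
        -- beyond `e`.
        room′ : j + (g ∸ R + R) ≤ m
        room′ = ≤-trans (≤-reflexive (trans (cong (j +_) (m∸n+n≡m (<⇒≤ R<g))) (8g g))) 8g≤m
          where
          8g : ∀ g → 7 * g + g ≡ 8 * g
          8g = solve-∀
        crowd′ : m + length cols ≤ c * (g ∸ R)
        crowd′ = ≤-trans (≤-reflexive (trans (cong (m +_) cols-length) (trans (+-suc m n) (cong suc (sym p≡m+n))))) crowd
        F = ∑ Ω (λ w → 𝟙 (W.Φ? R j (g ∸ R) c room′ (m<n⇒0<n∸m R<g) c>0 crowd′ w))
        G-small : 5 * K * G ≤ Λ
        G-small = begin
          5 * K * G  ≤⟨ *-monoˡ-≤ G 5K≤R ⟩
          suc R * G  ≡⟨ *-comm (suc R) G ⟩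
          G * suc R  ≤⟨ W.good-total R ⟩
          length Ω  ≡⟨ Ω-length D Λ>0 ⟩
          Λ  ∎
        F-small : 5 * K * F ≤ Λ
        F-small = *-cancelˡ-≤ (R * c ^ R) {{>-nonZero (*-mono-≤ R>0 (m^n>0 c {{>-nonZero c>0}} R))}} (begin
          R * c ^ R * (5 * K * F)  ≡⟨ *-x∙yz≈yx∙z (R * c ^ R) (5 * K) F ⟩
          5 * K * (R * c ^ R) * F  ≤⟨ *-monoˡ-≤ F T-large ⟩
          T * F  ≤⟨ W.Φ-total R j (g ∸ R) c room′ (m<n⇒0<n∸m R<g) c>0 crowd′ ⟩
          R * (c ^ R * length Ω)  ≡⟨ cong (λ z → R * (c ^ R * z)) (Ω-length D Λ>0) ⟩
          R * (c ^ R * Λ)  ≡⟨ *-assoc R (c ^ R) Λ ⟨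
          R * c ^ R * Λ  ∎)
        μ μ′ μ₀ : ℕ
        μ = Cs.mean hᵢ
        μ′ = Cs.mean (hᵢ + (T + T))
        μ₀ = Cs.mean h
        drop′ : ρ * μ ≤ ρ * μ′ + μ₀
        drop′ = subst₂ (λ x y → ρ * μ ≤ ρ * Cs.mean x + Cs.mean y) (sym next) (+-identityʳ h) drop-small
        ρB : ρ * B ≤ T * μ₀
        ρB = +-cancelʳ-≤ (ρ * (T * μ′)) _ _ (begin
          ρ * B + ρ * (T * μ′)  ≡⟨ *-distribˡ-+ ρ B (T * μ′) ⟨
          ρ * (B + T * μ′)  ≤⟨ *-monoʳ-≤ ρ (W.bad-total R) ⟩
          ρ * (T * μ)  ≡⟨ *-x∙yz≈y∙xz ρ T μ ⟩
          T * (ρ * μ)  ≤⟨ *-monoʳ-≤ T drop′ ⟩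
          T * (ρ * μ′ + μ₀)  ≡⟨ lem₂ T ρ μ′ μ₀ ⟩
          T * μ₀ + ρ * (T * μ′)  ∎)
          where
          lem₂ : ∀ t r x y → t * (r * x + y) ≡ t * y + r * (t * x)
          lem₂ = solve-∀
        B-small : 5 * K * B ≤ Λ
        B-small = *-cancelˡ-≤ (T * m) {{>-nonZero (*-mono-≤ T>0 (≤-trans (s≤s z≤n) j<m))}} (begin
          T * m * (5 * K * B)  ≡⟨ *-x∙yz≈yx∙z (T * m) (5 * K) B ⟩
          5 * K * (T * m) * B  ≤⟨ *-monoˡ-≤ B heavy ⟩
          ρ * h * B  ≡⟨ *-xy∙z≈y∙xz ρ h B ⟩
          h * (ρ * B)  ≤⟨ *-monoʳ-≤ h ρB ⟩
          h * (T * μ₀)  ≡⟨ *-x∙yz≈y∙xz h T μ₀ ⟩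
          T * (h * μ₀)  ≤⟨ *-monoʳ-≤ T (Cs.mean-bound h (≤-trans (m≤m+n h _) room)) ⟩
          T * (m * length Ω)  ≡⟨ cong (λ z → T * (m * z)) (Ω-length D Λ>0) ⟩
          T * (m * Λ)  ≡⟨ *-assoc T m Λ ⟨
          T * m * Λ  ∎)

-- Choice of the constants

module Sizes (C K : ℕ) (C>0 : 0 < C) (K>0 : 0 < K) where

  -- Chosen so that each of the four terms bounding an atom in window-atom is at most 1/5K of the total.
  opaque

    R κ c T c₂ c₃ ρ threshold : ℕ
    R = 5 * K
    κ = 16 * (3 * R + 9)
    c = 32 * C
    T = 5 * K * (R * c ^ R)
    c₂ = (8 + κ) * C
    c₃ = suc (32 * C * K)
    ρ = 10 * K * T * (2 * (c₂ * c₃))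
    threshold = 16 * R + 16 + c₂ * c₃ * (4 * (T * ρ) + 1)

    R≡ : R ≡ 5 * K
    R≡ = refl

    κ≡ : κ ≡ 16 * (3 * R + 9)
    κ≡ = refl

    c≡ : c ≡ 32 * C
    c≡ = refl

    T≡ : T ≡ 5 * K * (R * c ^ R)
    T≡ = refl

    c₂≡ : c₂ ≡ (8 + κ) * C
    c₂≡ = refl

    c₃≡ : c₃ ≡ suc (32 * C * K)
    c₃≡ = refl

    ρ≡ : ρ ≡ 10 * K * T * (2 * (c₂ * c₃))
    ρ≡ = refl

    threshold≡ : threshold ≡ 16 * R + 16 + c₂ * c₃ * (4 * (T * ρ) + 1)
    threshold≡ = refl

  R>0 : 0 < R
  R>0 = subst (0 <_) (sym R≡) (*-mono-≤ {1} {5} (s≤s z≤n) K>0)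

  c>0 : 0 < c
  c>0 = subst (0 <_) (sym c≡) (*-mono-≤ {1} {32} (s≤s z≤n) C>0)

  T>0 : 0 < T
  T>0 = subst (0 <_) (sym T≡) (*-mono-≤ (*-mono-≤ {1} {5} (s≤s z≤n) K>0) (*-mono-≤ R>0 (m^n>0 c {{>-nonZero c>0}} R)))

  c₂>0 : 0 < c₂
  c₂>0 = subst (0 <_) (sym c₂≡) (*-mono-≤ {1} {8 + κ} (s≤s z≤n) C>0)

  c₃>0 : 0 < c₃
  c₃>0 = subst (0 <_) (sym c₃≡) (s≤s z≤n)

  ρ>0 : 0 < ρ
  ρ>0 = subst (0 <_) (sym ρ≡) (*-mono-≤ (*-mono-≤ (*-mono-≤ {1} {10} (s≤s z≤n) K>0) T>0)
    (*-mono-≤ {1} {2} (s≤s z≤n) (*-mono-≤ c₂>0 c₃>0)))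

  -- As m is at most 16g, sparseness gives n * (3R + 9) ≤ g. This absorbs both R + 1 + 2Rn, what is
  -- needed beyond 7g, and 7 + n, the excess of m + n over 8g.
  sparse-room : ∀ {g m n} → 8 * g ≤ m → m ≤ 8 * g + 7 → 0 < g → 0 < n → n * κ ≤ m →
    7 * g + R + suc (2 * R * n) ≤ m × 2 * (m + n ∸ 7 * g) < 5 * g
  sparse-room {g} {m} {n} lo hi g>0 n>0 sparse = room , few
    where
    open ≤-Reasoning
    m≤15g : m ≤ 16 * g
    m≤15g = ≤-trans hi (≤-trans (+-monoʳ-≤ (8 * g) (≤-trans (m≤m*n 7 g {{>-nonZero g>0}}) (*-monoˡ-≤ g {7} {8} (n≤1+n 7)))) (≤-reflexive (lem g)))
      where
      lem : ∀ g → 8 * g + 8 * g ≡ 16 * g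
      lem = solve-∀
    core : n * (3 * R + 9) ≤ g
    core = *-cancelˡ-≤ 16 (≤-trans (≤-reflexive (trans (*-x∙yz≈y∙xz 16 n (3 * R + 9)) (cong (n *_) (sym κ≡)))) (≤-trans sparse m≤15g))
    room : 7 * g + R + suc (2 * R * n) ≤ m
    room = begin
      7 * g + R + suc (2 * R * n)  ≡⟨ lem₁ (7 * g) R (2 * R * n) ⟩
      7 * g + (R + 1 + 2 * R * n)  ≤⟨ +-monoʳ-≤ (7 * g) (+-monoˡ-≤ (2 * R * n) (+-mono-≤ (m≤n*m R n {{>-nonZero n>0}}) (≤-trans n>0 (m≤n*m n 9)))) ⟩
      7 * g + (n * R + 9 * n + 2 * R * n)  ≡⟨ cong (7 * g +_) (lem₂ n R 9) ⟩
      7 * g + n * (3 * R + 9)  ≤⟨ +-monoʳ-≤ (7 * g) core ⟩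
      7 * g + g  ≡⟨ lem₃ g ⟩
      8 * g  ≤⟨ lo ⟩
      m  ∎
      where
      lem₁ : ∀ a b x → a + b + suc x ≡ a + (b + 1 + x)
      lem₁ = solve-∀
      lem₂ : ∀ n r t → n * r + t * n + 2 * r * n ≡ n * (3 * r + t)
      lem₂ = solve-∀
      lem₃ : ∀ g → 7 * g + g ≡ 8 * g
      lem₃ = solve-∀
    7+n≤g : 7 + n ≤ g
    7+n≤g = begin
      7 + n  ≤⟨ +-monoˡ-≤ n (m≤n*m 7 n {{>-nonZero n>0}}) ⟩
      n * 7 + n  ≤⟨ +-monoʳ-≤ (n * 7) (m≤n*m n 2) ⟩
      n * 7 + 2 * n  ≡⟨ lem n ⟩
      n * 9  ≤⟨ *-monoʳ-≤ n (m≤n+m 9 (3 * R)) ⟩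
      n * (3 * R + 9)  ≤⟨ core ⟩
      g  ∎
      where
      lem : ∀ n → n * 7 + 2 * n ≡ n * 9
      lem = solve-∀
    few : 2 * (m + n ∸ 7 * g) < 5 * g
    few = begin-strict
      2 * (m + n ∸ 7 * g)  ≤⟨ *-monoʳ-≤ 2 (m≤n+o⇒m∸n≤o (m + n) (7 * g) (begin
          m + n  ≤⟨ +-monoˡ-≤ n hi ⟩
          8 * g + 7 + n  ≡⟨ lem₁ g n ⟩
          7 * g + (g + (7 + n))  ≤⟨ +-monoʳ-≤ (7 * g) (+-monoʳ-≤ g 7+n≤g) ⟩
          7 * g + (g + g)  ∎)) ⟩
      2 * (g + g)  <⟨ m<n+m _ g>0 ⟩
      g + 2 * (g + g)  ≡⟨ lem₂ g ⟩
      5 * g  ∎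
      where
      lem₁ : ∀ g n → 8 * g + 7 + n ≡ 7 * g + (g + (7 + n))
      lem₁ = solve-∀
      lem₂ : ∀ g → g + 2 * (g + g) ≡ 5 * g
      lem₂ = solve-∀

  -- With u + 1 ≤ 2u, p ≤ 15Cg and β - u ≥ 32CKu, the bound gives ℓ/Λ ≤ 30/(160K) = 3/(16K), just
  -- below 1/(5K). The 32 in `c₃` comes from here.
  late-small : ∀ {g u β p ℓ Λ} → 0 < g → 0 < u → u * c₃ ≤ β → p ≤ C * (15 * g) →
    5 * g * ((β ∸ u) * ℓ) ≤ suc u * ((p ∸ 7 * g) * Λ) → 5 * K * ℓ ≤ Λ
  late-small {g} {u} {β} {p} {ℓ} {Λ} g>0 u>0 uc₃≤β p≤ bound =
    *-cancelˡ-≤ (30 * (g * C * u)) {{>-nonZero (*-mono-≤ {1} {30} (s≤s z≤n) (*-mono-≤ (*-mono-≤ g>0 C>0) u>0))}} (begin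
      30 * (g * C * u) * (5 * K * ℓ)  ≤⟨ *-monoˡ-≤ (5 * K * ℓ) (*-monoˡ-≤ (g * C * u) (m≤m+n 30 2)) ⟩
      32 * (g * C * u) * (5 * K * ℓ)  ≡⟨ lem₁ 32 g C u K ℓ ⟩
      5 * g * (32 * C * K * u * ℓ)  ≤⟨ *-monoʳ-≤ (5 * g) (*-monoˡ-≤ ℓ (m+n≤o⇒m≤o∸n (32 * C * K * u)
                                                 (≤-trans (≤-reflexive (trans (lem₂ (32 * C * K) u) (cong (u *_) (sym c₃≡)))) uc₃≤β))) ⟩
      5 * g * ((β ∸ u) * ℓ)  ≤⟨ bound ⟩
      suc u * ((p ∸ 7 * g) * Λ)  ≤⟨ *-mono-≤ (+-monoˡ-≤ u u>0) (*-monoˡ-≤ Λ (≤-trans (m∸n≤m p (7 * g)) p≤)) ⟩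
      (u + u) * (C * (15 * g) * Λ)  ≡⟨ lem₃ u C 15 g Λ ⟩
      30 * (g * C * u) * Λ  ∎)
    where
    open ≤-Reasoning
    lem₁ : ∀ t g C u K l → t * (g * C * u) * (5 * K * l) ≡ 5 * g * (t * C * K * u * l)
    lem₁ = solve-∀
    lem₂ : ∀ x u → x * u + u ≡ u * suc x
    lem₂ = solve-∀
    lem₃ : ∀ u C t g Λ → (u + u) * (C * (t * g) * Λ) ≡ 2 * t * (g * C * u) * Λ
    lem₃ = solve-∀

  -- One more than p is at most 16Cg, and g is at most twice `g ∸ R`; this explains the value 32C of
  -- `c`.
  crowd : ∀ {g p} → 0 < g → 2 * R < g → p ≤ C * (15 * g) → suc p ≤ c * (g ∸ R)
  crowd {g} {p} g>0 2R<g p≤ = begin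
    1 + p  ≤⟨ +-mono-≤ (*-mono-≤ C>0 g>0) p≤ ⟩
    C * g + C * (15 * g)  ≡⟨ lem₁ C 15 g ⟩
    16 * C * g  ≤⟨ *-monoʳ-≤ (16 * C) half ⟩
    16 * C * (2 * (g ∸ R))  ≡⟨ trans (lem₂ 16 C (g ∸ R)) (cong (_* (g ∸ R)) (sym c≡)) ⟩
    c * (g ∸ R)  ∎
    where
    open ≤-Reasoning
    lem₁ : ∀ C t g → C * g + C * (t * g) ≡ suc t * C * g
    lem₁ = solve-∀
    lem₂ : ∀ t C x → t * C * (2 * x) ≡ t * 2 * C * x
    lem₂ = solve-∀
    R≤g : R ≤ g
    R≤g = ≤-trans (m≤m+n R _) (<⇒≤ 2R<g)
    half : g ≤ 2 * (g ∸ R)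
    half = +-cancelˡ-≤ (2 * R) _ _ (begin
      2 * R + g  ≤⟨ +-monoˡ-≤ g (<⇒≤ 2R<g) ⟩
      g + g  ≡⟨ lem g ⟩
      2 * g  ≡⟨ cong (2 *_) (m+[n∸m]≡n R≤g) ⟨
      2 * (R + (g ∸ R))  ≡⟨ *-distribˡ-+ 2 R (g ∸ R) ⟩
      2 * R + 2 * (g ∸ R)  ∎)
      where
      lem : ∀ g → g + g ≡ 2 * g
      lem = solve-∀

  -- The ρ windows take up less than half of the columns up to `u`, so the starting point h is
  -- comparable with u and hence with m; ρ is defined as the resulting ratio times 5KT.
  heavy : ∀ {m u} → 4 * (T * ρ) < u → m ≤ c₂ * (suc u * c₃) →
    (u ∸ ρ * (T + T)) + ρ * (T + T) ≤ u × 5 * K * (T * m) ≤ ρ * (u ∸ ρ * (T + T))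
  heavy {m} {u} big m≤ = ≤-reflexive (m∸n+n≡m fits) , (begin
    5 * K * (T * m)  ≤⟨ *-monoʳ-≤ (5 * K) (*-monoʳ-≤ T m≤) ⟩
    5 * K * (T * (c₂ * (suc u * c₃)))  ≤⟨ *-monoʳ-≤ (5 * K) (*-monoʳ-≤ T (*-monoʳ-≤ c₂ (*-monoˡ-≤ c₃ suc-u))) ⟩
    5 * K * (T * (c₂ * (4 * h * c₃)))  ≡⟨ trans (lem K T c₂ h c₃) (cong (_* h) (sym ρ≡)) ⟩
    ρ * h  ∎)
    where
    open ≤-Reasoning
    h = u ∸ ρ * (T + T)
    four : ρ * (T + T) + ρ * (T + T) ≡ 4 * (T * ρ)
    four = lem₀ ρ T
      where
      lem₀ : ∀ r t → r * (t + t) + r * (t + t) ≡ 4 * (t * r)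
      lem₀ = solve-∀
    fits : ρ * (T + T) ≤ u
    fits = ≤-trans (m≤m+n _ _) (≤-trans (≤-reflexive four) (<⇒≤ big))
    u≤2h : u < h + h
    u≤2h = +-cancelʳ-< (ρ * (T + T) + ρ * (T + T)) _ _ (begin-strict
      u + (ρ * (T + T) + ρ * (T + T))  ≡⟨ cong (u +_) four ⟩
      u + 4 * (T * ρ)  <⟨ +-monoʳ-< u big ⟩
      u + u  ≡⟨ cong (λ z → z + z) (m∸n+n≡m fits) ⟨
      (h + ρ * (T + T)) + (h + ρ * (T + T))  ≡⟨ +-interchange h (ρ * (T + T)) h (ρ * (T + T)) ⟩
      h + h + (ρ * (T + T) + ρ * (T + T))  ∎)
    suc-u : suc u ≤ 4 * h
    suc-u = ≤-trans u≤2h (≤-trans (m≤m+n (h + h) (h + h)) (≤-reflexive (lem₂ h)))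
      where
      lem₂ : ∀ h → h + h + (h + h) ≡ 4 * h
      lem₂ = solve-∀
    lem : ∀ K T a h b → 5 * K * (T * (a * (4 * h * b))) ≡ 10 * K * T * (2 * (a * b)) * h
    lem = solve-∀

-- The alternatives in `β-large` measure `bs` against the part of `as` below the cut or against
-- everything outside `as`. In the dense regime either one makes `bs` proportional to `as`.
record SizedDecomposition {d} (P : List (Pt d)) (C : ℕ) : Set where
  field
    D : Decomposition P
    g : ℕ
  open Decomposition D
  field
    cut≡ : cut ≡ 2 * g
    lo : 8 * g ≤ length as
    hi : length as ≤ 8 * g + 7
    β>0 : 0 < length bs
    P≤ : length P ≤ C * length as
    β-large : 2 * g ≤ C * length bs ⊎ length (bs ++ rs) ≤ C * length bs

module _ (C K : ℕ) (C>0 : 0 < C) (K>0 : 0 < K) where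
  open Sizes C K C>0 K>0

  many-elements-balanced : ∀ {d} {P : List (Pt d)} → 0 < length (linExts P) → SizedDecomposition P C →
    C * threshold < length P → Balanced P K
  many-elements-balanced {d} {P} Λ>0 sized p-large = by (n * κ ≤? m)
    where
    open SizedDecomposition sized
    open Decomposition D
    open ≤-Reasoning
    p = length P
    m = length as
    β = length bs
    n = length (bs ++ rs)
    m-large : threshold < m
    m-large = *-cancelˡ-< C threshold m (<-≤-trans p-large P≤)
    2R<g : 2 * R < g
    2R<g = *-cancelˡ-< 8 _ _ (+-cancelʳ-< 7 _ _ (begin-strict
      8 * (2 * R) + 7  <⟨ +-monoʳ-< (8 * (2 * R)) {7} {16} (s≤s (s≤s (s≤s (s≤s (s≤s (s≤s (s≤s (s≤s z≤n)))))))) ⟩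
      8 * (2 * R) + 16  ≡⟨ lem R 16 ⟩
      16 * R + 16  ≤⟨ m≤m+n _ _ ⟩
      16 * R + 16 + c₂ * c₃ * (4 * (T * ρ) + 1) ≡⟨ threshold≡ ⟨
      threshold  <⟨ m-large ⟩
      m  ≤⟨ hi ⟩
      8 * g + 7  ∎))
      where
      lem : ∀ r t → 8 * (2 * r) + t ≡ 16 * r + t
      lem = solve-∀
    g>0 : 0 < g
    g>0 = ≤-trans (s≤s z≤n) 2R<g
    m≤15g : m ≤ 15 * g
    m≤15g = ≤-trans hi (≤-trans (+-monoʳ-≤ (8 * g) (m≤m*n 7 g {{>-nonZero g>0}})) (≤-reflexive (lem g)))
      where
      lem : ∀ g → 8 * g + 7 * g ≡ 15 * g
      lem = solve-∀
    module G = Regimes D Λ>0 g cut≡ g>0 lo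
    p≤15 : p ≤ C * (15 * g)
    p≤15 = ≤-trans P≤ (*-monoʳ-≤ C m≤15g)
    n>0 : 0 < n
    n>0 = ≤-trans β>0 (≤-trans (m≤m+n β (length rs)) (≤-reflexive (sym (ListP.length-++ bs))))
    sparse : n * κ ≤ m → Balanced P K
    sparse sp = G.sparse-balanced K R β>0
      (subst (2 * K <_) (sym R≡) (*-monoˡ-< K {{>-nonZero K>0}} {2} {5} (s≤s (s≤s (s≤s z≤n)))))
      (proj₁ (sparse-room {g} {m} {n} lo hi g>0 n>0 sp))
      (subst (λ z → 2 * (z ∸ 7 * g) < 5 * g) (sym G.p≡m+n) (proj₂ (sparse-room {g} {m} {n} lo hi g>0 n>0 sp)))
    dense : m < n * κ → ∀ u → u * c₃ ≤ β → β ≤ suc u * c₃ → Balanced P K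
    dense m<nκ u uc₃≤β β≤ = G.Dense.dense-balanced u u<β K R T c ρ (u ∸ ρ * (T + T)) K>0
        (≤-trans (≤-reflexive (sym R≡)) (n≤1+n R)) R>0 T>0 (≤-reflexive (sym T≡)) c>0
        (≤-<-trans (m≤m+n R _) 2R<g) (crowd {g} {p} g>0 2R<g p≤15) ρ>0
        (proj₁ (heavy {m} {u} big m≤)) (proj₂ (heavy {m} {u} big m≤))
        (late-small {g} {u} {β} {p} {G.late u} {length (linExts P)} g>0 u>0 uc₃≤β p≤15 (G.lateness u u<β))
      where
      m≤c₂β : m ≤ c₂ * β
      m≤c₂β = ≤-trans (go β-large) (≤-reflexive (trans (sym (*-assoc (8 + κ) C β)) (cong (_* β) (sym c₂≡))))
        where
        go : 2 * g ≤ C * β ⊎ n ≤ C * β → m ≤ (8 + κ) * (C * β)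
        go (inj₁ le) = begin
          m  ≤⟨ m≤15g ⟩
          15 * g  ≤⟨ *-monoˡ-≤ g (n≤1+n 15) ⟩
          16 * g  ≡⟨ *-assoc 8 2 g ⟩
          8 * (2 * g)  ≤⟨ *-mono-≤ (m≤m+n 8 κ) le ⟩
          (8 + κ) * (C * β)  ∎
        go (inj₂ le) = begin
          m  ≤⟨ <⇒≤ m<nκ ⟩
          n * κ  ≡⟨ *-comm n κ ⟩
          κ * n  ≤⟨ *-mono-≤ (m≤n+m κ 8) le ⟩
          (8 + κ) * (C * β)  ∎
      m≤ : m ≤ c₂ * (suc u * c₃)
      m≤ = ≤-trans m≤c₂β (*-monoʳ-≤ c₂ β≤)
      big : 4 * (T * ρ) < u
      big = ≤-pred (≤-trans (≤-reflexive (cong suc (+-comm 1 (4 * (T * ρ))))) (*-cancelˡ-< (c₂ * c₃) _ _ (begin-strict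
        c₂ * c₃ * (4 * (T * ρ) + 1)  ≤⟨ m≤n+m _ (16 * R + 16) ⟩
        16 * R + 16 + c₂ * c₃ * (4 * (T * ρ) + 1) ≡⟨ threshold≡ ⟨
        threshold  <⟨ m-large ⟩
        m  ≤⟨ m≤ ⟩
        c₂ * (suc u * c₃)  ≡⟨ lem c₂ c₃ (suc u) ⟩
        c₂ * c₃ * suc u  ∎)))
        where
        lem : ∀ x y z → x * (z * y) ≡ x * y * z
        lem = solve-∀
      u>0 : 0 < u
      u>0 = ≤-trans (s≤s z≤n) big
      u<β : u < β
      u<β = <-≤-trans (≤-<-trans (≤-reflexive (sym (*-identityʳ u)))
        (*-monoʳ-< u {{>-nonZero u>0}} (subst (1 <_) (sym c₃≡) (s≤s (*-mono-≤ (*-mono-≤ {1} {32} (s≤s z≤n) C>0) K>0))))) uc₃≤β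
    -- Only an initial fraction 1/c₃ of `bs` supplies the columns; the elements of `bs` beyond it
    -- make the bound on `late u` small.
    β/c₃ : ∃[ u ] u * c₃ ≤ β × β ≤ suc u * c₃
    β/c₃ = β / c₃ , ≤-trans (m≤n+m (β / c₃ * c₃) _) (≤-reflexive (sym (m≡m%n+[m/n]*n β c₃)))
      , ≤-trans (≤-reflexive (m≡m%n+[m/n]*n β c₃)) (+-monoˡ-≤ (β / c₃ * c₃) (<⇒≤ (m%n<n β c₃)))
      where
      instance
        c₃≢0 : NonZero c₃
        c₃≢0 = >-nonZero c₃>0
    by : Dec (n * κ ≤ m) → Balanced P K
    by (yes sp) = sparse sp
    by (no ds) = dense (≰⇒> ds) (proj₁ β/c₃) (proj₁ (proj₂ β/c₃)) (proj₂ (proj₂ β/c₃))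

-- Lines in convex sets

sum-mono : ∀ {d} {x y : Pt d} → x ≤ᵖ y → sum x ≤ sum y
sum-mono [] = z≤n
sum-mono (p ∷ ps) = +-mono-≤ p (sum-mono ps)

sum-≡ : ∀ {d} {x y : Pt d} → x ≤ᵖ y → sum y ≤ sum x → x ≡ y
sum-≡ [] _ = refl
sum-≡ {x = a ∷ x} {b ∷ y} (p ∷ ps) le with m≤n⇒m<n∨m≡n p
... | inj₁ lt = contradiction le (<⇒≱ (+-mono-<-≤ lt (sum-mono ps)))
... | inj₂ refl = cong (a ∷_) (sum-≡ ps (+-cancelˡ-≤ a _ _ le))

sum-strict : ∀ {d} {x y : Pt d} → x <ᵖ y → sum x < sum y
sum-strict (le , ne) = ≰⇒> (λ ge → ne (sum-≡ le ge))

sum-bound : ∀ {d} (x y : Pt d) t → (∀ l → lookup y l ≤ lookup x l + t) → sum y ≤ sum x + d * t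
sum-bound [] [] t _ = z≤n
sum-bound {suc d} (a ∷ x) (b ∷ y) t le =
  ≤-trans (+-mono-≤ (le zero) (sum-bound x y t (λ l → le (suc l)))) (≤-reflexive (+-interchange a t (sum x) (d * t)))

≤ᵖ-ext : ∀ {d} {x y : Pt d} → (∀ l → lookup x l ≤ lookup y l) → x ≤ᵖ y
≤ᵖ-ext {x = []} {[]} _ = []
≤ᵖ-ext {x = a ∷ x} {b ∷ y} le = le zero ∷ ≤ᵖ-ext (λ l → le (suc l))

≡-ext : ∀ {d} {x y : Pt d} → (∀ l → lookup x l ≡ lookup y l) → x ≡ y
≡-ext eq = ≤ᵖ-antisym (≤ᵖ-ext (λ l → ≤-reflexive (eq l))) (≤ᵖ-ext (λ l → ≤-reflexive (sym (eq l))))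

line-arith : ∀ w d L b → 0 < L → w * suc (d * (b * L + w)) ≤ w * suc (d * (b + w)) * L
line-arith w d L b L>0 = ≤-trans
    (*-monoʳ-≤ w (+-mono-≤ L>0 (*-monoʳ-≤ d (+-monoʳ-≤ (b * L) (m≤m*n w L {{>-nonZero L>0}})))))
    (≤-reflexive (lem w L d b))
  where
  lem : ∀ w L d b → w * (L + d * (b * L + w * L)) ≡ w * suc (d * (b + w)) * L
  lem = solve-∀

filter-split : ∀ {A : Set} {Q : A → Set} (Q? : ∀ x → Dec (Q x)) (xs : List A) →
  length (filter Q? xs) + length (filter (λ x → ¬? (Q? x)) xs) ≡ length xs
filter-split Q? [] = refl
filter-split Q? (x ∷ xs) with Q? x
... | yes _ = cong suc (filter-split Q? xs)
... | no _ = trans (+-suc _ _) (cong suc (filter-split Q? xs))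

module _ {d : ℕ} where

  at : (x : Pt d) (k : Fin d) (v : ℕ) → lookup (x [ k ]≔ v) k ≡ v
  at x k v = VecP.lookup∘update k x v

  off : ∀ {l k : Fin d} (x : Pt d) (v : ℕ) → l ≢ k → lookup (x [ k ]≔ v) l ≡ lookup x l
  off x v l≢k = VecP.lookup∘update′ l≢k x v

  ≤-set : ∀ {x y : Pt d} {k v} → lookup x k ≤ v → (∀ l → l ≢ k → lookup x l ≤ lookup y l) → x ≤ᵖ (y [ k ]≔ v)
  ≤-set {x} {y} {k} {v} p ps = ≤ᵖ-ext by
    where
    by : ∀ l → lookup x l ≤ lookup (y [ k ]≔ v) l
    by l with l Fin.≟ k
    ... | yes refl = ≤-trans p (≤-reflexive (sym (at y k v)))
    ... | no n = ≤-trans (ps l n) (≤-reflexive (sym (off y v n)))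

  set-≤ : ∀ {x y : Pt d} {k v} → v ≤ lookup y k → (∀ l → l ≢ k → lookup x l ≤ lookup y l) → (x [ k ]≔ v) ≤ᵖ y
  set-≤ {x} {y} {k} {v} p ps = ≤ᵖ-ext by
    where
    by : ∀ l → lookup (x [ k ]≔ v) l ≤ lookup y l
    by l with l Fin.≟ k
    ... | yes refl = ≤-trans (≤-reflexive (at x k v)) p
    ... | no n = ≤-trans (≤-reflexive (off x v n)) (ps l n)

  -- Lying on a common line in direction `k`. Stated as an equation of points, the relation is
  -- decidable and composes by `trans`.
  _∼[_]_ : Pt d → Fin d → Pt d → Set
  x ∼[ k ] y = x [ k ]≔ 0 ≡ y [ k ]≔ 0

  ∼-off : ∀ {x y k l} → x ∼[ k ] y → l ≢ k → lookup x l ≡ lookup y l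
  ∼-off {x} {y} {k} {l} e n = trans (sym (off x 0 n)) (trans (cong (λ z → lookup z l) e) (off y 0 n))

  ∼-set : ∀ {k} (x : Pt d) v → (x [ k ]≔ v) ∼[ k ] x
  ∼-set {k} x v = VecP.[]≔-idempotent x k

  ∼-≤ : ∀ {x y k} → x ∼[ k ] y → lookup x k ≤ lookup y k → x ≤ᵖ y
  ∼-≤ {x} {y} {k} e le = ≤ᵖ-ext by
    where
    by : ∀ l → lookup x l ≤ lookup y l
    by l with l Fin.≟ k
    ... | yes refl = le
    ... | no n = ≤-reflexive (∼-off e n)

  flatten-mono : ∀ {x y : Pt d} {k} → x ≤ᵖ y → (x [ k ]≔ 0) ≤ᵖ (y [ k ]≔ 0)
  flatten-mono {x} {y} {k} le = set-≤ z≤n (λ l n → ≤-trans (PW.lookup le l) (≤-reflexive (sym (off y 0 n))))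

  down : List (Pt d) → Pt d → List (Pt d)
  down P a = filter (_≤ᵖ? a) P

  IsLineIdeal : List (Pt d) → Pt d → Fin d → Set
  IsLineIdeal P a k = All (λ z → z ≤ᵖ a → z ∼[ k ] a) P

  isLineIdeal? : ∀ P a k → Dec (IsLineIdeal P a k)
  isLineIdeal? P a k = All.all? (λ z → (z ≤ᵖ? a) →-dec ((z [ k ]≔ 0) ≟ᵖ (a [ k ]≔ 0))) P

  convex-≤ : ∀ {P : List (Pt d)} → Convex P → ∀ {x y z} → x ∈ P → z ∈ P → x ≤ᵖ y → y ≤ᵖ z → y ∈ P
  convex-≤ cvx {x} {y} {z} x∈ z∈ xy yz with x ≟ᵖ y | y ≟ᵖ z
  ... | yes refl | _ = x∈
  ... | no _ | yes refl = z∈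
  ... | no n | no n′ = cvx x y z x∈ z∈ (xy , n) (yz , n′)

  module _ {P : List (Pt d)} (uP : Unique P) {w : ℕ} (narrow : ∀ A → IsAntichain P A → length A ≤ w) where

    -- Removing the maximal elements, at most w of them, shortens all chains.
    long-chain : ∀ h (Q : List (Pt d)) → Unique Q → (∀ {x} → x ∈ Q → x ∈ P) → w * h < length Q →
      ∃[ x ] ∃[ z ] x ∈ Q × z ∈ Q × x ≤ᵖ z × sum x + h ≤ sum z
    long-chain zero (x ∷ Q) _ _ _ = x , x , here refl , here refl , ≤ᵖ-refl , ≤-reflexive (+-identityʳ _)
    long-chain zero [] _ _ lt = contradiction lt λ ()
    long-chain (suc h) Q uQ sub lt with long-chain h lower (UniqueP.filter⁺ _ uQ) (λ m → sub (lower-∈ m)) lower-large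
      where
      maximal? : ∀ x → Dec (All (λ z → ¬ (x <ᵖ z)) Q)
      maximal? x = All.all? (λ z → ¬? (x <ᵖ? z)) Q
      lower top : List (Pt d)
      lower = filter (λ x → ¬? (maximal? x)) Q
      top = filter maximal? Q
      lower-∈ : ∀ {x} → x ∈ lower → x ∈ Q
      lower-∈ m = proj₁ (∈-filter⁻ (λ x → ¬? (maximal? x)) {xs = Q} m)
      incomparable : ∀ T → Unique T → (∀ {x} → x ∈ T → x ∈ top) → AllPairs (λ a b → ¬ (a ≤ᵖ b) × ¬ (b ≤ᵖ a)) T
      incomparable [] _ _ = []
      incomparable (t ∷ T) (n ∷ u) s = All.tabulate (λ {t′} m →
          (λ le → not-below t t′ (s (here refl)) (s (there m)) (le , All.lookup n m)) ,
          (λ le → not-below t′ t (s (there m)) (s (here refl)) (le , λ e → All.lookup n m (sym e))))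
        ∷ incomparable T u (λ m → s (there m))
        where
        not-below : ∀ x y → x ∈ top → y ∈ top → ¬ (x <ᵖ y)
        not-below x y mx my = All.lookup (proj₂ (∈-filter⁻ maximal? {xs = Q} mx)) (proj₁ (∈-filter⁻ maximal? {xs = Q} my))
      top≤w : length top ≤ w
      top≤w = narrow top ((λ m → sub (proj₁ (∈-filter⁻ maximal? {xs = Q} m)))
        , incomparable top (UniqueP.filter⁺ maximal? uQ) (λ m → m))
      lower-large : w * h < length lower
      lower-large = +-cancelˡ-< w _ _ (<-≤-trans (≤-<-trans (≤-reflexive (sym (*-suc w h))) lt)
        (≤-trans (≤-reflexive (sym (filter-split maximal? Q))) (+-monoˡ-≤ (length lower) top≤w)))
    ... | x , z , x∈ , z∈ , x≤z , gap with find (AllP.¬All⇒Any¬ (λ z′ → ¬? (z <ᵖ? z′)) Q (proj₂ (∈-filter⁻ (λ x → ¬? (All.all? (λ z → ¬? (x <ᵖ? z)) Q)) {xs = Q} z∈)))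
    ...   | z′ , z′∈ , nn = x , z′ , proj₁ (∈-filter⁻ (λ x → ¬? (All.all? (λ z → ¬? (x <ᵖ? z)) Q)) {xs = Q} x∈) , z′∈
        , ≤ᵖ-trans x≤z (proj₁ z<z′) , ≤-trans (≤-reflexive (+-suc (sum x) h)) (≤-trans (s≤s gap) (sum-strict z<z′))
      where
      z<z′ : z <ᵖ z′
      z<z′ = decidable-stable (z <ᵖ? z′) nn

    module Walk (cvx : Convex P) {x z : Pt d} (x∈ : x ∈ P) (z∈ : z ∈ P) (x≤z : x ≤ᵖ z) (k : Fin d) (L : ℕ) where

      σ : Pt d → ℕ
      σ y = sum (y [ k ]≔ 0)

      line : ℕ → Pt d
      line v = x [ k ]≔ v

      line-≤ : ∀ {v v′} → v ≤ v′ → line v ≤ᵖ line v′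
      line-≤ {v} {v′} le = set-≤ (≤-trans le (≤-reflexive (sym (at x k v′)))) (λ l n → ≤-reflexive (sym (off x v′ n)))

      line≤z : ∀ {v} → v ≤ lookup z k → line v ≤ᵖ z
      line≤z le = set-≤ le (λ l _ → PW.lookup x≤z l)

      -- Otherwise p, x and the part of the line above v span a box with a large antichain.
      deep : ∀ {p v} → p ∈ P → p ≤ᵖ line v → v + w ≤ lookup z k → σ x ≤ σ p + d * w
      deep {p} {v} p∈ p≤ room = sum-bound (p [ k ]≔ 0) (x [ k ]≔ 0) w close
        where
        close : ∀ l → lookup (x [ k ]≔ 0) l ≤ lookup (p [ k ]≔ 0) l + w
        close l with l Fin.≟ k
        ... | yes refl = ≤-trans (≤-reflexive (at x k 0)) z≤n
        ... | no l≢k = ≤-trans (≤-reflexive (off x 0 l≢k)) (≤-trans (≮⇒≥ far) (≤-reflexive (cong (_+ w) (sym (off p 0 l≢k)))))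
          where
          far : ¬ (lookup p l + w < lookup x l)
          far lt = <⇒≱ ≤-refl (subst (_≤ w) (ListP.length-applyDownFrom y (suc w)) (narrow (applyDownFrom y (suc w))
              (members , AllPairsP.applyDownFrom⁺₁ y (suc w) (λ j<i i<w → incomparable j<i (≤-pred i<w)))))
            where
            k≢l : k ≢ l
            k≢l e = l≢k (sym e)
            y : ℕ → Pt d
            y r = (line (v + r)) [ l ]≔ (lookup x l ∸ r)
            y-k : ∀ r → lookup (y r) k ≡ v + r
            y-k r = trans (off (line (v + r)) _ k≢l) (at x k (v + r))
            y-l : ∀ r → lookup (y r) l ≡ lookup x l ∸ r
            y-l r = at (line (v + r)) l _
            w≤ : w ≤ lookup x l
            w≤ = ≤-trans (m≤n+m w (lookup p l)) (<⇒≤ lt)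
            in-box : ∀ {r} → r ≤ w → p ≤ᵖ y r × y r ≤ᵖ z
            in-box {r} r≤w = ≤-set (m+n≤o⇒m≤o∸n (lookup p l) (≤-trans (+-monoʳ-≤ _ r≤w) (<⇒≤ lt)))
                (λ i i≢l → ≤-trans (PW.lookup p≤ i) (PW.lookup (line-≤ (m≤m+n v r)) i))
              , set-≤ (≤-trans (m∸n≤m _ r) (PW.lookup x≤z l))
                (λ i _ → PW.lookup (line≤z (≤-trans (+-monoʳ-≤ v r≤w) room)) i)
            members : ∀ {a} → a ∈ applyDownFrom y (suc w) → a ∈ P
            members m with ∈-applyDownFrom⁻ y m
            ... | r , r<w , refl = convex-≤ cvx p∈ z∈ (proj₁ (in-box (≤-pred r<w))) (proj₂ (in-box (≤-pred r<w)))
            incomparable : ∀ {i j} → j < i → i ≤ w → ¬ (y i ≤ᵖ y j) × ¬ (y j ≤ᵖ y i)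
            incomparable {i} {j} j<i i≤w =
                (λ le → <⇒≱ (+-monoʳ-< v j<i) (subst₂ _≤_ (y-k i) (y-k j) (PW.lookup le k)))
              , (λ le → <⇒≱ (∸-monoʳ-< j<i (≤-trans i≤w w≤)) (subst₂ _≤_ (y-l j) (y-l i) (PW.lookup le l)))

      -- The potential σ is the coordinate sum off `k`. If nothing in `P` below `line (v + L)` has
      -- smaller σ than `p`, then the point over `p` at height `v + L` heads a line ideal containing
      -- the `L + 1` points above `p`. Otherwise descend to such an element and continue `L` higher;
      -- by `deep` this happens at most `d * w` times.
      walk : ∀ t v p → p ∈ P → p ≤ᵖ line v → v + t * L + w ≤ lookup z k → σ p + suc (d * w) ≤ σ x + t →
        ∃[ a ] a ∈ P × IsLineIdeal P a k × L < length (down P a)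
      walk zero v p p∈ p≤ room low = contradiction (deep p∈ p≤ (≤-trans (+-monoˡ-≤ w (≤-reflexive (sym (+-identityʳ v)))) room))
        (<⇒≱ (<-≤-trans (+-monoʳ-< (σ p) ≤-refl) (≤-trans low (≤-reflexive (+-identityʳ _)))))
      walk (suc t) v p p∈ p≤ room low with Any.any? (λ q → (q ≤ᵖ? line (v + L)) ×-dec (σ q <? σ p)) P
      ... | yes some with find some
      ...   | q , q∈ , q≤ , lt = walk t (v + L) q q∈ q≤ (≤-trans (≤-reflexive (cong (_+ w) (+-assoc v L (t * L)))) room)
                (≤-pred (≤-trans (+-monoˡ-≤ (suc (d * w)) lt) (≤-trans low (≤-reflexive (+-suc (σ x) t)))))
      walk (suc t) v p p∈ p≤ room low | no none = a , a∈ , ideal , size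
        where
        a : Pt d
        a = p [ k ]≔ (v + L)
        pk≤v : lookup p k ≤ v
        pk≤v = ≤-trans (PW.lookup p≤ k) (≤-reflexive (at x k v))
        top : v + L ≤ lookup z k
        top = ≤-trans (+-monoʳ-≤ v (m≤m+n L (t * L))) (≤-trans (m≤m+n _ w) room)
        above : ∀ {i} → i ≤ L → p ≤ᵖ (p [ k ]≔ (v + i)) × (p [ k ]≔ (v + i)) ≤ᵖ line (v + L)
        above {i} i≤L = ≤-set (≤-trans pk≤v (m≤m+n v i)) (λ _ _ → ≤-refl)
          , set-≤ (≤-trans (+-monoʳ-≤ v i≤L) (≤-reflexive (sym (at x k (v + L)))))
              (λ l n → ≤-trans (PW.lookup p≤ l) (≤-reflexive (trans (off x v n) (sym (off x (v + L) n)))))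
        on-line-∈ : ∀ {i} → i ≤ L → p [ k ]≔ (v + i) ∈ P
        on-line-∈ i≤L = convex-≤ cvx p∈ z∈ (proj₁ (above i≤L)) (≤ᵖ-trans (proj₂ (above i≤L)) (line≤z top))
        a∈ : a ∈ P
        a∈ = on-line-∈ ≤-refl
        ideal : IsLineIdeal P a k
        ideal = All.tabulate λ {q} q∈ q≤a → sum-≡ (flatten-mono q≤a)
          (≤-trans (≤-reflexive (cong sum (∼-set p (v + L)))) (≮⇒≥ λ lt → none (Any.map (λ { refl → ≤ᵖ-trans q≤a (proj₂ (above ≤-refl)) , lt }) q∈)))
        size : L < length (down P a)
        size = subst (_≤ length (down P a)) (ListP.length-applyDownFrom (λ i → p [ k ]≔ (v + i)) (suc L)) (length-⊆
          (UniqueP.applyDownFrom⁺₁ (λ i → p [ k ]≔ (v + i)) (suc L) λ {i} {j} j<i _ e →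
            <⇒≢ j<i (+-cancelˡ-≡ v _ _ (trans (sym (at p k (v + j))) (trans (cong (λ u → lookup u k) (sym e)) (at p k (v + i))))))
          on-line-down)
          where
          on-line-down : ∀ {y} → y ∈ applyDownFrom (λ i → p [ k ]≔ (v + i)) (suc L) → y ∈ down P a
          on-line-down m with ∈-applyDownFrom⁻ (λ i → p [ k ]≔ (v + i)) m
          ... | i , i<L , refl = ∈-filter⁺ (_≤ᵖ? a) (on-line-∈ (≤-pred i<L))
            (∼-≤ (trans (∼-set p (v + i)) (sym (∼-set p (v + L)))) (≤-trans (≤-reflexive (at p k (v + i)))
              (≤-trans (+-monoʳ-≤ v (≤-pred i<L)) (≤-reflexive (sym (at p k (v + L)))))))

    -- A long chain raises the coordinate sum by more than d * s, so some coordinate grows by more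
    -- than s. This leaves height for `suc (d * w)` stages of `L` each, and a margin of `w` for the
    -- antichain in `deep`.
    long-line-ideal : Convex P → ∀ L → w * suc (d * (suc (d * w) * L + w)) < length P →
      ∃[ a ] ∃[ k ] a ∈ P × IsLineIdeal P a k × L < length (down P a)
    long-line-ideal cvx L big with long-chain (suc (d * (suc (d * w) * L + w))) P uP (λ m → m) big
    ... | x , z , x∈ , z∈ , x≤z , gap with Fin.¬∀⟶∃¬ d (λ l → lookup z l ≤ lookup x l + s) (λ l → lookup z l ≤? lookup x l + s)
          (λ all → <⇒≱ (≤-trans (≤-reflexive (sym (+-suc (sum x) (d * s)))) gap) (sum-bound x z s all))
        where
        s = suc (d * w) * L + w
    ...   | k , far with Walk.walk cvx x∈ z∈ x≤z k L (suc (d * w)) (lookup x k) x x∈ (≤-set ≤-refl (λ _ _ → ≤-refl))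
              (≤-trans (≤-reflexive (+-assoc (lookup x k) (suc (d * w) * L) w)) (<⇒≤ (≰⇒> far))) ≤-refl
    ...     | a , a∈ , ideal , size = a , k , a∈ , ideal , size

    -- Maximal line ideals

    record MaximalLineIdeal : Set where
      field
        a : Pt d
        k : Fin d
        a∈ : a ∈ P
        ideal : IsLineIdeal P a k
        maximal : ∀ a′ k′ → a′ ∈ P → IsLineIdeal P a′ k′ → length (down P a′) ≤ length (down P a)

    private
      climb : ∀ t a k → a ∈ P → IsLineIdeal P a k → length P ≤ length (down P a) + t → MaximalLineIdeal
      climb t a k a∈ ideal le with Any.any? (λ a′ → Fin.any? (λ k′ → isLineIdeal? P a′ k′ ×-dec (length (down P a) <? length (down P a′)))) P
      ... | no none = record { a = a ; k = k ; a∈ = a∈ ; ideal = ideal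
        ; maximal = λ a′ k′ a′∈ i → ≮⇒≥ (λ lt → none (Any.map (λ { refl → k′ , i , lt }) a′∈)) }
      climb t a k a∈ ideal le | yes some with find some
      climb zero a k a∈ ideal le | yes some | a′ , a′∈ , k′ , i , lt =
        contradiction (ListP.length-filter (_≤ᵖ? a′) P) (<⇒≱ (≤-<-trans (≤-trans le (≤-reflexive (+-identityʳ _))) lt))
      climb (suc t) a k a∈ ideal le | yes some | a′ , a′∈ , k′ , i , lt =
        climb t a′ k′ a′∈ i (≤-trans le (≤-trans (≤-reflexive (+-suc _ t)) (+-monoˡ-≤ t lt)))

      lowest : ∀ (Q : List (Pt d)) → Q ≢ [] → ∃[ a ] a ∈ Q × All (λ z → sum a ≤ sum z) Q
      lowest [] ne = contradiction refl ne
      lowest (q ∷ []) _ = q , here refl , ≤-refl ∷ []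
      lowest (q ∷ q′ ∷ Q) _ with lowest (q′ ∷ Q) (λ ())
      ... | a , a∈ , low with ≤-total (sum a) (sum q)
      ...   | inj₁ le = a , there a∈ , le ∷ low
      ...   | inj₂ ge = q , here refl , ≤-refl ∷ All.map (≤-trans ge) low

    -- A point of least coordinate sum has nothing else below it, so it heads a line ideal in every
    -- direction; larger ones are chosen until none exists.
    maximalLineIdeal : Fin d → P ≢ [] → MaximalLineIdeal
    maximalLineIdeal k ne with lowest P ne
    ... | a , a∈ , low = climb (length P) a k a∈
      (All.map (λ le z≤a → cong (_[ k ]≔ 0) (sum-≡ z≤a le)) low) (m≤n+m _ _)

    line-constant : ℕ
    line-constant = w * suc (d * (suc (d * w) + w))

    ideal-size : Convex P → (I : MaximalLineIdeal) → length P ≤ line-constant * length (down P (MaximalLineIdeal.a I))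
    ideal-size cvx I = ≤-trans (≮⇒≥ too-long) bound
      where
      open MaximalLineIdeal I
      L = length (down P a)
      too-long : ¬ (w * suc (d * (suc (d * w) * L + w)) < length P)
      too-long lt = clash (long-line-ideal cvx L lt)
        where
        clash : ¬ (∃[ a′ ] ∃[ k′ ] a′ ∈ P × IsLineIdeal P a′ k′ × L < length (down P a′))
        clash (a′ , k′ , a′∈ , i , L<) = <⇒≱ L< (maximal a′ k′ a′∈ i)
      L>0 : 0 < L
      L>0 = ∈⇒nonempty (∈-filter⁺ (_≤ᵖ? a) a∈ ≤ᵖ-refl)
      bound : w * suc (d * (suc (d * w) * L + w)) ≤ line-constant * L
      bound = line-arith w d L (suc (d * w)) L>0

-- Extracting the two chains

module _ {d : ℕ} where

  private
    module Sort = Data.List.Sort (On.decTotalOrder ≤-decTotalOrder (sum {n = d}))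

  sort-by-sum : (xs : List (Pt d)) → ∃[ ys ] ys ↭ xs × AllPairs (λ x y → sum x ≤ sum y) ys
  sort-by-sum xs = Sort.sort xs , Sort.sort-↭ xs , Linked⇒AllPairs ≤-trans (Sort.sort-↗ xs)

  sort-chain : (xs : List (Pt d)) → Unique xs → (∀ {x y} → x ∈ xs → y ∈ xs → x ≤ᵖ y ⊎ y ≤ᵖ x) →
    ∃[ ys ] ys ↭ xs × AllPairs _<ᵖ_ ys
  sort-chain xs u cmp with sort-by-sum xs
  ... | ys , p , srt = ys , p , go ys (Unique-resp-↭ (↭-sym p) u) srt (∈-resp-↭ p)
    where
    go : ∀ ys → Unique ys → AllPairs (λ x y → sum x ≤ sum y) ys → (∀ {y} → y ∈ ys → y ∈ xs) → AllPairs _<ᵖ_ ys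
    go [] _ _ _ = []
    go (y ∷ ys) (n ∷ u) (s ∷ ss) sub = All.tabulate (λ m → smaller m (cmp (sub (here refl)) (sub (there m)))) ∷ go ys u ss (λ m → sub (there m))
      where
      smaller : ∀ {y′} → y′ ∈ ys → y ≤ᵖ y′ ⊎ y′ ≤ᵖ y → y <ᵖ y′
      smaller m (inj₁ le) = le , All.lookup n m
      smaller m (inj₂ ge) = contradiction (sym (sum-≡ ge (All.lookup s m))) (All.lookup n m)

  linExts-nonempty : {P : List (Pt d)} → 0 < length (linExts P)
  linExts-nonempty {P} with sort-by-sum P
  ... | ys , p , srt = ∈⇒nonempty (linExts⇐ p (AllPairs.map (λ le lt → <⇒≱ (sum-strict lt) le) srt))

  ideal-comparable : ∀ {P : List (Pt d)} {a k} → IsLineIdeal P a k → ∀ {x y} → x ∈ down P a → y ∈ down P a → x ≤ᵖ y ⊎ y ≤ᵖ x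
  ideal-comparable {P} {a} {k} ideal {x} {y} mx my with ∈-filter⁻ (_≤ᵖ? a) {xs = P} mx | ∈-filter⁻ (_≤ᵖ? a) {xs = P} my
  ... | x∈ , x≤ | y∈ , y≤ with ≤-total (lookup x k) (lookup y k)
  ...   | inj₁ le = inj₁ (∼-≤ (trans (All.lookup ideal x∈ x≤) (sym (All.lookup ideal y∈ y≤))) le)
  ...   | inj₂ ge = inj₂ (∼-≤ (trans (All.lookup ideal y∈ y≤) (sym (All.lookup ideal x∈ x≤))) ge)

  module Decompose {P : List (Pt d)} (uP : Unique P) {w : ℕ} (narrow : ∀ A → IsAntichain P A → length A ≤ w)
    (cvx : Convex P) (I : MaximalLineIdeal uP narrow) where
    open MaximalLineIdeal I

    A = down P a

    as-sort = sort-chain A (UniqueP.filter⁺ (_≤ᵖ? a) uP) (ideal-comparable ideal)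
    as = proj₁ as-sort

    as↭ : as ↭ A
    as↭ = proj₁ (proj₂ as-sort)

    as-sorted : AllPairs _<ᵖ_ as
    as-sorted = proj₂ (proj₂ as-sort)

    as⇒ : ∀ {x} → x ∈ as → x ∈ P × x ≤ᵖ a
    as⇒ m = ∈-filter⁻ (_≤ᵖ? a) {xs = P} (∈-resp-↭ as↭ m)

    as⇐ : ∀ {x} → x ∈ P → x ≤ᵖ a → x ∈ as
    as⇐ m le = ∈-resp-↭ (↭-sym as↭) (∈-filter⁺ (_≤ᵖ? a) m le)

    as-line : ∀ {x} → x ∈ as → x ∼[ k ] a
    as-line m = All.lookup ideal (proj₁ (as⇒ m)) (proj₂ (as⇒ m))

    Q = filter (λ x → ¬? (x ≤ᵖ? a)) P

    Q⇒ : ∀ {x} → x ∈ Q → x ∈ P × ¬ (x ≤ᵖ a)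
    Q⇒ = ∈-filter⁻ (λ x → ¬? (x ≤ᵖ? a)) {xs = P}

    Q⇐ : ∀ {x} → x ∈ P → ¬ (x ≤ᵖ a) → x ∈ Q
    Q⇐ = ∈-filter⁺ (λ x → ¬? (x ≤ᵖ? a))

    uQ : Unique Q
    uQ = UniqueP.filter⁺ (λ x → ¬? (x ≤ᵖ? a)) uP

    module Cut (as₁ : List (Pt d)) (c : Pt d) (as₂ : List (Pt d)) (as≡ : as ≡ as₁ ++ c ∷ as₂) where

      c∈ : c ∈ as
      c∈ = subst (c ∈_) (sym as≡) (∈-++⁺ʳ as₁ (here refl))

      -- Being a down-set of `Q`, it has line ideals that are initial in `Q` as well; and no element
      -- of `as` from `c` on is below any of its elements, as `not-above-cut` demands.
      N = filter (λ q → ¬? (c ≤ᵖ? q)) Q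

      N⇒ : ∀ {x} → x ∈ N → x ∈ Q × ¬ (c ≤ᵖ x)
      N⇒ = ∈-filter⁻ (λ q → ¬? (c ≤ᵖ? q)) {xs = Q}

      N⇐ : ∀ {x} → x ∈ Q → ¬ (c ≤ᵖ x) → x ∈ N
      N⇐ = ∈-filter⁺ (λ q → ¬? (c ≤ᵖ? q))

      uN : Unique N
      uN = UniqueP.filter⁺ (λ q → ¬? (c ≤ᵖ? q)) uQ

      N-P : ∀ {x} → x ∈ N → x ∈ P
      N-P m = proj₁ (Q⇒ (proj₁ (N⇒ m)))

      N-narrow : ∀ B → IsAntichain N B → length B ≤ w
      N-narrow B (sub , anti) = narrow B ((λ m → N-P (sub m)) , anti)

      N-convex : Convex N
      N-convex x y z mx mz xy yz = N⇐ (Q⇐ (cvx x y z (N-P mx) (N-P mz) xy yz)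
          (λ le → proj₂ (Q⇒ (proj₁ (N⇒ mx))) (≤ᵖ-trans (proj₁ xy) le)))
        (λ le → proj₂ (N⇒ mz) (≤ᵖ-trans le (proj₁ yz)))

      -- If some q above c is off the line of as, then N contains a translate of as₁;
      -- otherwise every y above c lies on that line, and maximality of as gives a neighbour of y in N.
      N-large : length as₁ ≤ length N ⊎ length Q ≤ 2 * length N
      N-large = by (Any.any? (λ q → (c ≤ᵖ? q) ×-dec ¬? ((q [ k ]≔ 0) ≟ᵖ (a [ k ]≔ 0))) Q)
        where
        by : Dec (Any (λ q → c ≤ᵖ q × ¬ (q ∼[ k ] a)) Q) → _
        by (yes some) with find some
        ... | q , q∈ , c≤q , off-line with Fin.¬∀⟶∃¬ d (λ l → lookup (q [ k ]≔ 0) l ≡ lookup (a [ k ]≔ 0) l)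
              (λ l → lookup (q [ k ]≔ 0) l ℕP.≟ lookup (a [ k ]≔ 0) l) (λ all → off-line (≡-ext all))
        ...   | l , differ = inj₁ (subst (_≤ length N) (ListP.length-map lift as₁) (length-⊆ shifted-unique shifted))
          where
          -- In direction `l` the point `q` is above the line of `as`. Raising coordinate `l` of
          -- some x in `as₁` to one more than that of `a` stays between x and `q`, hence in `P`; it
          -- leaves the down-set of `a`, and coordinate `k` still keeps it from being above `c`.
          l≢k : l ≢ k
          l≢k refl = differ (trans (at q k 0) (sym (at a k 0)))
          lift : Pt d → Pt d
          lift x = x [ l ]≔ suc (lookup a l)
          a<q : lookup a l < lookup q l
          a<q = ≤∧≢⇒< (≤-trans (≤-reflexive (sym (∼-off (as-line c∈) l≢k))) (PW.lookup c≤q l))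
            (λ e → differ (trans (off q 0 l≢k) (trans (sym e) (sym (off a 0 l≢k)))))
          as₁∈ : ∀ {x} → x ∈ as₁ → x ∈ as
          as₁∈ m = subst (_ ∈_) (sym as≡) (∈-++⁺ˡ m)
          below-c : ∀ {x} → x ∈ as₁ → x <ᵖ c
          below-c m = AllPairs-++ as₁ (subst (AllPairs _<ᵖ_) as≡ as-sorted) m (here refl)
          shift-N : ∀ {x} → x ∈ as₁ → lift x ∈ N
          shift-N {x} m = N⇐ (Q⇐ (convex-≤ cvx (proj₁ (as⇒ (as₁∈ m))) (proj₁ (Q⇒ q∈)) x≤ ≤q)
              (λ le → <⇒≱ ≤-refl (≤-trans (≤-reflexive (sym (at x l _))) (PW.lookup le l))))
            (λ le → proj₂ (below-c m) (≤ᵖ-antisym (proj₁ (below-c m))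
              (∼-≤ (trans (as-line c∈) (sym (as-line (as₁∈ m)))) (≤-trans (PW.lookup le k) (≤-reflexive (off x _ (λ e → l≢k (sym e))))))))
            where
            x≤ : x ≤ᵖ lift x
            x≤ = ≤-set (≤-trans (≤-reflexive (∼-off (as-line (as₁∈ m)) l≢k)) (n≤1+n _)) (λ _ _ → ≤-refl)
            ≤q : lift x ≤ᵖ q
            ≤q = set-≤ a<q (λ i _ → PW.lookup (≤ᵖ-trans (proj₁ (below-c m)) c≤q) i)
          shifted : ∀ {y} → y ∈ map lift as₁ → y ∈ N
          shifted m with ∈-map⁻ lift m
          ... | x , x∈ , refl = shift-N x∈
          shifted-unique : Unique (map lift as₁)
          shifted-unique = Unique-map lift same (Unique-++ˡ as₁ (subst Unique as≡ (AllPairs.map proj₂ as-sorted)))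
            where
            same : ∀ {x y} → x ∈ as₁ → y ∈ as₁ → lift x ≡ lift y → x ≡ y
            same {x} {y} mx my e = ≡-ext λ i → pick i (i Fin.≟ l)
              where
              pick : ∀ i → Dec (i ≡ l) → lookup x i ≡ lookup y i
              pick i (yes refl) = trans (∼-off (as-line (as₁∈ mx)) l≢k) (sym (∼-off (as-line (as₁∈ my)) l≢k))
              pick i (no n) = trans (sym (off x _ n)) (trans (cong (λ z → lookup z i) e) (off y _ n))
        by (no none) = inj₂ (begin
            length Q  ≡⟨ filter-split (c ≤ᵖ?_) Q ⟨
            length Y + length N  ≤⟨ +-monoˡ-≤ (length N) Y≤N ⟩
            length N + length N  ≡⟨ cong (length N +_) (+-identityʳ _) ⟨
            2 * length N  ∎)
          where
          open ≤-Reasoning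
          Y = filter (c ≤ᵖ?_) Q
          onto : Pt d → Pt d
          onto v = a [ k ]≔ lookup v k
          -- Here y lies on the line of `as`, above `a`. By maximality its down-set is not a line
          -- ideal, so some z below y is smaller in a coordinate `l` other than `k`. Lowering y by
          -- one in that coordinate gives a point between z and y that is not above `c`, and its
          -- coordinate `k` determines y.
          neighbour : ∀ {y} → y ∈ Y → y ∈ map onto N
          neighbour {y} m with ∈-filter⁻ (c ≤ᵖ?_) {xs = Q} m
          ... | y∈Q , c≤y with Q⇒ y∈Q
          ...   | y∈P , y≰a with find (AllP.¬All⇒Any¬ (λ z → (z ≤ᵖ? y) →-dec ((z [ k ]≔ 0) ≟ᵖ (y [ k ]≔ 0))) P not-ideal)
            where
            y-line : y ∼[ k ] a
            y-line = decidable-stable ((y [ k ]≔ 0) ≟ᵖ (a [ k ]≔ 0)) (λ n → none (Any.map (λ { refl → c≤y , n }) y∈Q))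
            a≤y : a ≤ᵖ y
            a≤y = ∼-≤ (sym y-line) (<⇒≤ (≰⇒> (λ le → y≰a (∼-≤ y-line le))))
            not-ideal : ¬ IsLineIdeal P y k
            not-ideal i = <⇒≱ (length-⊆ {xs = y ∷ A} {ys = down P y}
                (All.tabulate (λ m e → y≰a (subst (_≤ᵖ a) (sym e) (proj₂ (∈-filter⁻ (_≤ᵖ? a) {xs = P} m)))) ∷ UniqueP.filter⁺ (_≤ᵖ? a) uP)
                (λ { (here refl) → ∈-filter⁺ (_≤ᵖ? y) y∈P ≤ᵖ-refl
                   ; (there m) → let (p , le) = ∈-filter⁻ (_≤ᵖ? a) {xs = P} m in ∈-filter⁺ (_≤ᵖ? y) p (≤ᵖ-trans le a≤y) }))
              (maximal y k y∈P i)
          ...     | z , z∈ , off-line = subst (_∈ map onto N) (sym y≡) (∈-map⁺ onto v∈)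
            where
            y-line : y ∼[ k ] a
            y-line = decidable-stable ((y [ k ]≔ 0) ≟ᵖ (a [ k ]≔ 0)) (λ n → none (Any.map (λ { refl → c≤y , n }) y∈Q))
            z≤y : z ≤ᵖ y
            z≤y = decidable-stable (z ≤ᵖ? y) (λ n → off-line (λ le → contradiction le n))
            coordinate : ∃[ l ] ¬ (lookup (z [ k ]≔ 0) l ≡ lookup (y [ k ]≔ 0) l)
            coordinate = Fin.¬∀⟶∃¬ d _ (λ l → lookup (z [ k ]≔ 0) l ℕP.≟ lookup (y [ k ]≔ 0) l) (λ all → off-line (λ _ → ≡-ext all))
            l = proj₁ coordinate
            l≢k : l ≢ k
            l≢k e = proj₂ coordinate (trans (trans (cong (lookup (z [ k ]≔ 0)) e) (at z k 0)) (sym (trans (cong (lookup (y [ k ]≔ 0)) e) (at y k 0))))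
            zl<yl : lookup z l < lookup y l
            zl<yl = ≤∧≢⇒< (PW.lookup z≤y l) (λ e → proj₂ coordinate (trans (off z 0 l≢k) (trans e (sym (off y 0 l≢k)))))
            v : Pt d
            v = y [ l ]≔ (lookup y l ∸ 1)
            v-k : lookup v k ≡ lookup y k
            v-k = off y _ (λ e → l≢k (sym e))
            y≡ : y ≡ onto v
            y≡ = ≡-ext λ i → pick i (i Fin.≟ k)
              where
              pick : ∀ i → Dec (i ≡ k) → lookup y i ≡ lookup (onto v) i
              pick i (yes refl) = sym (trans (at a k _) v-k)
              pick i (no n) = trans (∼-off y-line n) (sym (off a _ n))
            v∈ : v ∈ N
            v∈ = N⇐ (Q⇐ (convex-≤ cvx z∈ y∈P (≤-set (m<n⇒m≤n∸1 zl<yl) (λ i _ → PW.lookup z≤y i)) (set-≤ (m∸n≤m _ 1) (λ _ _ → ≤-refl)))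
                (λ le → y≰a (∼-≤ y-line (≤-trans (≤-reflexive (sym v-k)) (PW.lookup le k)))))
              (λ le → <⇒≱ (subst (_< lookup y l) (sym (at y l _)) (pred-< zl<yl))
                (≤-trans (≤-reflexive (trans (∼-off y-line l≢k) (sym (∼-off (as-line c∈) l≢k)))) (PW.lookup le l)))
              where
              m<n⇒m≤n∸1 : ∀ {m n} → m < n → m ≤ n ∸ 1
              m<n⇒m≤n∸1 (s≤s p) = p
              pred-< : ∀ {m n} → m < n → n ∸ 1 < n
              pred-< (s≤s _) = ≤-refl
          Y≤N : length Y ≤ length N
          Y≤N = ≤-trans (length-⊆ (UniqueP.filter⁺ (c ≤ᵖ?_) uQ) neighbour) (≤-reflexive (ListP.length-map onto N))

      module _ (J : MaximalLineIdeal uN N-narrow) where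
        private
          module J = MaximalLineIdeal J
          b = J.a

        bs-sort = sort-chain (down N b) (UniqueP.filter⁺ (_≤ᵖ? b) uN) (ideal-comparable J.ideal)
        bs = proj₁ bs-sort

        bs⇒ : ∀ {x} → x ∈ bs → x ∈ N × x ≤ᵖ b
        bs⇒ m = ∈-filter⁻ (_≤ᵖ? b) {xs = N} (∈-resp-↭ (proj₁ (proj₂ bs-sort)) m)

        bs⇐ : ∀ {x} → x ∈ N → x ≤ᵖ b → x ∈ bs
        bs⇐ m le = ∈-resp-↭ (↭-sym (proj₁ (proj₂ bs-sort))) (∈-filter⁺ (_≤ᵖ? b) m le)

        _∈?_ = Mem._∈?_ (_≟ᵖ_ {d})

        rs = filter (λ x → ¬? (x ∈? bs)) Q

        rs⇒ : ∀ {x} → x ∈ rs → x ∈ Q × x ∉ bs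
        rs⇒ = ∈-filter⁻ (λ x → ¬? (x ∈? bs)) {xs = Q}

        Q-of : ∀ {x} → x ∈ bs ++ rs → x ∈ Q
        Q-of m with ∈-++⁻ bs m
        ... | inj₁ m′ = proj₁ (N⇒ (proj₁ (bs⇒ m′)))
        ... | inj₂ m′ = proj₁ (rs⇒ m′)

        of-Q : ∀ {x} → x ∈ Q → x ∈ bs ++ rs
        of-Q {x} m with x ∈? bs
        ... | yes b∈ = ∈-++⁺ˡ b∈
        ... | no b∉ = ∈-++⁺ʳ bs (∈-filter⁺ (λ x → ¬? (x ∈? bs)) m b∉)

        bs-unique : Unique (bs ++ rs)
        bs-unique = UniqueP.++⁺ (AllPairs.map proj₂ (proj₂ (proj₂ bs-sort))) (UniqueP.filter⁺ (λ x → ¬? (x ∈? bs)) uQ)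
          (λ (m , m′) → proj₂ (rs⇒ m′) m)

        Q-length : length (bs ++ rs) ≡ length Q
        Q-length = ↭-length (unique-set⇒↭ bs-unique uQ Q-of of-Q)

        decomposition : Decomposition P
        decomposition = record
          { as = as ; bs = bs ; rs = rs ; cut = length as₁
          ; P-unique = uP
          ; P↭ = unique-set⇒↭ uP (UniqueP.++⁺ (AllPairs.map proj₂ as-sorted) bs-unique
                   (λ (m , m′) → proj₂ (Q⇒ (Q-of m′)) (proj₂ (as⇒ m)))) to from
          ; as-sorted = as-sorted
          ; bs-sorted = proj₂ (proj₂ bs-sort)
          ; not-below-as = λ q∈ a∈ lt → proj₂ (Q⇒ (Q-of q∈)) (≤ᵖ-trans (proj₁ lt) (proj₂ (as⇒ a∈)))
          ; not-below-bs = λ q∈ b∈ lt → proj₂ (rs⇒ q∈) (bs⇐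
              (N⇐ (proj₁ (rs⇒ q∈)) (λ le → proj₂ (N⇒ (proj₁ (bs⇒ b∈))) (≤ᵖ-trans le (proj₁ lt))))
              (≤ᵖ-trans (proj₁ lt) (proj₂ (bs⇒ b∈))))
          ; not-above-cut = λ m b∈ lt → proj₂ (N⇒ (proj₁ (bs⇒ b∈))) (≤ᵖ-trans (above-c m) (proj₁ lt))
          }
          where
          to : ∀ {x} → x ∈ P → x ∈ as ++ bs ++ rs
          to {x} m with x ≤ᵖ? a
          ... | yes le = ∈-++⁺ˡ (as⇐ m le)
          ... | no n = ∈-++⁺ʳ as (of-Q (Q⇐ m n))
          from : ∀ {x} → x ∈ as ++ bs ++ rs → x ∈ P
          from m with ∈-++⁻ as m
          ... | inj₁ m′ = proj₁ (as⇒ m′)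
          ... | inj₂ m′ = proj₁ (Q⇒ (Q-of m′))
          above-c : ∀ {x} → x ∈ drop (length as₁) as → c ≤ᵖ x
          above-c {x} m with subst (x ∈_) (trans (cong (drop (length as₁)) as≡) (drop-++ as₁)) m
            where
            drop-++ : ∀ (xs : List (Pt d)) {ys} → drop (length xs) (xs ++ ys) ≡ ys
            drop-++ [] = refl
            drop-++ (_ ∷ xs) = drop-++ xs
          ... | here refl = ≤ᵖ-refl
          ... | there m′ = proj₁ (tail-above as₁ (subst (AllPairs _<ᵖ_) as≡ as-sorted) m′)
            where
            tail-above : ∀ xs {x y ys} → AllPairs _<ᵖ_ (xs ++ x ∷ ys) → y ∈ ys → x <ᵖ y
            tail-above [] (s ∷ _) m = All.lookup s m
            tail-above (_ ∷ xs) (_ ∷ ss) m = tail-above xs ss m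

-- Probabilities

-- A positive ε has numerator at least 1, so it is at least the reciprocal of its denominator, which
-- serves as K.
frac-lower : ∀ ε → 0ℚ <ℚ ε → ∀ c Λ → 0 < Λ → ↧ₙ ε * Λ < 2 * (↧ₙ ε * c) + 2 * Λ → (½ - ε) <ℚ frac c Λ
frac-lower ε@(mkℚ (ℤ.+ zero) k _) (ℚ.*<* (ℤ.+<+ lt)) c Λ _ _ = contradiction lt λ ()
frac-lower ε@(mkℚ ℤ.-[1+ n ] k _) (ℚ.*<* ()) c Λ _ _
frac-lower ε@(mkℚ (ℤ.+ suc a) k _) _ c (suc n) _ h = subst ((½ - ε) <ℚ_) cancel (ℚP.+-monoˡ-< (ℚ.- ε) half<)
  where
  q = frac c (suc n)
  cancel : q ℚ.+ ε ℚ.+ ℚ.- ε ≡ q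
  cancel = trans (ℚP.+-assoc q ε (ℚ.- ε)) (trans (cong (q ℚ.+_) (ℚP.+-inverseʳ ε)) (ℚP.+-identityʳ q))
  nat : 1 * (suc n * suc k) < (c * suc k + suc a * suc n) * 2
  nat = begin-strict
    1 * (suc n * suc k)  ≡⟨ lem₁ (suc n) (suc k) ⟩
    suc k * suc n  <⟨ h ⟩
    2 * (suc k * c) + 2 * suc n  ≤⟨ +-monoʳ-≤ (2 * (suc k * c)) (*-monoʳ-≤ 2 (m≤n*m (suc n) (suc a))) ⟩
    2 * (suc k * c) + 2 * (suc a * suc n)  ≡⟨ lem₂ (suc k) c (suc a * suc n) ⟩
    (c * suc k + suc a * suc n) * 2  ∎
    where
    open ≤-Reasoning
    lem₁ : ∀ x y → 1 * (x * y) ≡ y * x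
    lem₁ = solve-∀
    lem₂ : ∀ x y z → 2 * (x * y) + 2 * z ≡ (y * x + z) * 2
    lem₂ = solve-∀
  int : ℤ.+ 1 ℤ.* (ℤ.+ suc n ℤ.* ℤ.+ suc k) ℤ.< (ℤ.+ c ℤ.* ℤ.+ suc k ℤ.+ ℤ.+ suc a ℤ.* ℤ.+ suc n) ℤ.* ℤ.+ 2
  int = subst₂ ℤ._<_ (trans (ℤP.pos-* 1 (suc n * suc k)) (cong (ℤ.+ 1 ℤ.*_) (ℤP.pos-* (suc n) (suc k))))
    (trans (ℤP.pos-* (c * suc k + suc a * suc n) 2) (cong (ℤ._* ℤ.+ 2) (trans (ℤP.pos-+ (c * suc k) (suc a * suc n))
      (cong₂ ℤ._+_ (ℤP.pos-* c (suc k)) (ℤP.pos-* (suc a) (suc n)))))) (ℤ.+<+ nat)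
  half< : ½ <ℚ q ℚ.+ ε
  half< = ℚP.toℚᵘ-cancel-< (ℚᵘP.<-respʳ-≃ (ℚᵘP.≃-sym (ℚᵘP.≃-trans (ℚP.toℚᵘ-homo-+ q ε)
      (ℚᵘP.+-congˡ (toℚᵘ ε) (ℚP.toℚᵘ-fromℚᵘ (mkℚᵘ (ℤ.+ c) n)))))
    (ℚᵘ.*<* int))

foldr-⊔-upper : ∀ (qs : List ℚ) {q} → q ∈ qs → q ℚ.≤ foldr ℚ._⊔_ 0ℚ qs
foldr-⊔-upper (q ∷ qs) (here refl) = ℚP.p≤p⊔q q _
foldr-⊔-upper (q ∷ qs) (there m) = ℚP.≤-trans (foldr-⊔-upper qs m) (ℚP.p≤q⊔p q _)

count-flip : ∀ {d} {P : List (Pt d)} {x y : Pt d} → x ∈ P → y ∈ P → x ≢ y →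
  countBefore P x y + countBefore P y x ≡ length (linExts P)
count-flip {P = P} {x} {y} x∈ y∈ x≢y = trans (sym (∑-+ (linExts P) _ _))
  (trans (∑-cong (linExts P) one) (trans (∑-const (linExts P) 1) (*-identityʳ _)))
  where
  one : ∀ {L} → L ∈ linExts P → 𝟙 (beforeᵇ x y L Bool.≟ true) + 𝟙 (beforeᵇ y x L Bool.≟ true) ≡ 1
  one {L} m rewrite before-flip L x≢y (∈-resp-↭ (↭-sym (proj₁ (linExts⇒ {P = P} m))) x∈) (∈-resp-↭ (↭-sym (proj₁ (linExts⇒ {P = P} m))) y∈)
    with beforeᵇ x y L
  ... | true = refl
  ... | false = refl

balanced⇒δ : ∀ {d} {P : List (Pt d)} ε → 0ℚ <ℚ ε → Balanced P (↧ₙ ε) → (½ - ε) <ℚ δ P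
balanced⇒δ {P = P} ε ε>0 B = ℚP.<-≤-trans (min< (ℚP.⊓-sel (prob P x y) (prob P y x))) (foldr-⊔-upper _ member)
  where
  open Balanced B
  K = ↧ₙ ε
  Λ = length (linExts P)
  prob-lower : ∀ u v → K * Λ < 2 * (K * countBefore P u v) + 2 * Λ → (½ - ε) <ℚ prob P u v
  prob-lower u v h = frac-lower ε ε>0 _ Λ nonempty
    (subst (λ c → K * Λ < 2 * (K * c) + 2 * Λ) (sym (filterᵇ-count (beforeᵇ u v) (linExts P))) h)
  upper′ : Λ ≤ 2 * countBefore P y x
  upper′ = +-cancelˡ-≤ (2 * countBefore P x y) _ _ (begin
    2 * countBefore P x y + Λ  ≤⟨ +-monoˡ-≤ Λ upper ⟩
    Λ + Λ  ≡⟨ cong (λ z → Λ + z) (+-identityʳ Λ) ⟨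
    2 * Λ  ≡⟨ cong (2 *_) (count-flip {P = P} x∈ y∈ x≢y) ⟨
    2 * (countBefore P x y + countBefore P y x)  ≡⟨ *-distribˡ-+ 2 (countBefore P x y) _ ⟩
    2 * countBefore P x y + 2 * countBefore P y x  ∎)
    where open ≤-Reasoning
  lower′ : K * Λ < 2 * (K * countBefore P y x) + 2 * Λ
  lower′ = begin-strict
    K * Λ  ≤⟨ *-monoʳ-≤ K upper′ ⟩
    K * (2 * countBefore P y x)  ≡⟨ *-x∙yz≈y∙xz K 2 (countBefore P y x) ⟩
    2 * (K * countBefore P y x)  <⟨ m<m+n _ (*-mono-≤ {1} {2} (s≤s z≤n) nonempty) ⟩
    2 * (K * countBefore P y x) + 2 * Λ  ∎
    where open ≤-Reasoning
  min< : prob P x y ℚ.⊓ prob P y x ≡ prob P x y ⊎ prob P x y ℚ.⊓ prob P y x ≡ prob P y x → (½ - ε) <ℚ δxy P x y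
  min< (inj₁ e) = subst ((½ - ε) <ℚ_) (sym e) (prob-lower x y lower)
  min< (inj₂ e) = subst ((½ - ε) <ℚ_) (sym e) (prob-lower y x lower′)
  member : δxy P x y ∈ concatMap (λ x → map (δxy P x) (filterᵇ (λ y → not (eqᵇ x y)) P)) P
  member = ∈-concatMap⁺ _ (Any.map (λ { refl → ∈-map⁺ (δxy P x)
    (∈-filter⁺ (λ z → T? (not (eqᵇ x z))) y∈ (subst (λ b → Bool.T (not b)) (sym (eqᵇ-≢ x≢y)) _)) }) x∈)

-- The sizes of the two chains relative to the poset

module Large (d w : ℕ) (1≤d : 1 ≤ d) (C₁ C : ℕ)
  (C₁≡ : w * suc (d * (suc (d * w) + w)) ≡ C₁) (C≡ : 2 * C₁ ≡ C) (C>0 : 0 < C) where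

  -- `ideal-size` is applied once to `P` and once to `N`. The second alternative of `N-large` costs
  -- a factor 2, so C is twice C₁; a poset with more than 8C elements has g positive.
  sized : (P : List (Pt d)) → Unique P → Convex P →
    (Σ ℕ λ k → IsWidth P k × 2 ≤ k × k ≤ w) → C * 8 < length P → SizedDecomposition P C
  sized P uP cvx (k , ((anti , anti-P , refl) , widest) , 2≤k , k≤w) big =
    cut-at (proj₁ split) (proj₁ (proj₂ split)) (proj₁ (proj₂ (proj₂ split)))
      (proj₁ (proj₂ (proj₂ (proj₂ split)))) (proj₂ (proj₂ (proj₂ (proj₂ split))))
    where
    C₁≤C : C₁ ≤ C
    C₁≤C = ≤-trans (m≤n*m C₁ 2) (≤-reflexive C≡)
    narrow : ∀ A → IsAntichain P A → length A ≤ w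
    narrow A i = ≤-trans (widest A i) k≤w
    axis : Fin d
    axis = fromℕ< 1≤d
    P≢[] : P ≢ []
    P≢[] e = contradiction (subst (λ xs → C * 8 < length xs) e big) λ ()
    I = maximalLineIdeal uP narrow axis P≢[]
    module S = Decompose uP narrow cvx I
    m = length S.as
    p≤ : length P ≤ C₁ * m
    p≤ = subst₂ (λ x z → length P ≤ x * z) C₁≡ (sym (↭-length S.as↭)) (ideal-size uP narrow cvx I)
    p≤C : length P ≤ C * m
    p≤C = ≤-trans p≤ (*-monoˡ-≤ m C₁≤C)
    8<m : 8 < m
    8<m = *-cancelˡ-< C 8 m (<-≤-trans big p≤C)
    g = m / 8
    lo : 8 * g ≤ m
    lo = ≤-trans (≤-reflexive (*-comm 8 g)) (m/n*n≤m m 8)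
    hi : m ≤ 8 * g + 7
    hi = ≤-trans (≤-reflexive (m≡m%n+[m/n]*n m 8)) (≤-trans (+-monoˡ-≤ (g * 8) (≤-pred (m%n<n m 8)))
      (≤-reflexive (trans (+-comm 7 (g * 8)) (cong (_+ 7) (*-comm g 8)))))
    g>0 : 0 < g
    g>0 = positive g hi
      where
      positive : ∀ g → m ≤ 8 * g + 7 → 0 < g
      positive zero le = contradiction (≤-trans (<⇒≤ 8<m) le) λ { (s≤s (s≤s (s≤s (s≤s (s≤s (s≤s (s≤s ()))))))) }
      positive (suc _) _ = s≤s z≤n
    2g<m : 2 * g < m
    2g<m = <-≤-trans (*-monoˡ-< g {{>-nonZero g>0}} {2} {8} (s≤s (s≤s (s≤s z≤n)))) lo
    -- Width at least 2 enters here: two incomparable elements cannot both belong to the chain `as`.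
    Q-nonempty : 0 < length S.Q
    Q-nonempty = pair anti 2≤k anti-P
      where
      open MaximalLineIdeal I using (a; ideal)
      pair : ∀ A → 2 ≤ length A → IsAntichain P A → 0 < length S.Q
      pair (x ∷ []) (s≤s ()) _
      pair (x ∷ y ∷ A) _ (sub , ((n , n′) ∷ _) ∷ _) with x ≤ᵖ? a | y ≤ᵖ? a
      ... | no x≰ | _ = ∈⇒nonempty (S.Q⇐ (sub (here refl)) x≰)
      ... | yes _ | no y≰ = ∈⇒nonempty (S.Q⇐ (sub (there (here refl))) y≰)
      ... | yes x≤ | yes y≤ with ideal-comparable ideal (∈-filter⁺ (_≤ᵖ? a) (sub (here refl)) x≤) (∈-filter⁺ (_≤ᵖ? a) (sub (there (here refl))) y≤)
      ...   | inj₁ le = contradiction le n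
      ...   | inj₂ le = contradiction le n′
    split = split-at S.as (2 * g) 2g<m
    cut-at : ∀ as₁ c as₂ → S.as ≡ as₁ ++ c ∷ as₂ → length as₁ ≡ 2 * g → SizedDecomposition P C
    cut-at as₁ c as₂ as≡ len = record
      { D = T.decomposition J ; g = g ; cut≡ = len ; lo = lo ; hi = hi ; β>0 = β>0 ; P≤ = p≤C ; β-large = β-large }
      where
      module T = S.Cut as₁ c as₂ as≡
      N>0 : 0 < length T.N
      N>0 = pick T.N-large
        where
        pick : length as₁ ≤ length T.N ⊎ length S.Q ≤ 2 * length T.N → 0 < length T.N
        pick (inj₁ le) = ≤-trans (≤-trans (*-mono-≤ {1} {2} (s≤s z≤n) g>0) (≤-reflexive (sym len))) le
        pick (inj₂ le) = *-cancelˡ-< 2 0 _ (≤-trans Q-nonempty le)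
      N≢[] : T.N ≢ []
      N≢[] e = contradiction (subst (λ xs → 0 < length xs) e N>0) λ ()
      J = maximalLineIdeal T.uN T.N-narrow axis N≢[]
      β = length (T.bs J)
      N≤ : length T.N ≤ C₁ * β
      N≤ = subst₂ (λ x z → length T.N ≤ x * z) C₁≡ (sym (↭-length (proj₁ (proj₂ (T.bs-sort J))))) (ideal-size T.uN T.N-narrow T.N-convex J)
      β>0 : 0 < β
      β>0 = *-cancelˡ-< C₁ 0 β (≤-trans (≤-<-trans (≤-reflexive (*-zeroʳ C₁)) N>0) N≤)
      β-large : 2 * g ≤ C * β ⊎ length (T.bs J ++ T.rs J) ≤ C * β
      β-large = pick T.N-large
        where
        pick : length as₁ ≤ length T.N ⊎ length S.Q ≤ 2 * length T.N → 2 * g ≤ C * β ⊎ length (T.bs J ++ T.rs J) ≤ C * β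
        pick (inj₁ le) = inj₁ (≤-trans (≤-reflexive (sym len)) (≤-trans le (≤-trans N≤ (*-monoˡ-≤ β C₁≤C))))
        pick (inj₂ le) = inj₂ (≤-trans (≤-reflexive (T.Q-length J)) (≤-trans le (≤-trans (*-monoʳ-≤ 2 N≤) (≤-reflexive (trans (sym (*-assoc 2 C₁ β)) (cong (_* β) C≡))))))

theorem1p8 : (d w : ℕ) → 1 ≤ d → 1 ≤ w →
    (ε : ℚ) → 0ℚ <ℚ ε →
    ∃[ N ] ((P : List (Pt d)) →
    Unique P →
    All (AllV (1 ≤_)) P →
    Convex P →
    (Σ ℕ λ k → IsWidth P k × 2 ≤ k × k ≤ w) →
    N < length P →
    (½ - ε) <ℚ δ P)
-- The first summand makes `as` longer than `threshold`; the second ensures that `as` can be cut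
-- into eighths.
theorem1p8 d w 1≤d 1≤w ε ε>0 = C * Sizes.threshold C (↧ₙ ε) C>0 (s≤s z≤n) + C * 8 ,
  λ P uP _ cvx width big → balanced⇒δ ε ε>0 (many-elements-balanced C (↧ₙ ε) C>0 (s≤s z≤n) (linExts-nonempty {P = P})
    (Large.sized d w 1≤d C₁ C refl refl C>0 P uP cvx width (≤-<-trans (m≤n+m (C * 8) _) big))
    (≤-<-trans (m≤m+n _ (C * 8)) big))
  where
  C₁ = w * suc (d * (suc (d * w) + w))
  C = 2 * C₁
  C>0 : 0 < C
  C>0 = *-mono-≤ {1} {2} (s≤s z≤n) (*-mono-≤ 1≤w (s≤s z≤n))
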